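{- Let $0\leq\varepsilon_c<\varepsilon_f\leq1$ and let $g=\varepsilon_f-\varepsilon_c$. There exists a one-round $(\varepsilon_c,\varepsilon_f)$-IPP for Hamming-weight verification on inputs of length $n$ with verifier query complexity $\widetilde{O}(1/g^{4/3})$, honest-prover query complexity $O(1/g^2)$, and communication complexity $O(\log n)+\widetilde{O}(1/g^{4/3})$. In the regime $1/g^2=o(n)$, the protocol is doubly sublinear.
   Context: For $x\in\{0,1\}^n$ let $\mathrm{wt}(x)=\frac1n\sum_i x_i$. Parties access $x$ through an oracle returning $x_i$ on query $i$; all parameters are known explicitly. An $(\varepsilon_c,\varepsilon_f)$-IPP for Hamming-weight verification consists of a probabilistic oracle verifier $V$ and a designated probabilistic honest prover $P_h$ (also having only oracle access to $x$) such that for every $n$, every $x\in\{0,1\}^n$ and every claimed absolute weight $\sigma\in\{0,\dots,n\}$: (completeness) if $|\mathrm{wt}(x)-\sigma/n|\leq\varepsilon_c$ then $V$ interacting with $P_h$ accepts with probability at least $2/3$; (soundness) if $|\mathrm{wt}(x)-\sigma/n|>\varepsilon_f$ then for every (computationally unbounded, possibly knowing $x$ entirely) prover $P^*$, $V$ accepts with probability at most $1/3$. One round means one verifier message followed by one prover message. Oracle queries of the verifier and of the designated honest prover are counted separately (those of the honest prover only on completeness instances); communication counts all bits sent in both directions. An IPP is doubly sublinear in a parameter regime if both the verifier and the designated honest prover make $o(n)$ oracle queries in that regime. $\widetilde{O}(\cdot)$ suppresses polylogarithmic factors. -}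

module Defs where

import Algebra.Definitions.RawSemiring
open import Data.Bool.Base using (Bool; if_then_else_)
open import Data.Fin.Base using (Fin; toℕ)
open import Data.Integer.Base as ℤ using (+_)
open import Data.Nat.Base as ℕ using (ℕ; suc; NonZero)
import Data.Integer.Solver as ℤ
import Data.Nat.Properties as ℕ
open import Data.Nat.Logarithm using (⌈log₂_⌉)
open import Data.Product.Base using (_×_; _,_; proj₁; proj₂; Σ-syntax; ∃-syntax)
open import Data.Rational.Base
  using (ℚ; _/_; _+_; _-_; _*_; 1/_; ∣_∣; _≤_; _<_; toℚᵘ; 0ℚ; 1ℚ; Positive; ceiling; +-*-rawSemiring)
import Data.Rational.Properties as ℚ
open import Data.Rational.Unnormalised.Base as ℚᵘ using (mkℚᵘ; *≡*)
import Data.Rational.Unnormalised.Properties as ℚᵘ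
open import Data.Rational.Solver using (module +-*-Solver)
open import Data.Vec.Base as Vec using (Vec; lookup; tabulate)
open import Relation.Binary.PropositionalEquality using (_≡_; refl; sym; cong; cong₂; subst)

open Algebra.Definitions.RawSemiring +-*-rawSemiring using (_^_)

-- Real numbers as Bishop's regular sequences, approx n being within
-- 1/(n+1) of the number represented.

radius : ℕ → ℚ
radius n = + 1 / suc n

record ℝ : Set where
  field
    approx  : ℕ → ℚ
    regular : ∀ m n → ∣ approx m - approx n ∣ ≤ radius m + radius n

open ℝ public

infix 4 _≤ʳ_ _<ʳ_

_≤ʳ_ _<ʳ_ : ℝ → ℝ → Set
a ≤ʳ b = ∀ n → approx a n ≤ approx b n + (radius n + radius n)
a <ʳ b = ∃[ n ] approx a n + (radius n + radius n) < approx b n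

radius≥0 : ∀ n → 0ℚ ≤ radius n
radius≥0 n = ℚ.<⇒≤ (ℚ.positive⁻¹ (radius n) {{ℚ.normalize-pos 1 (suc n)}})

fromℚ : ℚ → ℝ
fromℚ q .approx _ = q
fromℚ q .regular m n =
  subst (_≤ radius m + radius n) (sym (cong ∣_∣ (ℚ.+-inverseʳ q)))
    (ℚ.+-mono-≤ (radius≥0 m) (radius≥0 n))

double : ℕ → ℕ
double n = n ℕ.+ suc n

radius-double : ∀ n → radius (double n) + radius (double n) ≡ radius n
radius-double n = ℚ.toℚᵘ-injective (begin
  toℚᵘ (ρ + ρ)          ≈⟨ ℚ.toℚᵘ-homo-+ ρ ρ ⟩
  toℚᵘ ρ ℚᵘ.+ toℚᵘ ρ    ≈⟨ ℚᵘ.+-cong ρ≃u ρ≃u ⟩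
  u ℚᵘ.+ u              ≈⟨ *≡* (halves (+ suc n)) ⟩
  mkℚᵘ (+ 1) n          ≈⟨ ℚ.toℚᵘ-fromℚᵘ (mkℚᵘ (+ 1) n) ⟨
  toℚᵘ (radius n)       ∎)
  where
  open import Relation.Binary.Reasoning.Setoid ℚᵘ.≃-setoid
  open ℤ.+-*-Solver
  ρ = radius (double n)
  u = mkℚᵘ (+ 1) (double n)
  ρ≃u : toℚᵘ ρ ℚᵘ.≃ u
  ρ≃u = ℚ.toℚᵘ-fromℚᵘ u
  halves : ∀ z → (+ 1 ℤ.* (z ℤ.+ z) ℤ.+ + 1 ℤ.* (z ℤ.+ z)) ℤ.* z
               ≡ + 1 ℤ.* ((z ℤ.+ z) ℤ.* (z ℤ.+ z))
  halves = solve 1 (λ z → (con (+ 1) :* (z :+ z) :+ con (+ 1) :* (z :+ z)) :* z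
                        := con (+ 1) :* ((z :+ z) :* (z :+ z))) refl

-- Doubling the precision of both arguments makes the difference regular.
infixl 6 _-ʳ_

_-ʳ_ : ℝ → ℝ → ℝ
(a -ʳ b) .approx n = approx a (double n) - approx b (double n)
(a -ʳ b) .regular m n = begin
  ∣ (a′ m - b′ m) - (a′ n - b′ n) ∣       ≡⟨ cong ∣_∣ (swap (a′ m) (b′ m) (a′ n) (b′ n)) ⟩
  ∣ (a′ m - a′ n) - (b′ m - b′ n) ∣       ≤⟨ ℚ.∣p-q∣≤∣p∣+∣q∣ (a′ m - a′ n) (b′ m - b′ n) ⟩
  ∣ a′ m - a′ n ∣ + ∣ b′ m - b′ n ∣       ≤⟨ ℚ.+-mono-≤ (regular a (double m) (double n))
                                                        (regular b (double m) (double n)) ⟩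
  (ρ m + ρ n) + (ρ m + ρ n)               ≡⟨ pair (ρ m) (ρ n) ⟩
  (ρ m + ρ m) + (ρ n + ρ n)               ≡⟨ cong₂ _+_ (radius-double m) (radius-double n) ⟩
  radius m + radius n                     ∎
  where
  open ℚ.≤-Reasoning
  open +-*-Solver
  a′ b′ ρ : ℕ → ℚ
  a′ k = approx a (double k)
  b′ k = approx b (double k)
  ρ k = radius (double k)
  swap : ∀ p q r s → (p - q) - (r - s) ≡ (p - r) - (q - s)
  swap = solve 4 (λ p q r s → (p :- q) :- (r :- s) := (p :- r) :- (q :- s)) refl
  pair : ∀ p q → (p + q) + (p + q) ≡ (p + p) + (q + q)
  pair = solve 2 (λ p q → (p :+ q) :+ (p :+ q) := (p :+ p) :+ (q :+ q)) refl

-- A deterministic oracle algorithm on n-bit inputs is a decision tree.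
data Algorithm (n : ℕ) (A : Set) : Set where
  output : A → Algorithm n A
  query  : Fin n → (Bool → Algorithm n A) → Algorithm n A

run : ∀ {n A} → Algorithm n A → Vec Bool n → A
run (output a)  x = a
run (query i k) x = run (k (lookup x i)) x

queries : ∀ {n A} → Algorithm n A → Vec Bool n → ℕ
queries (output a)  x = 0
queries (query i k) x = suc (queries (k (lookup x i)) x)

-- A randomised algorithm is a uniformly random choice, from a nonempty
-- finite set, of a deterministic one.  The choices of the two parties are
-- independent and private.
--
-- After its message (of v bits) the verifier continues with an algorithm
-- that depends on the prover's reply (of p bits) and may remember
-- everything seen before.
record Verifier (n v p : ℕ) : Set where
  field
    coins       : ℕ
    {{coins≢0}} : NonZero coins
    strategy    : Fin coins → Algorithm n (Vec Bool v × (Vec Bool p → Algorithm n Bool))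

  message : Fin coins → Vec Bool n → Vec Bool v
  message r x = proj₁ (run (strategy r) x)

  decision : Fin coins → Vec Bool n → Vec Bool p → Algorithm n Bool
  decision r x = proj₂ (run (strategy r) x)

record Prover (n v p : ℕ) : Set where
  field
    coins       : ℕ
    {{coins≢0}} : NonZero coins
    strategy    : Fin coins → Vec Bool v → Algorithm n (Vec Bool p)

bit : Bool → ℕ
bit b = if b then 1 else 0

module _ {n v p : ℕ} (V : Verifier n v p) (P : Prover n v p) (x : Vec Bool n) where
  private
    module V = Verifier V
    module P = Prover P

  accepts : Fin V.coins → Fin P.coins → Bool
  accepts r s = run (V.decision r x (run (P.strategy s (V.message r x)) x)) x

  Pr[accept] : ℚ
  Pr[accept] = (+ Vec.sum (tabulate λ r → Vec.sum (tabulate λ s → bit (accepts r s))))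
               / (V.coins ℕ.* P.coins)
    where instance _ = ℕ.m*n≢0 V.coins P.coins

wt : ∀ {n} .{{_ : NonZero n}} → Vec Bool n → ℚ
wt {n} x = + Vec.sum (Vec.map bit x) / n

deviation : ∀ {n} .{{_ : NonZero n}} → Vec Bool n → Fin (suc n) → ℚ
deviation {n} x σ = ∣ wt x - + toℕ σ / n ∣

record Tolerances : Set where
  field
    εc εf : ℝ
    0≤εc  : fromℚ 0ℚ ≤ʳ εc
    εc<εf : εc <ʳ εf
    εf≤1  : εf ≤ʳ fromℚ 1ℚ

open Tolerances public

gap : Tolerances → ℝ
gap t = εf t -ʳ εc t

record OneRoundIPP (t : Tolerances) : Set where
  field
    verifierBits proverBits : ∀ n .{{_ : NonZero n}} → Fin (suc n) → ℕ
    verifier     : ∀ n .{{_ : NonZero n}} (σ : Fin (suc n)) →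
                   Verifier n (verifierBits n σ) (proverBits n σ)
    honestProver : ∀ n .{{_ : NonZero n}} (σ : Fin (suc n)) →
                   Prover n (verifierBits n σ) (proverBits n σ)
    completeness : ∀ n .{{_ : NonZero n}} (σ : Fin (suc n)) (x : Vec Bool n) →
                   fromℚ (deviation x σ) ≤ʳ εc t →
                   + 2 / 3 ≤ Pr[accept] (verifier n σ) (honestProver n σ) x
    -- P* is chosen after x, so its strategy may depend on all of x.
    soundness    : ∀ n .{{_ : NonZero n}} (σ : Fin (suc n)) (x : Vec Bool n) →
                   εf t <ʳ fromℚ (deviation x σ) →
                   ∀ (P* : Prover n (verifierBits n σ) (proverBits n σ)) →
                   Pr[accept] (verifier n σ) P* x ≤ + 1 / 3

-- A bound is a predicate that every execution's count must satisfy.  The verifier's counts range over all replies, hence over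
-- all provers; the honest prover's only over completeness instances.

module _ {t : Tolerances} (Π : OneRoundIPP t) (n : ℕ) .{{_ : NonZero n}} where
  open OneRoundIPP Π

  VerifierQueries : (ℕ → Set) → Set
  VerifierQueries Bound =
    ∀ (σ : Fin (suc n)) (x : Vec Bool n) →
    let open Verifier (verifier n σ) in
    ∀ (r : Fin coins) (reply : Vec Bool (proverBits n σ)) →
    Bound (queries (strategy r) x ℕ.+ queries (decision r x reply) x)

  HonestProverQueries : (ℕ → Set) → Set
  HonestProverQueries Bound =
    ∀ (σ : Fin (suc n)) (x : Vec Bool n) → fromℚ (deviation x σ) ≤ʳ εc t →
    let module V = Verifier (verifier n σ)
        module P = Prover (honestProver n σ) in
    ∀ (r : Fin V.coins) (s : Fin P.coins) →
    Bound (queries (P.strategy s (V.message r x)) x)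

  Communication : (ℕ → Set) → Set
  Communication Bound =
    ∀ (σ : Fin (suc n)) → Bound (verifierBits n σ ℕ.+ proverBits n σ)

fromℕ : ℕ → ℚ
fromℕ m = + m / 1

log⁺1/ : (r : ℚ) .{{_ : Positive r}} → ℕ
log⁺1/ r = suc ⌈log₂ ℤ.∣ ceiling (1/ r) ∣ ⌉
  where instance _ = ℚ.pos⇒nonZero r

-- For g > 0: m ≤ C/g², that is, m r² ≤ C for all rationals 0 < r < g.
_≤_/g²[_] : ℕ → ℕ → ℝ → Set
m ≤ C /g²[ g ] =
  ∀ (r : ℚ) .{{_ : Positive r}} → fromℚ r <ʳ g → fromℕ m * r ^ 2 ≤ fromℕ C

-- For 0 < g ≤ 1: m ≤ C (1 + log(1/g))ᵏ / g^(4/3), cubed and cleared of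
-- denominators, and tested on the rationals 0 < r < g.
Õ[1/_^4/3] : ℝ → (C k : ℕ) → ℕ → Set
Õ[1/ g ^4/3] C k m =
  ∀ (r : ℚ) .{{_ : Positive r}} → fromℚ r <ʳ g →
  fromℕ m ^ 3 * r ^ 4 ≤ fromℕ (C ℕ.* log⁺1/ r ℕ.^ k) ^ 3

-- For g > 0: 1/g² ≤ q, that is, 1 ≤ q s² for all rationals s > g.
1/g²[_]≤_ : ℝ → ℚ → Set
1/g²[ g ]≤ q = ∀ (s : ℚ) → g <ʳ fromℚ s → 1ℚ ≤ q * s ^ 2

-- The asymptotic regimes: input length and tolerances vary along a
-- sequence.  Tolerances given as functions of n are the case size j = suc j.
record Regime : Set where
  field
    size       : ℕ → ℕ
    {{size≢0}} : ∀ {j} → NonZero (size j)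
    tolerances : ℕ → Tolerances

Eventually : (ℕ → Set) → Set
Eventually A = ∃[ J ] (∀ j → J ℕ.≤ j → A j)

module _ (R : Regime) where
  open Regime R

  1/g²=o[n] : Set
  1/g²=o[n] = ∀ (η : ℚ) .{{_ : Positive η}} →
    Eventually λ j → 1/g²[ gap (tolerances j) ]≤ (η * fromℕ (size j))

  DoublySublinear : ((t : Tolerances) → OneRoundIPP t) → Set
  DoublySublinear Π = ∀ (δ : ℚ) .{{_ : Positive δ}} →
    Eventually λ j →
      let o[n] = λ m → fromℕ m ≤ δ * fromℕ (size j) in
      VerifierQueries     (Π (tolerances j)) (size j) o[n] ×
      HonestProverQueries (Π (tolerances j)) (size j) o[n]

{-# OPTIONS --safe #-}

-- Write g ≈ 8⁻ᶠ.  A pairwise independent hash with an O(log n)-bit seed draws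
-- O(1/g²) positions of x, whose mean is within O(g) of wt x by Chebyshev's
-- inequality.  The honest prover reads them and sends the number of ones in
-- each of O(2⁴ᶠ) = O(g^(-4/3)) blocks of 2²ᶠ positions.  If these numbers
-- pretend a wrong total, the block means err by Ω(g) on average.  By a layer
-- cake decomposition it suffices to look, for each dyadic θ ≤ 1, for blocks
-- erring by θ in O(θ/g) random blocks.  An error θ ≥ 2⁻ᶠ shows in Õ(θ⁻²)
-- samples of a block; for θ < 2⁻ᶠ the block is read entirely.  Both cost
-- Õ(g^(-4/3)).  A block raises an alarm only if O(f) independent estimates
-- agree that it errs, so honest blocks hardly ever do.

module Submission where

open import Data.Bool.Base using (Bool; true; false; _∧_; _∨_; not; _xor_; if_then_else_)
import Data.Bool.Properties as Bool
open import Data.Empty using (⊥-elim)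
open import Data.Fin.Base as Fin using (Fin; toℕ; _↑ˡ_; _↑ʳ_)
import Data.Fin.Properties as Fin
import Data.Integer.Base as ℤ
import Data.Integer.DivMod as ℤ
import Data.Integer.Properties as ℤ
open import Data.List.Base as List using (List; []; _∷_)
import Data.List.Properties as List
open import Data.Maybe.Base using (Maybe; just; nothing)
open import Data.Nat.Base as ℕ using (ℕ; zero; suc; NonZero)
open import Data.Nat.Logarithm as ℕ using (⌈log₂_⌉)
import Data.Nat.Logarithm.Core as ℕ
import Data.Nat.Properties as ℕ
import Data.Nat.Solver as ℕ
open import Data.Product.Base using (_×_; _,_; proj₁; proj₂; Σ-syntax; ∃-syntax)
open import Data.Rational.Base as ℚ
  using (ℚ; _/_; _+_; _-_; -_; _*_; 1/_; ∣_∣; _≤_; _<_; 0ℚ; 1ℚ; ½; Positive; toℚᵘ; positive; nonNegative; ceiling)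
import Data.Rational.Properties as ℚ
import Data.Rational.Solver as ℚ
open import Data.Rational.Unnormalised.Base as ℚᵘ using (mkℚᵘ; *≡*; *≤*)
import Data.Rational.Unnormalised.Properties as ℚᵘ
open import Data.Sum.Base using (_⊎_; inj₁; inj₂; [_,_]′)
open import Data.Vec.Base as Vec using (Vec; []; _∷_; _++_; lookup; tabulate)
import Data.Vec.Properties as Vec
open import Function.Base using (_∘_; case_of_)
open import Induction.WellFounded using (acc)
open import Relation.Binary.PropositionalEquality
  using (_≡_; _≢_; refl; sym; trans; cong; cong₂; subst; subst₂; module ≡-Reasoning)
open import Relation.Nullary using (¬_; Dec; yes; no; does)
open import Relation.Nullary.Decidable using (from-yes)
open import Defs

open ℚ.+-*-Solver using (solve; con; _:=_; _:+_; _:*_; _:-_; :-_)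
open ℕ.+-*-Solver using ()
  renaming (solve to ℕ-solve; con to ℕ-con; _:=_ to infix 4 _≔_; _:+_ to infixl 6 _⊕ₛ_; _:*_ to infixl 7 _⊗ₛ_)

-- Rational arithmetic

-- The exponent 4/3 comes from a balance. With 1/g² positions cut into blocks of length B, the reply
-- holds 1/(g² B) numbers. Sampling a block at scale θ costs θ⁻², which stops paying off at θ =
-- 1/√B, and hitting an erring block takes θ/g tries, so the dearest level costs √B/g. Both are
-- equal at B = g^(-2/3), which is 4ᶠ for g = 8⁻ᶠ; base 8 keeps all these powers integral.
--
-- The prover sees the hash seed but not the coins of the tests. Whether a seed misrepresents x does
-- not depend on the reply, so the bound on such seeds survives adaptive replies; for any other seed
-- the reply is fixed before a test coin matters, and soundness can be shown reply by reply.
--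
-- Pairwise independence gives only polynomial tails. Pushing the false alarms of honest blocks
-- below the inverse number of tests by larger samples would multiply the cost by a power of 1/g;
-- requiring independent estimates to agree multiplies it by polylogarithmic factors only.

0≤1 : 0ℚ ≤ 1ℚ
0≤1 = ℚ.nonNegative⁻¹ 1ℚ

0≤½ : 0ℚ ≤ ½
0≤½ = ℚ.nonNegative⁻¹ ½

-- Turns an inequality into a ring identity with an explicit slack `s`. Below, `s` is a nonnegative
-- combination of the hypotheses, so that the ring solver does the linear arithmetic.
≤-via : ∀ {p q} s → 0ℚ ≤ s → q ≡ p + s → p ≤ q
≤-via {p} s 0≤s refl = ℚ.≤-trans (ℚ.≤-reflexive (sym (ℚ.+-identityʳ p))) (ℚ.+-monoʳ-≤ p 0≤s)

0≤-diff : ∀ {p q} → p ≤ q → 0ℚ ≤ q - p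
0≤-diff {p} {q} p≤q = ℚ.≤-trans (ℚ.≤-reflexive (sym (ℚ.+-inverseʳ p))) (ℚ.+-monoˡ-≤ (- p) p≤q)

0≤+ : ∀ {p q} → 0ℚ ≤ p → 0ℚ ≤ q → 0ℚ ≤ p + q
0≤+ = ℚ.+-mono-≤

*-monoˡ : ∀ {r p q} → 0ℚ ≤ r → p ≤ q → r * p ≤ r * q
*-monoˡ {r} 0≤r = ℚ.*-monoˡ-≤-nonNeg r {{nonNegative 0≤r}}

*-monoʳ : ∀ {r p q} → 0ℚ ≤ r → p ≤ q → p * r ≤ q * r
*-monoʳ {r} 0≤r = ℚ.*-monoʳ-≤-nonNeg r {{nonNegative 0≤r}}

*-mono : ∀ {p q r s} → 0ℚ ≤ p → 0ℚ ≤ s → p ≤ q → r ≤ s → p * r ≤ q * s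
*-mono 0≤p 0≤s p≤q r≤s = ℚ.≤-trans (*-monoˡ 0≤p r≤s) (*-monoʳ 0≤s p≤q)

0≤* : ∀ {p q} → 0ℚ ≤ p → 0ℚ ≤ q → 0ℚ ≤ p * q
0≤* {p} 0≤p 0≤q = ℚ.≤-trans (ℚ.≤-reflexive (sym (ℚ.*-zeroʳ p))) (*-monoˡ 0≤p 0≤q)

p≤∣p∣ : ∀ p → p ≤ ∣ p ∣
p≤∣p∣ p with ℚ.≤-total 0ℚ p
... | inj₁ 0≤p = ℚ.≤-reflexive (sym (ℚ.0≤p⇒∣p∣≡p 0≤p))
... | inj₂ p≤0 = ℚ.≤-trans p≤0 (ℚ.0≤∣p∣ p)

-p≤∣p∣ : ∀ p → - p ≤ ∣ p ∣
-p≤∣p∣ p = ℚ.≤-trans (p≤∣p∣ (- p)) (ℚ.≤-reflexive (ℚ.∣-p∣≡∣p∣ p))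

∣p∣≤ : ∀ {p q} → p ≤ q → - p ≤ q → ∣ p ∣ ≤ q
∣p∣≤ {p} p≤q -p≤q with ℚ.∣p∣≡p∨∣p∣≡-p p
... | inj₁ eq = ℚ.≤-trans (ℚ.≤-reflexive eq) p≤q
... | inj₂ eq = ℚ.≤-trans (ℚ.≤-reflexive eq) -p≤q

∣p∣*∣p∣ : ∀ p → ∣ p ∣ * ∣ p ∣ ≡ p * p
∣p∣*∣p∣ p with ℚ.∣p∣≡p∨∣p∣≡-p p
... | inj₁ eq = cong₂ _*_ eq eq
... | inj₂ eq = trans (cong₂ _*_ eq eq) (solve 1 (λ p → :- p :* :- p := p :* p) refl p)

0≤p² : ∀ p → 0ℚ ≤ p * p
0≤p² p = ℚ.≤-trans (0≤* (ℚ.0≤∣p∣ p) (ℚ.0≤∣p∣ p)) (ℚ.≤-reflexive (∣p∣*∣p∣ p))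

∣∣-sub : ∀ p q r → ∣ p - r ∣ ≤ ∣ p - q ∣ + ∣ q - r ∣
∣∣-sub p q r = ℚ.≤-trans (ℚ.≤-reflexive (cong ∣_∣ (solve 3 (λ p q r → p :- r := (p :- q) :+ (q :- r)) refl p q r)))
                         (ℚ.∣p+q∣≤∣p∣+∣q∣ (p - q) (q - r))

∣∣-comm : ∀ p q → ∣ p - q ∣ ≡ ∣ q - p ∣
∣∣-comm p q = trans (cong ∣_∣ (solve 2 (λ p q → p :- q := :- (q :- p)) refl p q)) (ℚ.∣-p∣≡∣p∣ (q - p))

fromℕ≃ : ∀ m → toℚᵘ (fromℕ m) ℚᵘ.≃ mkℚᵘ (ℤ.+ m) 0
fromℕ≃ m = ℚ.toℚᵘ-fromℚᵘ (mkℚᵘ (ℤ.+ m) 0)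

fromℕ-+ : ∀ m n → fromℕ (m ℕ.+ n) ≡ fromℕ m + fromℕ n
fromℕ-+ m n = ℚ.toℚᵘ-injective (begin
  toℚᵘ (fromℕ (m ℕ.+ n))              ≈⟨ fromℕ≃ (m ℕ.+ n) ⟩
  mkℚᵘ (ℤ.+ (m ℕ.+ n)) 0                ≈⟨ *≡* (cong (ℤ._* ℤ.1ℤ) (cong₂ ℤ._+_ (sym (ℤ.*-identityʳ (ℤ.+ m))) (sym (ℤ.*-identityʳ (ℤ.+ n))))) ⟩
  mkℚᵘ (ℤ.+ m) 0 ℚᵘ.+ mkℚᵘ (ℤ.+ n) 0      ≈⟨ ℚᵘ.+-cong (fromℕ≃ m) (fromℕ≃ n) ⟨
  toℚᵘ (fromℕ m) ℚᵘ.+ toℚᵘ (fromℕ n)  ≈⟨ ℚ.toℚᵘ-homo-+ (fromℕ m) (fromℕ n) ⟨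
  toℚᵘ (fromℕ m + fromℕ n)            ∎)
  where open import Relation.Binary.Reasoning.Setoid ℚᵘ.≃-setoid

fromℕ-* : ∀ m n → fromℕ (m ℕ.* n) ≡ fromℕ m * fromℕ n
fromℕ-* m n = ℚ.toℚᵘ-injective (begin
  toℚᵘ (fromℕ (m ℕ.* n))              ≈⟨ fromℕ≃ (m ℕ.* n) ⟩
  mkℚᵘ (ℤ.+ (m ℕ.* n)) 0                ≈⟨ *≡* (cong (ℤ._* ℤ.1ℤ) (ℤ.pos-* m n)) ⟩
  mkℚᵘ (ℤ.+ m) 0 ℚᵘ.* mkℚᵘ (ℤ.+ n) 0      ≈⟨ ℚᵘ.*-cong (fromℕ≃ m) (fromℕ≃ n) ⟨
  toℚᵘ (fromℕ m) ℚᵘ.* toℚᵘ (fromℕ n)  ≈⟨ ℚ.toℚᵘ-homo-* (fromℕ m) (fromℕ n) ⟨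
  toℚᵘ (fromℕ m * fromℕ n)            ∎)
  where open import Relation.Binary.Reasoning.Setoid ℚᵘ.≃-setoid

fromℕ-mono : ∀ {m n} → m ℕ.≤ n → fromℕ m ≤ fromℕ n
fromℕ-mono {m} {n} m≤n = ℚ.toℚᵘ-cancel-≤
  (ℚᵘ.≤-respˡ-≃ (ℚᵘ.≃-sym (fromℕ≃ m)) (ℚᵘ.≤-respʳ-≃ (ℚᵘ.≃-sym (fromℕ≃ n))
    (*≤* (ℤ.*-monoʳ-≤-nonNeg (ℤ.+ 1) (ℤ.+≤+ m≤n)))))

0≤fromℕ : ∀ m → 0ℚ ≤ fromℕ m
0≤fromℕ m = fromℕ-mono {0} {m} ℕ.z≤n

/-as-* : ∀ m n .{{_ : NonZero n}} → (ℤ.+ m / n) * fromℕ n ≡ fromℕ m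
/-as-* m (suc n) = ℚ.toℚᵘ-injective (begin
  toℚᵘ ((ℤ.+ m / suc n) * fromℕ (suc n))            ≈⟨ ℚ.toℚᵘ-homo-* (ℤ.+ m / suc n) (fromℕ (suc n)) ⟩
  toℚᵘ (ℤ.+ m / suc n) ℚᵘ.* toℚᵘ (fromℕ (suc n))    ≈⟨ ℚᵘ.*-cong (ℚ.toℚᵘ-fromℚᵘ (mkℚᵘ (ℤ.+ m) n)) (fromℕ≃ (suc n)) ⟩
  mkℚᵘ (ℤ.+ m) n ℚᵘ.* mkℚᵘ (ℤ.+ suc n) 0              ≈⟨ *≡* (trans (ℤ.*-assoc (ℤ.+ m) (ℤ.+ suc n) (ℤ.+ 1)) (cong (ℤ.+ m ℤ.*_) (sym (ℤ.pos-* (suc n) 1)))) ⟩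
  mkℚᵘ (ℤ.+ m) 0                                    ≈⟨ fromℕ≃ m ⟨
  toℚᵘ (fromℕ m)                                  ∎)
  where open import Relation.Binary.Reasoning.Setoid ℚᵘ.≃-setoid

-- Powers of one half

infix 9 ½^_

½^_ : ℕ → ℚ
½^ zero  = 1ℚ
½^ suc k = ½ * ½^ k

½^-+ : ∀ j k → ½^ (j ℕ.+ k) ≡ ½^ j * ½^ k
½^-+ zero    k = sym (ℚ.*-identityˡ (½^ k))
½^-+ (suc j) k = trans (cong (½ *_) (½^-+ j k)) (sym (ℚ.*-assoc ½ (½^ j) (½^ k)))

½^-pos : ∀ k → 0ℚ < ½^ k
½^-pos zero    = ℚ.positive⁻¹ 1ℚ
½^-pos (suc k) = ℚ.positive⁻¹ (½ * ½^ k) {{ℚ.pos*pos⇒pos ½ (½^ k) {{positive (½^-pos k)}}}}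

0≤½^ : ∀ k → 0ℚ ≤ ½^ k
0≤½^ k = ℚ.<⇒≤ (½^-pos k)

½≤1 : ½ ≤ 1ℚ
½≤1 = ≤-via ½ 0≤½ refl

½^-≤1 : ∀ k → ½^ k ≤ 1ℚ
½^-≤1 zero    = ℚ.≤-refl
½^-≤1 (suc k) = *-mono 0≤½ 0≤1 ½≤1 (½^-≤1 k)

½^-antimono : ∀ {j k} → j ℕ.≤ k → ½^ k ≤ ½^ j
½^-antimono {j} {k} j≤k = ℚ.≤-trans
  (ℚ.≤-reflexive (trans (cong ½^_ (sym (ℕ.m+[n∸m]≡n j≤k))) (½^-+ j (k ℕ.∸ j))))
  (ℚ.≤-trans (*-monoˡ (0≤½^ j) (½^-≤1 (k ℕ.∸ j))) (ℚ.≤-reflexive (ℚ.*-identityʳ (½^ j))))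

2^*½^ : ∀ k → fromℕ (2 ℕ.^ k) * ½^ k ≡ 1ℚ
2^*½^ zero    = refl
2^*½^ (suc k) = begin
  fromℕ (2 ℕ.* 2 ℕ.^ k) * (½ * ½^ k)         ≡⟨ cong (_* (½ * ½^ k)) (fromℕ-* 2 (2 ℕ.^ k)) ⟩
  (fromℕ 2 * fromℕ (2 ℕ.^ k)) * (½ * ½^ k)   ≡⟨ solve 2 (λ a b → (con (fromℕ 2) :* a) :* (con ½ :* b) := a :* b) refl (fromℕ (2 ℕ.^ k)) (½^ k) ⟩
  fromℕ (2 ℕ.^ k) * ½^ k                     ≡⟨ 2^*½^ k ⟩
  1ℚ                                         ∎
  where
  open ≡-Reasoning

infix 4 _≤?_

-- Opaque, so that goals mentioning the test stay small.
abstract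
  _≤?_ : ∀ p q → Dec (p ≤ q)
  _≤?_ = ℚ._≤?_

-- Expectation over uniform sample spaces

infixr 7 _⊗_

-- Each factor has a power of two of points, so that expectation is iterated halving. Products stay
-- formal, which makes independent coins nested expectations by definition.
data Space : Set where
  bits : ℕ → Space
  _⊗_  : Space → Space → Space

Point : Space → Set
Point (bits k) = Vec Bool k
Point (S ⊗ T)  = Point S × Point T

E : ∀ S → (Point S → ℚ) → ℚ
E (bits zero)    F = F []
E (bits (suc k)) F = ½ * (E (bits k) (F ∘ (false ∷_)) + E (bits k) (F ∘ (true ∷_)))
E (S ⊗ T)        F = E S λ s → E T λ t → F (s , t)

⟦_⟧ : Bool → ℚ
⟦ false ⟧ = 0ℚ
⟦ true  ⟧ = 1ℚ

0≤⟦⟧ : ∀ b → 0ℚ ≤ ⟦ b ⟧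
0≤⟦⟧ false = ℚ.≤-refl
0≤⟦⟧ true  = 0≤1

⟦⟧≤1 : ∀ b → ⟦ b ⟧ ≤ 1ℚ
⟦⟧≤1 false = 0≤1
⟦⟧≤1 true  = ℚ.≤-refl

⟦⟧≡bit : ∀ b → ⟦ b ⟧ ≡ fromℕ (bit b)
⟦⟧≡bit false = refl
⟦⟧≡bit true  = refl

E-cong : ∀ S {F G : Point S → ℚ} → (∀ ω → F ω ≡ G ω) → E S F ≡ E S G
E-cong (bits zero)    F≡G = F≡G []
E-cong (bits (suc k)) F≡G = cong (½ *_) (cong₂ _+_ (E-cong (bits k) λ ω → F≡G (false ∷ ω))
                                                   (E-cong (bits k) λ ω → F≡G (true ∷ ω)))
E-cong (S ⊗ T)        F≡G = E-cong S λ s → E-cong T λ t → F≡G (s , t)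

E-mono : ∀ S {F G : Point S → ℚ} → (∀ ω → F ω ≤ G ω) → E S F ≤ E S G
E-mono (bits zero)    F≤G = F≤G []
E-mono (bits (suc k)) F≤G = *-monoˡ 0≤½ (ℚ.+-mono-≤ (E-mono (bits k) λ ω → F≤G (false ∷ ω))
                                                    (E-mono (bits k) λ ω → F≤G (true ∷ ω)))
E-mono (S ⊗ T)        F≤G = E-mono S λ s → E-mono T λ t → F≤G (s , t)

E-+ : ∀ S (F G : Point S → ℚ) → E S (λ ω → F ω + G ω) ≡ E S F + E S G
E-+ (bits zero)    F G = refl
E-+ (bits (suc k)) F G = trans
  (cong (½ *_) (cong₂ _+_ (E-+ (bits k) (F ∘ (false ∷_)) (G ∘ (false ∷_)))
                          (E-+ (bits k) (F ∘ (true ∷_)) (G ∘ (true ∷_)))))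
  (solve 4 (λ a b c d → con ½ :* ((a :+ b) :+ (c :+ d)) := con ½ :* (a :+ c) :+ con ½ :* (b :+ d)) refl
    (E (bits k) (F ∘ (false ∷_))) (E (bits k) (G ∘ (false ∷_)))
    (E (bits k) (F ∘ (true ∷_))) (E (bits k) (G ∘ (true ∷_))))
E-+ (S ⊗ T)        F G = trans (E-cong S λ s → E-+ T (λ t → F (s , t)) (λ t → G (s , t)))
                               (E-+ S (λ s → E T λ t → F (s , t)) (λ s → E T λ t → G (s , t)))

E-* : ∀ S c (F : Point S → ℚ) → E S (λ ω → c * F ω) ≡ c * E S F
E-* (bits zero)    c F = refl
E-* (bits (suc k)) c F = trans
  (cong (½ *_) (cong₂ _+_ (E-* (bits k) c (F ∘ (false ∷_))) (E-* (bits k) c (F ∘ (true ∷_)))))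
  (solve 3 (λ c a b → con ½ :* (c :* a :+ c :* b) := c :* (con ½ :* (a :+ b))) refl
    c (E (bits k) (F ∘ (false ∷_))) (E (bits k) (F ∘ (true ∷_))))
E-* (S ⊗ T)        c F = trans (E-cong S λ s → E-* T c λ t → F (s , t))
                               (E-* S c λ s → E T λ t → F (s , t))

E-const : ∀ S c → E S (λ _ → c) ≡ c
E-const (bits zero)    c = refl
E-const (bits (suc k)) c = trans (cong (λ e → ½ * (e + e)) (E-const (bits k) c))
                                 (solve 1 (λ c → con ½ :* (c :+ c) := c) refl c)
E-const (S ⊗ T)        c = trans (E-cong S λ _ → E-const T c) (E-const S c)

E-*ʳ : ∀ S c (F : Point S → ℚ) → E S (λ ω → F ω * c) ≡ E S F * c
E-*ʳ S c F = trans (E-cong S λ ω → ℚ.*-comm (F ω) c) (trans (E-* S c F) (ℚ.*-comm c (E S F)))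

E-- : ∀ S (F G : Point S → ℚ) → E S (λ ω → F ω - G ω) ≡ E S F - E S G
E-- S F G = trans (E-+ S F (λ ω → - G ω)) (cong (E S F +_)
  (trans (E-cong S λ ω → neg (G ω)) (trans (E-* S (- 1ℚ) G) (sym (neg (E S G))))))
  where
  neg : ∀ p → - p ≡ - 1ℚ * p
  neg = solve 1 (λ p → :- p := :- con 1ℚ :* p) refl

E-≥0 : ∀ S {F : Point S → ℚ} → (∀ ω → 0ℚ ≤ F ω) → 0ℚ ≤ E S F
E-≥0 S 0≤F = ℚ.≤-trans (ℚ.≤-reflexive (sym (E-const S 0ℚ))) (E-mono S 0≤F)

E-≤ : ∀ S {F : Point S → ℚ} {c} → (∀ ω → F ω ≤ c) → E S F ≤ c
E-≤ S {c = c} F≤c = ℚ.≤-trans (E-mono S F≤c) (ℚ.≤-reflexive (E-const S c))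

E-∣∣ : ∀ S (F : Point S → ℚ) → ∣ E S F ∣ ≤ E S (λ ω → ∣ F ω ∣)
E-∣∣ S F = ∣p∣≤ (E-mono S λ ω → p≤∣p∣ (F ω)) (ℚ.≤-trans (ℚ.≤-reflexive (sym eq)) (E-mono S λ ω → -p≤∣p∣ (F ω)))
  where
  eq : E S (λ ω → - F ω) ≡ - E S F
  eq = begin
    E S (λ ω → - F ω)       ≡⟨ E-cong S (λ ω → sym (ℚ.+-identityˡ (- F ω))) ⟩
    E S (λ ω → 0ℚ - F ω)    ≡⟨ E-- S (λ _ → 0ℚ) F ⟩
    E S (λ _ → 0ℚ) - E S F  ≡⟨ cong (_- E S F) (E-const S 0ℚ) ⟩
    0ℚ - E S F              ≡⟨ ℚ.+-identityˡ (- E S F) ⟩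
    - E S F                 ∎
    where open ≡-Reasoning

E-swap : ∀ S T (F : Point S → Point T → ℚ) → E S (λ s → E T (F s)) ≡ E T (λ t → E S λ s → F s t)
E-swap (bits zero)    T F = refl
E-swap (bits (suc k)) T F = sym (trans
  (E-* T ½ λ t → E (bits k) (λ s → F (false ∷ s) t) + E (bits k) (λ s → F (true ∷ s) t))
  (cong (½ *_) (trans
    (E-+ T (λ t → E (bits k) (λ s → F (false ∷ s) t)) (λ t → E (bits k) (λ s → F (true ∷ s) t)))
    (cong₂ _+_ (sym (E-swap (bits k) T λ s → F (false ∷ s))) (sym (E-swap (bits k) T λ s → F (true ∷ s)))))))
E-swap (S ⊗ S′)       T F = trans (E-cong S λ s → E-swap S′ T λ s′ → F (s , s′))
                                  (E-swap S T λ s t → E S′ λ s′ → F (s , s′) t)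

E-indep : ∀ S T (F : Point S → ℚ) (G : Point T → ℚ) → E S (λ s → E T λ t → F s * G t) ≡ E S F * E T G
E-indep S T F G = trans (E-cong S λ s → E-* T (F s) G) (E-*ʳ S (E T G) F)

E-++ : ∀ a b (F : Vec Bool (a ℕ.+ b) → ℚ) → E (bits (a ℕ.+ b)) F ≡ E (bits a) λ u → E (bits b) λ v → F (u ++ v)
E-++ zero    b F = refl
E-++ (suc a) b F = cong (½ *_) (cong₂ _+_ (E-++ a b (F ∘ (false ∷_))) (E-++ a b (F ∘ (true ∷_))))

-- Pointwise, `θ²` times the indicator is at most `Z²`. The variance bound has the form `ε * θ²` to
-- avoid a quotient.
chebyshev : ∀ S (Z : Point S → ℚ) {θ ε} → 0ℚ < θ → E S (λ ω → Z ω * Z ω) ≤ ε * (θ * θ) →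
            E S (λ ω → ⟦ does (θ ≤? ∣ Z ω ∣) ⟧) ≤ ε
chebyshev S Z {θ} {ε} 0<θ var≤ = ℚ.*-cancelʳ-≤-pos (θ * θ) {{ℚ.pos*pos⇒pos θ {{positive 0<θ}} θ {{positive 0<θ}}}} (begin
  E S (λ ω → ⟦ does (θ ≤? ∣ Z ω ∣) ⟧) * (θ * θ)    ≡⟨ E-*ʳ S (θ * θ) _ ⟨
  E S (λ ω → ⟦ does (θ ≤? ∣ Z ω ∣) ⟧ * (θ * θ))    ≤⟨ E-mono S (λ ω → pointwise (Z ω)) ⟩
  E S (λ ω → Z ω * Z ω)                              ≤⟨ var≤ ⟩
  ε * (θ * θ)                                        ∎)
  where
  open ℚ.≤-Reasoning
  0≤θ = ℚ.<⇒≤ 0<θ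
  pointwise : ∀ z → ⟦ does (θ ≤? ∣ z ∣) ⟧ * (θ * θ) ≤ z * z
  pointwise z with θ ≤? ∣ z ∣
  ... | yes θ≤∣z∣ = ℚ.≤-trans (ℚ.≤-reflexive (ℚ.*-identityˡ (θ * θ)))
                     (ℚ.≤-trans (*-mono 0≤θ (ℚ.0≤∣p∣ z) θ≤∣z∣ θ≤∣z∣) (ℚ.≤-reflexive (∣p∣*∣p∣ z)))
  ... | no  _     = ℚ.≤-trans (ℚ.≤-reflexive (ℚ.*-zeroˡ (θ * θ))) (0≤p² z)

-- Pairwise independent sampling

infixr 6 _⊕_

_⊕_ : ∀ {m} → Vec Bool m → Vec Bool m → Vec Bool m
_⊕_ = Vec.zipWith _xor_

zeros : ∀ m → Vec Bool m
zeros m = Vec.replicate m false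

⊕-assoc : ∀ {m} (u v w : Vec Bool m) → (u ⊕ v) ⊕ w ≡ u ⊕ (v ⊕ w)
⊕-assoc = Vec.zipWith-assoc Bool.xor-assoc

⊕-comm : ∀ {m} (u v : Vec Bool m) → u ⊕ v ≡ v ⊕ u
⊕-comm = Vec.zipWith-comm Bool.xor-comm

⊕-cancel : ∀ {m} (u v : Vec Bool m) → u ⊕ (u ⊕ v) ≡ v
⊕-cancel []      []      = refl
⊕-cancel (a ∷ u) (b ∷ v) = cong₂ _∷_
  (trans (sym (Bool.xor-assoc a a b)) (cong (_xor b) (Bool.xor-same a))) (⊕-cancel u v)

⊕-injective : ∀ {m} (u v : Vec Bool m) → u ⊕ v ≡ zeros m → u ≡ v
⊕-injective []          []          _  = refl
⊕-injective (false ∷ u) (false ∷ v) eq = cong (false ∷_) (⊕-injective u v (Vec.∷-injectiveʳ eq))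
⊕-injective (true ∷ u)  (true ∷ v)  eq = cong (true ∷_) (⊕-injective u v (Vec.∷-injectiveʳ eq))
⊕-injective (false ∷ u) (true ∷ v)  eq = case Vec.∷-injectiveˡ eq of λ ()
⊕-injective (true ∷ u)  (false ∷ v) eq = case Vec.∷-injectiveˡ eq of λ ()

E-⊕ : ∀ {m} c (F : Vec Bool m → ℚ) → E (bits m) (λ v → F (c ⊕ v)) ≡ E (bits m) F
E-⊕ []          F = refl
E-⊕ (false ∷ c) F = cong (½ *_) (cong₂ _+_ (E-⊕ c (F ∘ (false ∷_))) (E-⊕ c (F ∘ (true ∷_))))
E-⊕ {suc m} (true ∷ c)  F = cong (½ *_) (trans
  (cong₂ _+_ (E-⊕ c (F ∘ (true ∷_))) (E-⊕ c (F ∘ (false ∷_))))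
  (ℚ.+-comm (E (bits m) (F ∘ (true ∷_))) (E (bits m) (F ∘ (false ∷_)))))

_≟_ : ∀ {k} (i j : Vec Bool k) → Dec (i ≡ j)
_≟_ = Vec.≡-dec Bool._≟_

E-≟ : ∀ {k} (i : Vec Bool k) → E (bits k) (λ j → ⟦ does (i ≟ j) ⟧) ≡ ½^ k
E-≟ []                = refl
E-≟ {suc k} (false ∷ i) = cong (½ *_) (trans (cong₂ _+_ (E-≟ i) (E-const (bits k) 0ℚ)) (ℚ.+-identityʳ (½^ k)))
E-≟ {suc k} (true ∷ i)  = cong (½ *_) (trans (cong₂ _+_ (E-const (bits k) 0ℚ) (E-≟ i)) (ℚ.+-identityˡ (½^ k)))

-- Multiplication by a random Toeplitz matrix over 𝔽₂, whose rows are the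
-- successive windows of the vector t; only lengths l ≥ m + k are meaningful.
dot : ∀ {k l} → Vec Bool k → Vec Bool l → Bool
dot []      t       = false
dot (c ∷ i) []      = false
dot (c ∷ i) (b ∷ t) = (c ∧ b) xor dot i t

toeplitz : ∀ m {k l} → Vec Bool k → Vec Bool l → Vec Bool m
toeplitz zero    i t       = []
toeplitz (suc m) i []      = zeros (suc m)
toeplitz (suc m) i (b ∷ t) = dot i (b ∷ t) ∷ toeplitz m i t

xor-interchange : ∀ a b c d → (a xor b) xor (c xor d) ≡ (a xor c) xor (b xor d)
xor-interchange a b c d = begin
  (a xor b) xor (c xor d)   ≡⟨ Bool.xor-assoc a b (c xor d) ⟩
  a xor (b xor (c xor d))   ≡⟨ cong (a xor_) (trans (sym (Bool.xor-assoc b c d)) (trans (cong (_xor d) (Bool.xor-comm b c)) (Bool.xor-assoc c b d))) ⟩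
  a xor (c xor (b xor d))   ≡⟨ Bool.xor-assoc a c (b xor d) ⟨
  (a xor c) xor (b xor d)   ∎
  where open ≡-Reasoning

dot-⊕ : ∀ {k l} (i j : Vec Bool k) (t : Vec Bool l) → dot (i ⊕ j) t ≡ dot i t xor dot j t
dot-⊕ []      []      t       = refl
dot-⊕ (c ∷ i) (d ∷ j) []      = refl
dot-⊕ (c ∷ i) (d ∷ j) (b ∷ t) = trans (cong₂ _xor_ (Bool.∧-distribʳ-xor b c d) (dot-⊕ i j t))
                                      (xor-interchange (c ∧ b) (d ∧ b) (dot i t) (dot j t))

toeplitz-⊕ : ∀ m {k l} (i j : Vec Bool k) (t : Vec Bool l) → toeplitz m (i ⊕ j) t ≡ toeplitz m i t ⊕ toeplitz m j t
toeplitz-⊕ zero    i j t       = refl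
toeplitz-⊕ (suc m) i j []      = sym (Vec.zipWith-replicate _xor_ false false)
toeplitz-⊕ (suc m) i j (b ∷ t) = cong₂ _∷_ (dot-⊕ i j (b ∷ t)) (toeplitz-⊕ m i j t)

dot-[] : ∀ {k} (i : Vec Bool k) → dot i [] ≡ false
dot-[] []      = refl
dot-[] (_ ∷ _) = refl

-- A leading zero of `i` ignores the first entry of every window, so all windows may be shifted by
-- one. Once `t` is exhausted, both sides consist of zeros.
toeplitz-false : ∀ m {k l} b (i : Vec Bool k) (t : Vec Bool l) → toeplitz m (false ∷ i) (b ∷ t) ≡ toeplitz m i t
toeplitz-false zero          b i t        = refl
toeplitz-false (suc zero)    b i []       = cong (_∷ []) (dot-[] i)
toeplitz-false (suc (suc m)) b i []       = cong (_∷ zeros (suc m)) (dot-[] i)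
toeplitz-false (suc m)       b i (b′ ∷ t) = cong (dot i (b′ ∷ t) ∷_) (toeplitz-false m b′ i t)

-- The first nonzero entry of i makes the rows triangular in t.
E-toeplitz : ∀ m {k} (i : Vec Bool k) → i ≢ zeros k → ∀ l → m ℕ.+ k ℕ.≤ l → (F : Vec Bool m → ℚ) →
             E (bits l) (F ∘ toeplitz m i) ≡ E (bits m) F
E-toeplitz zero    i           i≢0 l       _         F = E-const (bits l) (F [])
E-toeplitz (suc m) []          i≢0 l       _         F = ⊥-elim (i≢0 refl)
E-toeplitz (suc m) {suc k} (false ∷ i) i≢0 (suc l) (ℕ.s≤s h) F = begin
  ½ * (E (bits l) (λ t → F (toeplitz (suc m) (false ∷ i) (false ∷ t))) + E (bits l) (λ t → F (toeplitz (suc m) (false ∷ i) (true ∷ t))))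
    ≡⟨ cong (½ *_) (cong₂ _+_ (E-cong (bits l) λ t → cong F (toeplitz-false (suc m) false i t))
                              (E-cong (bits l) λ t → cong F (toeplitz-false (suc m) true i t))) ⟩
  ½ * (E (bits l) (F ∘ toeplitz (suc m) i) + E (bits l) (F ∘ toeplitz (suc m) i))
    ≡⟨ solve 1 (λ p → con ½ :* (p :+ p) := p) refl (E (bits l) (F ∘ toeplitz (suc m) i)) ⟩
  E (bits l) (F ∘ toeplitz (suc m) i)
    ≡⟨ E-toeplitz (suc m) i (λ eq → i≢0 (cong (false ∷_) eq)) l (ℕ.≤-trans (ℕ.≤-reflexive (sym (ℕ.+-suc m k))) h) F ⟩
  E (bits (suc m)) F ∎
  where
  open ≡-Reasoning
E-toeplitz (suc m) (true ∷ i) i≢0 (suc l) (ℕ.s≤s h) F = begin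
  ½ * (E (bits l) (λ t → F (dot i t ∷ toeplitz m (true ∷ i) t)) + E (bits l) (λ t → F (not (dot i t) ∷ toeplitz m (true ∷ i) t)))
    ≡⟨ cong (½ *_) (E-+ (bits l) (λ t → F (dot i t ∷ toeplitz m (true ∷ i) t)) (λ t → F (not (dot i t) ∷ toeplitz m (true ∷ i) t))) ⟨
  ½ * E (bits l) (λ t → F (dot i t ∷ toeplitz m (true ∷ i) t) + F (not (dot i t) ∷ toeplitz m (true ∷ i) t))
    ≡⟨ cong (½ *_) (E-cong (bits l) λ t → both (dot i t) (toeplitz m (true ∷ i) t)) ⟩
  ½ * E (bits l) (λ t → F (false ∷ toeplitz m (true ∷ i) t) + F (true ∷ toeplitz m (true ∷ i) t))
    ≡⟨ cong (½ *_) (E-toeplitz m (true ∷ i) i≢0 l h (λ v → F (false ∷ v) + F (true ∷ v))) ⟩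
  ½ * E (bits m) (λ v → F (false ∷ v) + F (true ∷ v))
    ≡⟨ cong (½ *_) (E-+ (bits m) (F ∘ (false ∷_)) (F ∘ (true ∷_))) ⟩
  E (bits (suc m)) F ∎
  where
  open ≡-Reasoning
  both : ∀ b v → F (b ∷ v) + F (not b ∷ v) ≡ F (false ∷ v) + F (true ∷ v)
  both false v = refl
  both true  v = ℚ.+-comm (F (true ∷ v)) (F (false ∷ v))

hash : ∀ m {k l} → Vec Bool l × Vec Bool m → Vec Bool k → Vec Bool m
hash m (t , b) i = toeplitz m i t ⊕ b

-- Translating the offset by the image of `i` makes the value at `i` the offset itself and the value
-- at `j` the offset plus the image of `j ⊕ i`. As `j ⊕ i` is nonzero, that image is uniform over
-- the matrices, for each offset.
hash-pairwise : ∀ m {k} (i j : Vec Bool k) → i ≢ j → (F G : Vec Bool m → ℚ) →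
                E (bits (m ℕ.+ k) ⊗ bits m) (λ ω → F (hash m ω i) * G (hash m ω j)) ≡ E (bits m) F * E (bits m) G
hash-pairwise m {k} i j i≢j F G = begin
  E T (λ t → E M λ b → F (s i t ⊕ b) * G (s j t ⊕ b))
    ≡⟨ E-cong T (λ t → E-⊕ (s i t) λ b → F (s i t ⊕ b) * G (s j t ⊕ b)) ⟨
  E T (λ t → E M λ b → F (s i t ⊕ (s i t ⊕ b)) * G (s j t ⊕ (s i t ⊕ b)))
    ≡⟨ E-cong T (λ t → E-cong M λ b → cong₂ (λ u v → F u * G v) (⊕-cancel (s i t) b) (shift t b)) ⟩
  E T (λ t → E M λ b → F b * G (b ⊕ s (j ⊕ i) t))
    ≡⟨ E-swap T M (λ t b → F b * G (b ⊕ s (j ⊕ i) t)) ⟩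
  E M (λ b → E T λ t → F b * G (b ⊕ s (j ⊕ i) t))
    ≡⟨ E-cong M (λ b → trans (E-* T (F b) λ t → G (b ⊕ s (j ⊕ i) t)) (cong (F b *_) (uniform b))) ⟩
  E M (λ b → F b * E M G)
    ≡⟨ E-*ʳ M (E M G) F ⟩
  E M F * E M G ∎
  where
  open ≡-Reasoning
  M = bits m
  T = bits (m ℕ.+ k)
  s = toeplitz m {k} {m ℕ.+ k}
  shift : ∀ t b → s j t ⊕ (s i t ⊕ b) ≡ b ⊕ s (j ⊕ i) t
  shift t b = trans (sym (⊕-assoc (s j t) (s i t) b))
                    (trans (cong (_⊕ b) (sym (toeplitz-⊕ m j i t))) (⊕-comm (s (j ⊕ i) t) b))
  uniform : ∀ b → E T (λ t → G (b ⊕ s (j ⊕ i) t)) ≡ E M G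
  uniform b = trans (E-toeplitz m (j ⊕ i) (λ eq → i≢j (sym (⊕-injective j i eq))) (m ℕ.+ k) ℕ.≤-refl (λ v → G (b ⊕ v)))
                    (E-⊕ b G)

-- Reading a whole block and sampling it by hashing share this interface, the former with variance
-- zero; hence one test and one analysis serve both.
record Sampler (b : ℕ) : Set where
  field
    Ω      : Space
    width  : ℕ
    point  : Point Ω → Vec Bool width → Vec Bool b
    var    : ℚ

  average : (Vec Bool b → ℚ) → Point Ω → ℚ
  average y ω = E (bits width) λ i → y (point ω i)

  error : (Vec Bool b → Bool) → Point Ω → ℚ
  error y ω = average (⟦_⟧ ∘ y) ω - E (bits b) (⟦_⟧ ∘ y)

  field
    variance : ∀ y → E Ω (λ ω → error y ω * error y ω) ≤ var

identitySampler : ∀ b → Sampler b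
identitySampler b = record
  { Ω = bits 0 ; width = b ; point = λ _ i → i ; var = 0ℚ
  ; variance = λ y → ℚ.≤-reflexive (cong (λ p → p * p) (ℚ.+-inverseʳ (E (bits b) (⟦_⟧ ∘ y)))) }

hashSampler : ∀ b k → Sampler b
hashSampler b k = record
  { Ω = Ω ; width = k ; point = hash b ; var = ½^ k ; variance = variance }
  where
  Ω = bits (b ℕ.+ k) ⊗ bits b
  K = bits k
  variance : ∀ y → let e = λ ω → E K (λ i → ⟦ y (hash b ω i) ⟧) - E (bits b) (⟦_⟧ ∘ y) in
             E Ω (λ ω → e ω * e ω) ≤ ½^ k
  variance y = begin
    E Ω (λ ω → (E K (λ i → ⟦ y (hash b ω i) ⟧) - μ) * (E K (λ i → ⟦ y (hash b ω i) ⟧) - μ))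
      ≡⟨ E-cong Ω (λ ω → cong (λ p → p * p) (centre ω)) ⟨
    E Ω (λ ω → E K (λ i → G (hash b ω i)) * E K (λ i → G (hash b ω i)))
      ≡⟨ E-cong Ω (λ ω → E-indep K K (λ i → G (hash b ω i)) (λ i → G (hash b ω i))) ⟨
    E Ω (λ ω → E K λ i → E K λ j → G (hash b ω i) * G (hash b ω j))
      ≡⟨ E-swap Ω K (λ ω i → E K λ j → G (hash b ω i) * G (hash b ω j)) ⟩
    E K (λ i → E Ω λ ω → E K λ j → G (hash b ω i) * G (hash b ω j))
      ≡⟨ E-cong K (λ i → E-swap Ω K λ ω j → G (hash b ω i) * G (hash b ω j)) ⟩
    E K (λ i → E K λ j → E Ω λ ω → G (hash b ω i) * G (hash b ω j))
      -- Off the diagonal the covariance vanishes by pairwise independence and centring; on it, it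
      -- is at most 1. The diagonal has measure `½^ k`.
      ≤⟨ E-mono K (λ i → E-mono K λ j → covariance i j) ⟩
    E K (λ i → E K λ j → ⟦ does (i ≟ j) ⟧)
      ≡⟨ E-cong K E-≟ ⟩
    E K (λ _ → ½^ k)
      ≡⟨ E-const K (½^ k) ⟩
    ½^ k ∎
    where
    open ℚ.≤-Reasoning
    μ = E (bits b) (⟦_⟧ ∘ y)
    G : Vec Bool b → ℚ
    G v = ⟦ y v ⟧ - μ
    centre : ∀ ω → E K (λ i → G (hash b ω i)) ≡ E K (λ i → ⟦ y (hash b ω i) ⟧) - μ
    centre ω = trans (E-- K (λ i → ⟦ y (hash b ω i) ⟧) (λ _ → μ)) (cong (λ e → E K (λ i → ⟦ y (hash b ω i) ⟧) - e) (E-const K μ))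
    EG≡0 : E (bits b) G ≡ 0ℚ
    EG≡0 = trans (E-- (bits b) (⟦_⟧ ∘ y) (λ _ → μ)) (trans (cong (λ e → μ - e) (E-const (bits b) μ)) (ℚ.+-inverseʳ μ))
    0≤μ : 0ℚ ≤ μ
    0≤μ = E-≥0 (bits b) (0≤⟦⟧ ∘ y)
    μ≤1 : μ ≤ 1ℚ
    μ≤1 = E-≤ (bits b) (⟦⟧≤1 ∘ y)
    ∣G∣≤1 : ∀ v → ∣ G v ∣ ≤ 1ℚ
    ∣G∣≤1 v = ∣p∣≤
      (≤-via ((1ℚ - ⟦ y v ⟧) + μ) (0≤+ (0≤-diff (⟦⟧≤1 (y v))) 0≤μ)
        (solve 2 (λ p m → con 1ℚ := (p :- m) :+ ((con 1ℚ :- p) :+ m)) refl ⟦ y v ⟧ μ))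
      (≤-via ((1ℚ - μ) + ⟦ y v ⟧) (0≤+ (0≤-diff μ≤1) (0≤⟦⟧ (y v)))
        (solve 2 (λ p m → con 1ℚ := (:- (p :- m)) :+ ((con 1ℚ :- m) :+ p)) refl ⟦ y v ⟧ μ))
    G²≤1 : ∀ v → G v * G v ≤ 1ℚ
    G²≤1 v = ℚ.≤-trans (ℚ.≤-reflexive (sym (∣p∣*∣p∣ (G v)))) (*-mono (ℚ.0≤∣p∣ (G v)) 0≤1 (∣G∣≤1 v) (∣G∣≤1 v))
    covariance : ∀ i j → E Ω (λ ω → G (hash b ω i) * G (hash b ω j)) ≤ ⟦ does (i ≟ j) ⟧
    covariance i j with i ≟ j
    ... | yes refl = E-≤ Ω λ ω → G²≤1 (hash b ω i)
    ... | no i≢j   = ℚ.≤-reflexive (trans (hash-pairwise b i j i≢j G G) (trans (cong (_* E (bits b) G) EG≡0) (ℚ.*-zeroˡ (E (bits b) G))))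

-- Randomised tests

bind : ∀ {n} {A B : Set} → Algorithm n A → (A → Algorithm n B) → Algorithm n B
bind (output a)  f = f a
bind (query i k) f = query i λ b → bind (k b) f

run-bind : ∀ {n} {A B : Set} (a : Algorithm n A) (f : A → Algorithm n B) x → run (bind a f) x ≡ run (f (run a x)) x
run-bind (output a)  f x = refl
run-bind (query i k) f x = run-bind (k (lookup x i)) f x

queries-bind : ∀ {n} {A B : Set} (a : Algorithm n A) (f : A → Algorithm n B) x →
               queries (bind a f) x ≡ queries a x ℕ.+ queries (f (run a x)) x
queries-bind (output a)  f x = refl
queries-bind (query i k) f x = cong suc (queries-bind (k (lookup x i)) f x)

queries-bind-≤ : ∀ {n} {A B : Set} (a : Algorithm n A) (f : A → Algorithm n B) x {c d} →
                 queries a x ℕ.≤ c → (∀ v → queries (f v) x ℕ.≤ d) → queries (bind a f) x ℕ.≤ c ℕ.+ d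
queries-bind-≤ a f x ≤c ≤d = ℕ.≤-trans (ℕ.≤-reflexive (queries-bind a f x)) (ℕ.+-mono-≤ ≤c (≤d (run a x)))

branch : ∀ {k} {A : Set} → (Vec Bool k → A) → (Vec Bool k → A) → Vec Bool (suc k) → A
branch f g (false ∷ v) = f v
branch f g (true ∷ v)  = g v

-- The answers are returned as a table, so that means and block counts can be computed from it
-- without further queries.
readAll : ∀ {n} k → (Vec Bool k → Algorithm n Bool) → Algorithm n (Vec Bool k → Bool)
readAll zero    cell = bind (cell []) λ b → output λ _ → b
readAll (suc k) cell = bind (readAll k (cell ∘ (false ∷_))) λ f → bind (readAll k (cell ∘ (true ∷_))) λ g → output (branch f g)

run-readAll : ∀ {n} k (cell : Vec Bool k → Algorithm n Bool) x v → run (readAll k cell) x v ≡ run (cell v) x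
run-readAll zero    cell x []      = cong (λ (f : Vec Bool 0 → Bool) → f []) (run-bind (cell []) (λ b → output λ _ → b) x)
run-readAll (suc k) cell x (b ∷ v) = trans (cong (λ (f : Vec Bool (suc k) → Bool) → f (b ∷ v)) (trans
    (run-bind (readAll k (cell ∘ (false ∷_))) second x) (run-bind (readAll k (cell ∘ (true ∷_))) _ x))) (at b)
  where
  second : (Vec Bool k → Bool) → Algorithm _ (Vec Bool (suc k) → Bool)
  second f = bind (readAll k (cell ∘ (true ∷_))) λ g → output (branch f g)
  at : ∀ b → branch (run (readAll k (cell ∘ (false ∷_))) x) (run (readAll k (cell ∘ (true ∷_))) x) (b ∷ v) ≡ run (cell (b ∷ v)) x
  at false = run-readAll k (cell ∘ (false ∷_)) x v
  at true  = run-readAll k (cell ∘ (true ∷_)) x v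

queries-readAll : ∀ {n} k (cell : Vec Bool k → Algorithm n Bool) x → (∀ v → queries (cell v) x ℕ.≤ 1) →
                  queries (readAll k cell) x ℕ.≤ 2 ℕ.^ k
queries-readAll zero    cell x ≤1 = queries-bind-≤ (cell []) _ x {1} {0} (≤1 []) λ _ → ℕ.z≤n
queries-readAll (suc k) cell x ≤1 =
  queries-bind-≤ (readAll k (cell ∘ (false ∷_))) _ x (queries-readAll k _ x λ v → ≤1 (false ∷ v)) λ _ →
    queries-bind-≤ (readAll k (cell ∘ (true ∷_))) _ x (queries-readAll k _ x λ v → ≤1 (true ∷ v)) λ _ → ℕ.z≤n

-- `Q` holds what is fixed before the coins of the test are drawn: the seed and the reply, and for a
-- test of one block also its index. Rates are stated for each `q`, and hence cover every way of
-- choosing the reply.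
record Test (n : ℕ) (Q : Set) : Set where
  field
    Ω          : Space
    alarm      : Q → Point Ω → Algorithm n Bool
    cost       : ℕ
    cost-bound : ∀ q ω x → queries (alarm q ω) x ℕ.≤ cost

open Test

rate quiet : ∀ {n Q} → Test n Q → Q → Vec Bool n → ℚ
rate  T q x = E (Ω T) λ ω → ⟦ run (alarm T q ω) x ⟧
quiet T q x = E (Ω T) λ ω → ⟦ not (run (alarm T q ω) x) ⟧

combine : ∀ {n Q} → (Bool → Bool → Bool) → Test n Q → Test n Q → Test n Q
combine _·_ T U = record
  { Ω          = Ω T ⊗ Ω U
  ; alarm      = λ q ω → bind (alarm T q (proj₁ ω)) λ a → bind (alarm U q (proj₂ ω)) λ b → output (a · b)
  ; cost       = cost T ℕ.+ (cost U ℕ.+ 0)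
  ; cost-bound = λ q ω x → queries-bind-≤ (alarm T q (proj₁ ω)) _ x (cost-bound T q (proj₁ ω) x) λ _ →
                             queries-bind-≤ (alarm U q (proj₂ ω)) _ x (cost-bound U q (proj₂ ω) x) λ _ → ℕ.z≤n
  }

constant : ∀ {n Q} → Bool → Test n Q
constant b = record { Ω = bits 0 ; alarm = λ _ _ → output b ; cost = 0 ; cost-bound = λ _ _ _ → ℕ.z≤n }

run-combine : ∀ {n Q} _·_ (T U : Test n Q) q ω x →
              run (alarm (combine _·_ T U) q ω) x ≡ (run (alarm T q (proj₁ ω)) x) · (run (alarm U q (proj₂ ω)) x)
run-combine _·_ T U q ω x = trans (run-bind (alarm T q (proj₁ ω)) _ x) (run-bind (alarm U q (proj₂ ω)) _ x)

both either : ∀ {n Q} → Test n Q → Test n Q → Test n Q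
both   = combine _∧_
either = combine _∨_

allOf anyOf : ∀ {n Q} → ℕ → Test n Q → Test n Q
allOf zero    T = constant true
allOf (suc u) T = both T (allOf u T)
anyOf zero    T = constant false
anyOf (suc s) T = either T (anyOf s T)

cost-allOf : ∀ {n Q} u (T : Test n Q) → cost (allOf u T) ≡ u ℕ.* cost T
cost-allOf zero    T = refl
cost-allOf (suc u) T = cong (cost T ℕ.+_) (trans (ℕ.+-identityʳ _) (cost-allOf u T))

cost-anyOf : ∀ {n Q} s (T : Test n Q) → cost (anyOf s T) ≡ s ℕ.* cost T
cost-anyOf zero    T = refl
cost-anyOf (suc s) T = cong (cost T ℕ.+_) (trans (ℕ.+-identityʳ _) (cost-anyOf s T))

⟦∧⟧ : ∀ a b → ⟦ a ∧ b ⟧ ≡ ⟦ a ⟧ * ⟦ b ⟧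
⟦∧⟧ false b = sym (ℚ.*-zeroˡ ⟦ b ⟧)
⟦∧⟧ true  b = sym (ℚ.*-identityˡ ⟦ b ⟧)

⟦∨⟧ : ∀ a b → ⟦ a ∨ b ⟧ ≤ ⟦ a ⟧ + ⟦ b ⟧
⟦∨⟧ false b = ℚ.≤-reflexive (sym (ℚ.+-identityˡ ⟦ b ⟧))
⟦∨⟧ true  b = ≤-via ⟦ b ⟧ (0≤⟦⟧ b) refl

⟦not-∨⟧ : ∀ a b → ⟦ not (a ∨ b) ⟧ ≡ ⟦ not a ⟧ * ⟦ not b ⟧
⟦not-∨⟧ false b = sym (ℚ.*-identityˡ ⟦ not b ⟧)
⟦not-∨⟧ true  b = sym (ℚ.*-zeroˡ ⟦ not b ⟧)

⟦not⟧ : ∀ a → ⟦ not a ⟧ ≡ 1ℚ - ⟦ a ⟧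
⟦not⟧ false = refl
⟦not⟧ true  = refl

0≤rate : ∀ {n Q} (T : Test n Q) q x → 0ℚ ≤ rate T q x
0≤rate T q x = E-≥0 (Ω T) λ ω → 0≤⟦⟧ (run (alarm T q ω) x)

0≤quiet : ∀ {n Q} (T : Test n Q) q x → 0ℚ ≤ quiet T q x
0≤quiet T q x = E-≥0 (Ω T) λ ω → 0≤⟦⟧ (not (run (alarm T q ω) x))

quiet≡1-rate : ∀ {n Q} (T : Test n Q) q x → quiet T q x ≡ 1ℚ - rate T q x
quiet≡1-rate T q x = trans (E-cong (Ω T) λ ω → ⟦not⟧ (run (alarm T q ω) x))
  (trans (E-- (Ω T) (λ _ → 1ℚ) _) (cong (λ e → e - rate T q x) (E-const (Ω T) 1ℚ)))

rate-both : ∀ {n Q} (T U : Test n Q) q x → rate (both T U) q x ≡ rate T q x * rate U q x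
rate-both T U q x = trans (E-cong (Ω T ⊗ Ω U) λ ω → trans (cong ⟦_⟧ (run-combine _∧_ T U q ω x)) (⟦∧⟧ (run (alarm T q (proj₁ ω)) x) _))
                          (E-indep (Ω T) (Ω U) _ _)

quiet-either : ∀ {n Q} (T U : Test n Q) q x → quiet (either T U) q x ≡ quiet T q x * quiet U q x
quiet-either T U q x = trans
  (E-cong (Ω T ⊗ Ω U) λ ω → trans (cong (⟦_⟧ ∘ not) (run-combine _∨_ T U q ω x)) (⟦not-∨⟧ (run (alarm T q (proj₁ ω)) x) _))
  (E-indep (Ω T) (Ω U) _ _)

rate-either : ∀ {n Q} (T U : Test n Q) q x → rate (either T U) q x ≤ rate T q x + rate U q x
rate-either T U q x = begin
  rate (either T U) q x                                    ≤⟨ E-mono (Ω T ⊗ Ω U) (λ ω → ℚ.≤-trans (ℚ.≤-reflexive (cong ⟦_⟧ (run-combine _∨_ T U q ω x))) (⟦∨⟧ (run (alarm T q (proj₁ ω)) x) _)) ⟩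
  E (Ω T) (λ s → E (Ω U) λ t → F s + G t)                  ≡⟨ E-cong (Ω T) (λ s → trans (E-+ (Ω U) (λ _ → F s) G) (cong (_+ E (Ω U) G) (E-const (Ω U) (F s)))) ⟩
  E (Ω T) (λ s → F s + E (Ω U) G)                          ≡⟨ trans (E-+ (Ω T) F (λ _ → E (Ω U) G)) (cong (E (Ω T) F +_) (E-const (Ω T) (E (Ω U) G))) ⟩
  rate T q x + rate U q x                                  ∎
  where
  open ℚ.≤-Reasoning
  F : Point (Ω T) → ℚ
  F s = ⟦ run (alarm T q s) x ⟧
  G : Point (Ω U) → ℚ
  G t = ⟦ run (alarm U q t) x ⟧

rate-anyOf : ∀ {n Q} s (T : Test n Q) q x → rate (anyOf s T) q x ≤ fromℕ s * rate T q x
rate-anyOf zero    T q x = ℚ.≤-reflexive (sym (ℚ.*-zeroˡ (rate T q x)))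
rate-anyOf (suc s) T q x = begin
  rate (anyOf (suc s) T) q x               ≤⟨ rate-either T (anyOf s T) q x ⟩
  rate T q x + rate (anyOf s T) q x        ≤⟨ ℚ.+-monoʳ-≤ (rate T q x) (rate-anyOf s T q x) ⟩
  rate T q x + fromℕ s * rate T q x        ≡⟨ solve 2 (λ r s → r :+ s :* r := (con 1ℚ :+ s) :* r) refl (rate T q x) (fromℕ s) ⟩
  (1ℚ + fromℕ s) * rate T q x              ≡⟨ cong (_* rate T q x) (fromℕ-+ 1 s) ⟨
  fromℕ (suc s) * rate T q x               ∎
  where open ℚ.≤-Reasoning

rate-allOf-≤ : ∀ {n Q} u l (T : Test n Q) q x → rate T q x ≤ ½^ l → rate (allOf u T) q x ≤ ½^ (u ℕ.* l)
rate-allOf-≤ zero    l T q x r≤ = ℚ.≤-refl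
rate-allOf-≤ (suc u) l T q x r≤ = begin
  rate (both T (allOf u T)) q x          ≡⟨ rate-both T (allOf u T) q x ⟩
  rate T q x * rate (allOf u T) q x      ≤⟨ *-mono (0≤rate T q x) (0≤½^ (u ℕ.* l)) r≤ (rate-allOf-≤ u l T q x r≤) ⟩
  ½^ l * ½^ (u ℕ.* l)                    ≡⟨ ½^-+ l (u ℕ.* l) ⟨
  ½^ (suc u ℕ.* l)                       ∎
  where open ℚ.≤-Reasoning

-- A union bound over the runs that stay quiet; for two rates it reads `r R = 1 - (1 - r) - (1 - R)
-- + (1 - r)(1 - R)`, whose last term is dropped.
rate-allOf-≥ : ∀ {n Q} u {ε} (T : Test n Q) q x → 0ℚ ≤ ε → 1ℚ - ε ≤ rate T q x → 1ℚ - fromℕ u * ε ≤ rate (allOf u T) q x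
rate-allOf-≥ zero    {ε} T q x 0≤ε ≤r = ℚ.≤-reflexive (solve 1 (λ e → con 1ℚ :- con 0ℚ :* e := con 1ℚ) refl ε)
rate-allOf-≥ (suc u) {ε} T q x 0≤ε ≤r = begin
  1ℚ - fromℕ (suc u) * ε                 ≡⟨ cong (λ s → 1ℚ - s * ε) (fromℕ-+ 1 u) ⟩
  1ℚ - (1ℚ + fromℕ u) * ε                ≤⟨ ≤-via ((1ℚ - R) * (1ℚ - r) + (r - (1ℚ - ε)) + (R - (1ℚ - fromℕ u * ε)))
                                              (0≤+ (0≤+ (0≤* (0≤-diff R≤1) (0≤-diff r≤1)) (0≤-diff ≤r)) (0≤-diff (rate-allOf-≥ u T q x 0≤ε ≤r)))
                                              (solve 4 (λ r R u e → r :* R := (con 1ℚ :- (con 1ℚ :+ u) :* e) :+ (((con 1ℚ :- R) :* (con 1ℚ :- r) :+ (r :- (con 1ℚ :- e))) :+ (R :- (con 1ℚ :- u :* e)))) refl r R (fromℕ u) ε) ⟩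
  r * R                                  ≡⟨ rate-both T (allOf u T) q x ⟨
  rate (both T (allOf u T)) q x          ∎
  where
  open ℚ.≤-Reasoning
  r R : ℚ
  r = rate T q x
  R = rate (allOf u T) q x
  r≤1 : r ≤ 1ℚ
  r≤1 = E-≤ (Ω T) λ ω → ⟦⟧≤1 (run (alarm T q ω) x)
  R≤1 : R ≤ 1ℚ
  R≤1 = E-≤ (Ω (allOf u T)) λ ω → ⟦⟧≤1 (run (alarm (allOf u T) q ω) x)

-- Replaces the exponential bound ∏ (1 - pᵢ) ≤ exp (- ∑ pᵢ).
Caught : ∀ {n Q} → Test n Q → Q → Vec Bool n → ℚ → Set
Caught T q x w = 0ℚ ≤ w × quiet T q x * (1ℚ + w) ≤ 1ℚ

caught-single : ∀ {n Q} (T : Test n Q) q x → Caught T q x (rate T q x)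
caught-single T q x = 0≤rate T q x , (begin
  quiet T q x * (1ℚ + r)   ≡⟨ cong (_* (1ℚ + r)) (quiet≡1-rate T q x) ⟩
  (1ℚ - r) * (1ℚ + r)      ≤⟨ ≤-via (r * r) (0≤p² r) (solve 1 (λ r → con 1ℚ := (con 1ℚ :- r) :* (con 1ℚ :+ r) :+ r :* r) refl r) ⟩
  1ℚ                       ∎)
  where
  open ℚ.≤-Reasoning
  r = rate T q x

-- Probabilities of staying quiet multiply, while `1 + (v + w) ≤ (1 + v)(1 + w)`; so weights, which
-- are expected numbers of hits, simply add up.
caught-either : ∀ {n Q} (T U : Test n Q) q x {v w} → Caught T q x v → Caught U q x w → Caught (either T U) q x (v + w)
caught-either T U q x {v} {w} (0≤v , hT) (0≤w , hU) = 0≤+ 0≤v 0≤w , (begin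
  quiet (either T U) q x * (1ℚ + (v + w))                  ≡⟨ cong (_* (1ℚ + (v + w))) (quiet-either T U q x) ⟩
  (a * b) * (1ℚ + (v + w))                                 ≤⟨ *-monoˡ (0≤* 0≤a 0≤b) (≤-via (v * w) (0≤* 0≤v 0≤w)
                                                                (solve 2 (λ v w → (con 1ℚ :+ v) :* (con 1ℚ :+ w) := (con 1ℚ :+ (v :+ w)) :+ v :* w) refl v w)) ⟩
  (a * b) * ((1ℚ + v) * (1ℚ + w))                          ≡⟨ solve 4 (λ a b v w → (a :* b) :* (v :* w) := (a :* v) :* (b :* w)) refl a b (1ℚ + v) (1ℚ + w) ⟩
  (a * (1ℚ + v)) * (b * (1ℚ + w))                          ≤⟨ *-mono (0≤* 0≤a (0≤+ 0≤1 0≤v)) 0≤1 hT hU ⟩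
  1ℚ                                                       ∎)
  where
  open ℚ.≤-Reasoning
  a b : ℚ
  a = quiet T q x
  b = quiet U q x
  0≤a = 0≤quiet T q x
  0≤b = 0≤quiet U q x

caught-anyOf : ∀ {n Q} s (T : Test n Q) q x → Caught (anyOf s T) q x (fromℕ s * rate T q x)
caught-anyOf zero    T q x = subst (Caught (anyOf 0 T) q x) (sym (ℚ.*-zeroˡ (rate T q x))) (ℚ.≤-refl , ℚ.≤-refl)
caught-anyOf (suc s) T q x = subst (Caught (anyOf (suc s) T) q x) eq
  (caught-either T (anyOf s T) q x (caught-single T q x) (caught-anyOf s T q x))
  where
  eq : rate T q x + fromℕ s * rate T q x ≡ fromℕ (suc s) * rate T q x
  eq = trans (solve 2 (λ r s → r :+ s :* r := (con 1ℚ :+ s) :* r) refl (rate T q x) (fromℕ s))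
             (cong (_* rate T q x) (sym (fromℕ-+ 1 s)))

-- The index becomes a coin, so that the rate is an average over blocks and is bounded below through
-- the fraction of erring ones.
atRandom : ∀ {n Q} a → Test n (Q × Vec Bool a) → Test n Q
atRandom a T = record
  { Ω          = bits a ⊗ Ω T
  ; alarm      = λ q ω → alarm T (q , proj₁ ω) (proj₂ ω)
  ; cost       = cost T
  ; cost-bound = λ q ω x → cost-bound T (q , proj₁ ω) (proj₂ ω) x
  }

module _ {n b : ℕ} {Q : Set} (S : Sampler b) (θ : ℚ) (cell : Q → Vec Bool b → Algorithm n Bool)
         (cell-cost : ∀ q v x → queries (cell q v) x ℕ.≤ 1) (claim : Q → ℚ) where
  private module S = Sampler S

  meanTest : Test n Q
  meanTest = record
    { Ω          = S.Ω
    ; alarm      = λ q ω → bind (readAll S.width λ i → cell q (S.point ω i)) λ ys →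
                             output (does (θ ≤? ∣ E (bits S.width) (⟦_⟧ ∘ ys) - claim q ∣))
    ; cost       = 2 ℕ.^ S.width ℕ.+ 0
    ; cost-bound = λ q ω x → queries-bind-≤ (readAll S.width _) _ x
                               (queries-readAll S.width _ x λ i → cell-cost q (S.point ω i) x) λ _ → ℕ.z≤n
    }

  module _ (q : Q) (x : Vec Bool n) where
    private
      y : Vec Bool b → Bool
      y v = run (cell q v) x
      μ : ℚ
      μ = E (bits b) (⟦_⟧ ∘ y)

    run-meanTest : ∀ ω → run (alarm meanTest q ω) x ≡ does (θ ≤? ∣ S.average (⟦_⟧ ∘ y) ω - claim q ∣)
    run-meanTest ω = trans (run-bind (readAll S.width λ i → cell q (S.point ω i)) _ x)
      (cong (λ m → does (θ ≤? ∣ m - claim q ∣)) (E-cong (bits S.width) λ i → cong ⟦_⟧ (run-readAll S.width _ x i)))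

    meanTest-honest : ∀ {ε} → 0ℚ < θ → S.var ≤ ε * (θ * θ) → claim q ≡ μ → rate meanTest q x ≤ ε
    meanTest-honest {ε} 0<θ var≤ claim≡μ = ℚ.≤-trans
      (ℚ.≤-reflexive (E-cong S.Ω λ ω → trans (cong ⟦_⟧ (run-meanTest ω))
        (cong (λ c → ⟦ does (θ ≤? ∣ S.average (⟦_⟧ ∘ y) ω - c ∣) ⟧) claim≡μ)))
      (chebyshev S.Ω (S.error y) {ε = ε} 0<θ (ℚ.≤-trans (S.variance y) var≤))

    meanTest-caught : ∀ {ε} → 0ℚ < θ → S.var ≤ ε * (θ * θ) → θ + θ ≤ ∣ claim q - μ ∣ → 1ℚ - ε ≤ rate meanTest q x
    meanTest-caught {ε} 0<θ var≤ far = begin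
      1ℚ - ε
        ≤⟨ ℚ.+-monoʳ-≤ 1ℚ (ℚ.neg-antimono-≤ (chebyshev S.Ω (S.error y) {ε = ε} 0<θ (ℚ.≤-trans (S.variance y) var≤))) ⟩
      1ℚ - E S.Ω (λ ω → ⟦ does (θ ≤? ∣ S.error y ω ∣) ⟧)
        ≡⟨ trans (E-- S.Ω (λ _ → 1ℚ) _) (cong (λ e → e - E S.Ω (λ ω → ⟦ does (θ ≤? ∣ S.error y ω ∣) ⟧)) (E-const S.Ω 1ℚ)) ⟨
      E S.Ω (λ ω → 1ℚ - ⟦ does (θ ≤? ∣ S.error y ω ∣) ⟧)
        ≤⟨ E-mono S.Ω (λ ω → pointwise ω (θ ≤? ∣ S.error y ω ∣) (θ ≤? ∣ S.average (⟦_⟧ ∘ y) ω - claim q ∣)) ⟩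
      E S.Ω (λ ω → ⟦ does (θ ≤? ∣ S.average (⟦_⟧ ∘ y) ω - claim q ∣) ⟧)
        ≡⟨ E-cong S.Ω (λ ω → cong ⟦_⟧ (run-meanTest ω)) ⟨
      rate meanTest q x ∎
      where
      open ℚ.≤-Reasoning
      pointwise : ∀ ω (d : Dec (θ ≤ ∣ S.error y ω ∣)) (d′ : Dec (θ ≤ ∣ S.average (⟦_⟧ ∘ y) ω - claim q ∣)) →
                  1ℚ - ⟦ does d ⟧ ≤ ⟦ does d′ ⟧
      pointwise ω (yes _)  d′       = 0≤⟦⟧ (does d′)
      pointwise ω (no _)   (yes _)  = ℚ.≤-refl
      -- If the sample is accurate and no alarm is raised, the sample mean is strictly within `θ` of
      -- both the true mean and the claim, which are at least `θ + θ` apart.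
      pointwise ω (no ≱θ)  (no ≱θ′) = ⊥-elim (ℚ.<-irrefl refl (begin-strict
        θ + θ                                        ≤⟨ far ⟩
        ∣ claim q - μ ∣                              ≤⟨ ∣∣-sub (claim q) avg μ ⟩
        ∣ claim q - avg ∣ + ∣ avg - μ ∣              ≡⟨ cong (_+ ∣ avg - μ ∣) (∣∣-comm (claim q) avg) ⟩
        ∣ avg - claim q ∣ + ∣ avg - μ ∣              <⟨ ℚ.+-mono-< (ℚ.≰⇒> ≱θ′) (ℚ.≰⇒> ≱θ) ⟩
        θ + θ                                        ∎))
        where avg = S.average (⟦_⟧ ∘ y) ω

-- Expectations as counts of coins

-- Doubling is written as a sum, so that `Fin.splitAt` extracts one bit of the coin.
size : Space → ℕ
size (bits zero)    = 1
size (bits (suc k)) = size (bits k) ℕ.+ size (bits k)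
size (S ⊗ T)        = size S ℕ.* size T

size≢0 : ∀ S → NonZero (size S)
size≢0 (bits zero)    = _
size≢0 (bits (suc k)) = ℕ.>-nonZero (ℕ.m≤n⇒m≤n+o (size (bits k)) (ℕ.>-nonZero⁻¹ (size (bits k)) {{size≢0 (bits k)}}))
size≢0 (S ⊗ T)        = ℕ.m*n≢0 (size S) (size T) {{size≢0 S}} {{size≢0 T}}

decode : ∀ S → Fin (size S) → Point S
decode (bits zero)    r = []
decode (bits (suc k)) r = [ (λ s → false ∷ decode (bits k) s) , (λ s → true ∷ decode (bits k) s) ]′ (Fin.splitAt (size (bits k)) r)
decode (S ⊗ T)        r = decode S (proj₁ (Fin.remQuot {size S} (size T) r)) , decode T (proj₂ (Fin.remQuot {size S} (size T) r))

∑ : ∀ {n} → (Fin n → ℕ) → ℕ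
∑ f = Vec.sum (tabulate f)

∑-cong : ∀ {n} {f g : Fin n → ℕ} → (∀ i → f i ≡ g i) → ∑ f ≡ ∑ g
∑-cong f≡g = cong Vec.sum (Vec.tabulate-cong f≡g)

∑-↑ : ∀ m {n} (f : Fin (m ℕ.+ n) → ℕ) → ∑ f ≡ ∑ (λ i → f (i ↑ˡ n)) ℕ.+ ∑ (λ j → f (m ↑ʳ j))
∑-↑ zero    f = refl
∑-↑ (suc m) f = trans (cong (f Fin.zero ℕ.+_) (∑-↑ m (f ∘ Fin.suc))) (sym (ℕ.+-assoc (f Fin.zero) _ _))

∑-combine : ∀ m {n} (f : Fin (m ℕ.* n) → ℕ) → ∑ f ≡ ∑ (λ i → ∑ λ j → f (Fin.combine {m} {n} i j))
∑-combine zero        f = refl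
∑-combine (suc m) {n} f = trans (∑-↑ n f) (cong (∑ (λ j → f (j ↑ˡ (m ℕ.* n))) ℕ.+_) (∑-combine m (λ i → f (n ↑ʳ i))))

∑-+ : ∀ {n} (f g : Fin n → ℕ) → ∑ (λ i → f i ℕ.+ g i) ≡ ∑ f ℕ.+ ∑ g
∑-+ {zero}  f g = refl
∑-+ {suc n} f g = trans (cong (f Fin.zero ℕ.+ g Fin.zero ℕ.+_) (∑-+ (f ∘ Fin.suc) (g ∘ Fin.suc)))
  (ℕ-solve 4 (λ a b c d → (a ⊕ₛ b) ⊕ₛ (c ⊕ₛ d) ≔ (a ⊕ₛ c) ⊕ₛ (b ⊕ₛ d)) refl (f Fin.zero) (g Fin.zero) _ _)

∑-0 : ∀ n → ∑ {n} (λ _ → 0) ≡ 0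
∑-0 zero    = refl
∑-0 (suc n) = ∑-0 n

∑-swap : ∀ {m n} (f : Fin m → Fin n → ℕ) → ∑ (λ i → ∑ (f i)) ≡ ∑ (λ j → ∑ λ i → f i j)
∑-swap {zero}  {n} f = sym (∑-0 n)
∑-swap {suc m}     f = trans (cong (∑ (f Fin.zero) ℕ.+_) (∑-swap (f ∘ Fin.suc)))
                             (sym (∑-+ (f Fin.zero) (λ j → ∑ λ i → f (Fin.suc i) j)))

∑-decode : ∀ S (g : Point S → ℕ) → fromℕ (∑ (g ∘ decode S)) ≡ fromℕ (size S) * E S (fromℕ ∘ g)
∑-decode (bits zero) g = trans (cong fromℕ (ℕ.+-identityʳ (g []))) (sym (ℚ.*-identityˡ (fromℕ (g []))))
∑-decode (bits (suc k)) g = begin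
  fromℕ (∑ (g ∘ decode (bits (suc k))))
    ≡⟨ cong fromℕ (∑-↑ N (g ∘ decode (bits (suc k)))) ⟩
  fromℕ (∑ (λ i → g (decode (bits (suc k)) (i ↑ˡ N))) ℕ.+ ∑ (λ i → g (decode (bits (suc k)) (N ↑ʳ i))))
    ≡⟨ cong₂ (λ a b → fromℕ (a ℕ.+ b)) (∑-cong λ i → cong (g ∘ [ _ , _ ]′) (Fin.splitAt-↑ˡ N i N))
                                       (∑-cong λ i → cong (g ∘ [ _ , _ ]′) (Fin.splitAt-↑ʳ N N i)) ⟩
  fromℕ (∑ (g ∘ (false ∷_) ∘ decode (bits k)) ℕ.+ ∑ (g ∘ (true ∷_) ∘ decode (bits k)))
    ≡⟨ fromℕ-+ (∑ (g ∘ (false ∷_) ∘ decode (bits k))) (∑ (g ∘ (true ∷_) ∘ decode (bits k))) ⟩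
  fromℕ (∑ (g ∘ (false ∷_) ∘ decode (bits k))) + fromℕ (∑ (g ∘ (true ∷_) ∘ decode (bits k)))
    ≡⟨ cong₂ _+_ (∑-decode (bits k) (g ∘ (false ∷_))) (∑-decode (bits k) (g ∘ (true ∷_))) ⟩
  fromℕ N * e₀ + fromℕ N * e₁
    ≡⟨ solve 3 (λ n a b → n :* a :+ n :* b := (n :+ n) :* (con ½ :* (a :+ b))) refl (fromℕ N) e₀ e₁ ⟩
  (fromℕ N + fromℕ N) * (½ * (e₀ + e₁))
    ≡⟨ cong (_* (½ * (e₀ + e₁))) (fromℕ-+ N N) ⟨
  fromℕ (N ℕ.+ N) * (½ * (e₀ + e₁)) ∎
  where
  open ≡-Reasoning
  N = size (bits k)
  e₀ e₁ : ℚ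
  e₀ = E (bits k) (fromℕ ∘ g ∘ (false ∷_))
  e₁ = E (bits k) (fromℕ ∘ g ∘ (true ∷_))
∑-decode (S ⊗ T) g = begin
  fromℕ (∑ (g ∘ decode (S ⊗ T)))
    ≡⟨ cong fromℕ (∑-combine (size S) (g ∘ decode (S ⊗ T))) ⟩
  fromℕ (∑ λ i → ∑ λ j → g (decode (S ⊗ T) (Fin.combine {size S} {size T} i j)))
    ≡⟨ cong fromℕ (∑-cong λ i → ∑-cong λ j → cong (λ ij → g (decode S (proj₁ ij) , decode T (proj₂ ij))) (Fin.remQuot-combine {size S} {size T} i j)) ⟩
  fromℕ (∑ ((λ s → ∑ λ j → g (s , decode T j)) ∘ decode S))
    ≡⟨ ∑-decode S (λ s → ∑ λ j → g (s , decode T j)) ⟩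
  fromℕ (size S) * E S (λ s → fromℕ (∑ λ j → g (s , decode T j)))
    ≡⟨ cong (fromℕ (size S) *_) (trans (E-cong S λ s → ∑-decode T λ t → g (s , t)) (E-* S (fromℕ (size T)) λ s → E T λ t → fromℕ (g (s , t)))) ⟩
  fromℕ (size S) * (fromℕ (size T) * E (S ⊗ T) (fromℕ ∘ g))
    ≡⟨ ℚ.*-assoc (fromℕ (size S)) (fromℕ (size T)) (E (S ⊗ T) (fromℕ ∘ g)) ⟨
  (fromℕ (size S) * fromℕ (size T)) * E (S ⊗ T) (fromℕ ∘ g)
    ≡⟨ cong (_* E (S ⊗ T) (fromℕ ∘ g)) (fromℕ-* (size S) (size T)) ⟨
  fromℕ (size S ℕ.* size T) * E (S ⊗ T) (fromℕ ∘ g) ∎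
  where open ≡-Reasoning

∑-≤ : ∀ {n} (f : Fin n → ℕ) {c} → (∀ i → fromℕ (f i) ≤ c) → fromℕ (∑ f) ≤ fromℕ n * c
∑-≤ {zero}  f {c} f≤c = ℚ.≤-reflexive (sym (ℚ.*-zeroˡ c))
∑-≤ {suc n} f {c} f≤c = begin
  fromℕ (f Fin.zero ℕ.+ ∑ (f ∘ Fin.suc))         ≡⟨ fromℕ-+ (f Fin.zero) (∑ (f ∘ Fin.suc)) ⟩
  fromℕ (f Fin.zero) + fromℕ (∑ (f ∘ Fin.suc))   ≤⟨ ℚ.+-mono-≤ (f≤c Fin.zero) (∑-≤ (f ∘ Fin.suc) λ i → f≤c (Fin.suc i)) ⟩
  c + fromℕ n * c                                ≡⟨ solve 2 (λ c n → c :+ n :* c := (con 1ℚ :+ n) :* c) refl c (fromℕ n) ⟩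
  (1ℚ + fromℕ n) * c                             ≡⟨ cong (_* c) (fromℕ-+ 1 n) ⟨
  fromℕ (suc n) * c                              ∎
  where open ℚ.≤-Reasoning

∑-≥ : ∀ {n} (f : Fin n → ℕ) {c} → (∀ i → c ≤ fromℕ (f i)) → fromℕ n * c ≤ fromℕ (∑ f)
∑-≥ {zero}  f {c} c≤f = ℚ.≤-reflexive (ℚ.*-zeroˡ c)
∑-≥ {suc n} f {c} c≤f = begin
  fromℕ (suc n) * c                              ≡⟨ cong (_* c) (fromℕ-+ 1 n) ⟩
  (1ℚ + fromℕ n) * c                             ≡⟨ solve 2 (λ c n → (con 1ℚ :+ n) :* c := c :+ n :* c) refl c (fromℕ n) ⟩
  c + fromℕ n * c                                ≤⟨ ℚ.+-mono-≤ (c≤f Fin.zero) (∑-≥ (f ∘ Fin.suc) λ i → c≤f (Fin.suc i)) ⟩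
  fromℕ (f Fin.zero) + fromℕ (∑ (f ∘ Fin.suc))   ≡⟨ fromℕ-+ (f Fin.zero) (∑ (f ∘ Fin.suc)) ⟨
  fromℕ (f Fin.zero ℕ.+ ∑ (f ∘ Fin.suc))         ∎
  where open ℚ.≤-Reasoning

fromℕ-pos : ∀ n .{{_ : NonZero n}} → Positive (fromℕ n)
fromℕ-pos n = ℚ.normalize-pos n 1

module _ (S : Space) (coins : ℕ) .{{_ : NonZero coins}} (f : Point S → Fin coins → Bool) where
  private
    instance
      _ = ℕ.m*n≢0 (size S) coins {{size≢0 S}}
      _ = fromℕ-pos (size S ℕ.* coins)

    total : ℕ
    total = ∑ λ r → ∑ λ s → bit (f (decode S r) s)

    probability : ℚ
    probability = ℤ.+ total / (size S ℕ.* coins)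

    column : ∀ s → fromℕ (∑ λ r → bit (f (decode S r) s)) ≡ fromℕ (size S) * E S (λ ω → ⟦ f ω s ⟧)
    column s = trans (∑-decode S λ ω → bit (f ω s)) (cong (fromℕ (size S) *_) (E-cong S λ ω → sym (⟦⟧≡bit (f ω s))))

    rearrange : ∀ c → fromℕ coins * (fromℕ (size S) * c) ≡ c * fromℕ (size S ℕ.* coins)
    rearrange c = trans (solve 3 (λ m n c → m :* (n :* c) := c :* (n :* m)) refl (fromℕ coins) (fromℕ (size S)) c)
                        (cong (c *_) (sym (fromℕ-* (size S) coins)))

    swapped : fromℕ total ≡ fromℕ (∑ λ s → ∑ λ r → bit (f (decode S r) s))
    swapped = cong fromℕ (∑-swap λ r s → bit (f (decode S r) s))

  -- After exchanging the sums the prover's coin is drawn first, so a bound for every deterministic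
  -- prover suffices. The number of coins of the prover is arbitrary, which is why they are not part
  -- of a `Space`.
  probability-≤ : ∀ {c} → (∀ s → E S (λ ω → ⟦ f ω s ⟧) ≤ c) → probability ≤ c
  probability-≤ {c} ≤c = ℚ.*-cancelʳ-≤-pos (fromℕ (size S ℕ.* coins)) (begin
    probability * fromℕ (size S ℕ.* coins)                ≡⟨ trans (/-as-* total (size S ℕ.* coins)) swapped ⟩
    fromℕ (∑ λ s → ∑ λ r → bit (f (decode S r) s))        ≤⟨ ∑-≤ (λ s → ∑ λ r → bit (f (decode S r) s)) (λ s → ℚ.≤-trans (ℚ.≤-reflexive (column s)) (*-monoˡ (0≤fromℕ (size S)) (≤c s))) ⟩
    fromℕ coins * (fromℕ (size S) * c)                    ≡⟨ rearrange c ⟩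
    c * fromℕ (size S ℕ.* coins)                          ∎)
    where open ℚ.≤-Reasoning

  probability-≥ : ∀ {c} → (∀ s → c ≤ E S (λ ω → ⟦ f ω s ⟧)) → c ≤ probability
  probability-≥ {c} c≤ = ℚ.*-cancelʳ-≤-pos (fromℕ (size S ℕ.* coins)) (begin
    c * fromℕ (size S ℕ.* coins)                          ≡⟨ rearrange c ⟨
    fromℕ coins * (fromℕ (size S) * c)                    ≤⟨ ∑-≥ (λ s → ∑ λ r → bit (f (decode S r) s)) (λ s → ℚ.≤-trans (*-monoˡ (0≤fromℕ (size S)) (c≤ s)) (ℚ.≤-reflexive (sym (column s)))) ⟩
    fromℕ (∑ λ s → ∑ λ r → bit (f (decode S r) s))        ≡⟨ trans (/-as-* total (size S ℕ.* coins)) swapped ⟨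
    probability * fromℕ (size S ℕ.* coins)                ∎)
    where open ℚ.≤-Reasoning

-- Padding of the input and encoding of the reply

n≤2^⌈log2⌉ : ∀ n a → n ℕ.≤ 2 ℕ.^ ℕ.⌈log2⌉ n a
n≤2^⌈log2⌉ 0             a        = ℕ.z≤n
n≤2^⌈log2⌉ 1             a        = ℕ.≤-refl
n≤2^⌈log2⌉ (suc (suc n)) (acc rs) = begin
  suc (suc n)                            ≤⟨ ℕ.s≤s (ℕ.s≤s (ℕ.≤-trans (ℕ.≤-reflexive (sym (ℕ.⌊n/2⌋+⌈n/2⌉≡n n))) (ℕ.+-monoˡ-≤ h (ℕ.⌊n/2⌋≤⌈n/2⌉ n)))) ⟩
  suc (suc (h ℕ.+ h))                    ≡⟨ ℕ-solve 1 (λ h → ℕ-con 2 ⊕ₛ (h ⊕ₛ h) ≔ ℕ-con 2 ⊗ₛ (ℕ-con 1 ⊕ₛ h)) refl h ⟩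
  2 ℕ.* suc h                            ≤⟨ ℕ.*-monoʳ-≤ 2 (n≤2^⌈log2⌉ (suc h) (rs (ℕ.⌈n/2⌉<n n))) ⟩
  2 ℕ.* 2 ℕ.^ ℕ.⌈log2⌉ (suc h) _         ∎
  where
  open ℕ.≤-Reasoning
  h = ℕ.⌈ n /2⌉

n≤2^⌈log₂n⌉ : ∀ n → n ℕ.≤ 2 ℕ.^ ⌈log₂ n ⌉
n≤2^⌈log₂n⌉ n = n≤2^⌈log2⌉ n _

2^⌈log₂n⌉≤2n : ∀ n .{{_ : NonZero n}} → 2 ℕ.^ ⌈log₂ n ⌉ ℕ.≤ 2 ℕ.* n
2^⌈log₂n⌉≤2n n = bound ⌈log₂ n ⌉ refl
  where
  bound : ∀ l → ⌈log₂ n ⌉ ≡ l → 2 ℕ.^ l ℕ.≤ 2 ℕ.* n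
  bound zero    _  = ℕ.≤-trans (ℕ.>-nonZero⁻¹ n) (ℕ.m≤n*m n 2)
  bound (suc l) eq = ℕ.*-monoʳ-≤ 2 (ℕ.<⇒≤ (ℕ.≰⇒> {n} {2 ℕ.^ l} λ (n≤2^l : n ℕ.≤ 2 ℕ.^ l) → ℕ.<-irrefl refl
    (ℕ.≤-trans (ℕ.≤-reflexive (sym eq)) (ℕ.≤-trans (ℕ.⌈log₂⌉-mono-≤ {n} {2 ℕ.^ l} n≤2^l) (ℕ.≤-reflexive (ℕ.⌈log₂2^n⌉≡n l))))))

-- Positions beyond the end of the list are padding, read as false.
layout : ∀ {A : Set} m → List A → Vec Bool m → Maybe A
layout zero    ps v           = List.head ps
layout (suc m) ps (false ∷ v) = layout m (List.take (2 ℕ.^ m) ps) v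
layout (suc m) ps (true ∷ v)  = layout m (List.drop (2 ℕ.^ m) ps) v

fetch : ∀ {n} → Maybe (Fin n) → Algorithm n Bool
fetch nothing  = output false
fetch (just i) = query i output

queries-fetch : ∀ {n} (i : Maybe (Fin n)) x → queries (fetch i) x ℕ.≤ 1
queries-fetch nothing  x = ℕ.z≤n
queries-fetch (just i) x = ℕ.≤-refl

ones : ∀ {n} → Vec Bool n → List (Fin n) → ℕ
ones x []       = 0
ones x (p ∷ ps) = bit (lookup x p) ℕ.+ ones x ps

ones-take-drop : ∀ {n} (x : Vec Bool n) k ps → ones x (List.take k ps) ℕ.+ ones x (List.drop k ps) ≡ ones x ps
ones-take-drop x zero    ps       = refl
ones-take-drop x (suc k) []       = refl
ones-take-drop x (suc k) (p ∷ ps) = trans (ℕ.+-assoc (bit (lookup x p)) _ _) (cong (bit (lookup x p) ℕ.+_) (ones-take-drop x k ps))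

ones-tabulate : ∀ {n m} (x : Vec Bool n) (f : Fin m → Fin n) → ones x (List.tabulate f) ≡ ∑ (λ i → bit (lookup x (f i)))
ones-tabulate {m = zero}  x f = refl
ones-tabulate {m = suc m} x f = cong (bit (lookup x (f Fin.zero)) ℕ.+_) (ones-tabulate x (f ∘ Fin.suc))

ones-allFin : ∀ {n} (x : Vec Bool n) → ones x (List.tabulate λ i → i) ≡ Vec.sum (Vec.map bit x)
ones-allFin x = trans (ones-tabulate x λ i → i)
  (cong Vec.sum (trans (Vec.tabulate-∘ bit (lookup x)) (cong (Vec.map bit) (Vec.tabulate∘lookup x))))

E-layout : ∀ {n} (x : Vec Bool n) m ps → List.length ps ℕ.≤ 2 ℕ.^ m →
           E (bits m) (λ v → ⟦ run (fetch (layout m ps v)) x ⟧) ≡ fromℕ (ones x ps) * ½^ m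
E-layout x zero    []       _ = refl
E-layout x zero    (p ∷ []) _ = trans (⟦⟧≡bit (lookup x p)) (trans (cong fromℕ (sym (ℕ.+-identityʳ (bit (lookup x p))))) (sym (ℚ.*-identityʳ _)))
E-layout x zero    (p ∷ q ∷ ps) (ℕ.s≤s ())
E-layout x (suc m) ps       h = begin
  ½ * (E (bits m) (λ v → ⟦ run (fetch (layout m (List.take (2 ℕ.^ m) ps) v)) x ⟧) + E (bits m) (λ v → ⟦ run (fetch (layout m (List.drop (2 ℕ.^ m) ps) v)) x ⟧))
    ≡⟨ cong (½ *_) (cong₂ _+_ (E-layout x m (List.take (2 ℕ.^ m) ps) short₁) (E-layout x m (List.drop (2 ℕ.^ m) ps) short₂)) ⟩
  ½ * (a * ½^ m + b * ½^ m)
    ≡⟨ solve 3 (λ a b h → con ½ :* (a :* h :+ b :* h) := (a :+ b) :* (con ½ :* h)) refl a b (½^ m) ⟩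
  (a + b) * ½^ (suc m)
    ≡⟨ cong (_* ½^ (suc m)) (trans (sym (fromℕ-+ (ones x (List.take (2 ℕ.^ m) ps)) (ones x (List.drop (2 ℕ.^ m) ps)))) (cong fromℕ (ones-take-drop x (2 ℕ.^ m) ps))) ⟩
  fromℕ (ones x ps) * ½^ (suc m) ∎
  where
  open ≡-Reasoning
  a b : ℚ
  a = fromℕ (ones x (List.take (2 ℕ.^ m) ps))
  b = fromℕ (ones x (List.drop (2 ℕ.^ m) ps))
  short₁ : List.length (List.take (2 ℕ.^ m) ps) ℕ.≤ 2 ℕ.^ m
  short₁ = ℕ.≤-trans (ℕ.≤-reflexive (List.length-take (2 ℕ.^ m) ps)) (ℕ.m⊓n≤m (2 ℕ.^ m) _)
  short₂ : List.length (List.drop (2 ℕ.^ m) ps) ℕ.≤ 2 ℕ.^ m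
  short₂ = ℕ.≤-trans (ℕ.≤-reflexive (List.length-drop (2 ℕ.^ m) ps))
             (ℕ.m≤n+o⇒m∸n≤o _ (2 ℕ.^ m) (ℕ.≤-trans h (ℕ.≤-reflexive (cong (2 ℕ.^ m ℕ.+_) (ℕ.+-identityʳ (2 ℕ.^ m))))))

count : ∀ k → (Vec Bool k → Bool) → ℕ
count zero    y = bit (y [])
count (suc k) y = count k (y ∘ (false ∷_)) ℕ.+ count k (y ∘ (true ∷_))

count-cong : ∀ k {y z : Vec Bool k → Bool} → (∀ v → y v ≡ z v) → count k y ≡ count k z
count-cong zero    y≡z = cong bit (y≡z [])
count-cong (suc k) y≡z = cong₂ ℕ._+_ (count-cong k λ v → y≡z (false ∷ v)) (count-cong k λ v → y≡z (true ∷ v))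

count≤2^ : ∀ k y → count k y ℕ.≤ 2 ℕ.^ k
count≤2^ zero    y with y []
... | false = ℕ.z≤n
... | true  = ℕ.≤-refl
count≤2^ (suc k) y = ℕ.≤-trans (ℕ.+-mono-≤ (count≤2^ k (y ∘ (false ∷_))) (count≤2^ k (y ∘ (true ∷_))))
                               (ℕ.≤-reflexive (cong (2 ℕ.^ k ℕ.+_) (sym (ℕ.+-identityʳ (2 ℕ.^ k)))))

E-count : ∀ k y → E (bits k) (⟦_⟧ ∘ y) ≡ fromℕ (count k y) * ½^ k
E-count zero    y = trans (⟦⟧≡bit (y [])) (sym (ℚ.*-identityʳ _))
E-count (suc k) y = trans (cong (½ *_) (cong₂ _+_ (E-count k (y ∘ (false ∷_))) (E-count k (y ∘ (true ∷_)))))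
  (trans (solve 3 (λ a b h → con ½ :* (a :* h :+ b :* h) := (a :+ b) :* (con ½ :* h)) refl
           (fromℕ (count k (y ∘ (false ∷_)))) (fromℕ (count k (y ∘ (true ∷_)))) (½^ k))
         (cong (_* ½^ (suc k)) (sym (fromℕ-+ (count k (y ∘ (false ∷_))) (count k (y ∘ (true ∷_)))))))

-- Binary numerals and tables of numerals

value : ∀ {w} → Vec Bool w → ℕ
value []              = 0
value {suc w} (b ∷ v) = bit b ℕ.* 2 ℕ.^ w ℕ.+ value v

value<2^ : ∀ {w} (v : Vec Bool w) → value v ℕ.< 2 ℕ.^ w
value<2^ []                  = ℕ.≤-refl
value<2^ {suc w} (false ∷ v) = ℕ.≤-trans (value<2^ v) (ℕ.m≤m+n (2 ℕ.^ w) _)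
value<2^ {suc w} (true ∷ v)  = ℕ.≤-trans (ℕ.≤-reflexive (sym (ℕ.+-suc (2 ℕ.^ w ℕ.+ 0) (value v))))
  (ℕ.≤-trans (ℕ.+-mono-≤ (ℕ.≤-reflexive (ℕ.+-identityʳ (2 ℕ.^ w))) (value<2^ v)) (ℕ.≤-reflexive (cong (2 ℕ.^ w ℕ.+_) (sym (ℕ.+-identityʳ (2 ℕ.^ w))))))

encode : ∀ w → ℕ → Vec Bool w
encode zero    j = []
encode (suc w) j with 2 ℕ.^ w ℕ.≤? j
... | yes _ = true ∷ encode w (j ℕ.∸ 2 ℕ.^ w)
... | no _  = false ∷ encode w j

value-encode : ∀ w j → j ℕ.< 2 ℕ.^ w → value (encode w j) ≡ j
value-encode zero    zero    _            = refl
value-encode zero    (suc j) (ℕ.s≤s ())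
value-encode (suc w) j       h with 2 ℕ.^ w ℕ.≤? j
... | no  ≰j = value-encode w j (ℕ.≰⇒> ≰j)
... | yes ≤j = trans (cong₂ ℕ._+_ (ℕ.+-identityʳ (2 ℕ.^ w)) (value-encode w (j ℕ.∸ 2 ℕ.^ w) small)) (ℕ.m+[n∸m]≡n ≤j)
  where
  small : j ℕ.∸ 2 ℕ.^ w ℕ.< 2 ℕ.^ w
  small = ℕ.+-cancelˡ-< (2 ℕ.^ w) _ _ (ℕ.≤-<-trans (ℕ.≤-reflexive (ℕ.m+[n∸m]≡n ≤j))
            (ℕ.≤-trans h (ℕ.≤-reflexive (cong (2 ℕ.^ w ℕ.+_) (ℕ.+-identityʳ (2 ℕ.^ w))))))

-- Recursive, so that the two halves of a table have the right lengths by definition; the closed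
-- form is needed only for the communication bound.
tableSize : ℕ → ℕ → ℕ
tableSize zero    w = w
tableSize (suc a) w = tableSize a w ℕ.+ tableSize a w

tableSize≡ : ∀ a w → tableSize a w ≡ 2 ℕ.^ a ℕ.* w
tableSize≡ zero    w = sym (ℕ.*-identityˡ w)
tableSize≡ (suc a) w = trans (cong₂ ℕ._+_ (tableSize≡ a w) (tableSize≡ a w))
  (ℕ-solve 2 (λ p w → p ⊗ₛ w ⊕ₛ p ⊗ₛ w ≔ (ℕ-con 2 ⊗ₛ p) ⊗ₛ w) refl (2 ℕ.^ a) w)

write : ∀ a {w} → (Vec Bool a → Vec Bool w) → Vec Bool (tableSize a w)
write zero    f = f []
write (suc a) f = write a (f ∘ (false ∷_)) ++ write a (f ∘ (true ∷_))

entry : ∀ a {w} → Vec Bool (tableSize a w) → Vec Bool a → Vec Bool w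
entry zero        t []          = t
entry (suc a) {w} t (false ∷ β) = entry a (Vec.take (tableSize a w) t) β
entry (suc a) {w} t (true ∷ β)  = entry a (Vec.drop (tableSize a w) t) β

take-++ : ∀ {A : Set} {m n} (u : Vec A m) (v : Vec A n) → Vec.take m (u ++ v) ≡ u
take-++ []      v = refl
take-++ (a ∷ u) v = cong (a ∷_) (take-++ u v)

drop-++ : ∀ {A : Set} {m n} (u : Vec A m) (v : Vec A n) → Vec.drop m (u ++ v) ≡ v
drop-++ []      v = refl
drop-++ (a ∷ u) v = drop-++ u v

entry-write : ∀ a {w} (f : Vec Bool a → Vec Bool w) β → entry a (write a f) β ≡ f β
entry-write zero    f []          = refl
entry-write (suc a) f (false ∷ β) = trans (cong (λ t → entry a t β) (take-++ (write a (f ∘ (false ∷_))) _)) (entry-write a _ β)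
entry-write (suc a) f (true ∷ β)  = trans (cong (λ t → entry a t β) (drop-++ (write a (f ∘ (false ∷_))) _)) (entry-write a _ β)

-- Finding inconsistent blocks

module Levels {n : ℕ} {Q : Set} (f a : ℕ) (cell : Q × Vec Bool a → Vec Bool (2 ℕ.* f) → Algorithm n Bool)
              (cell-cost : ∀ q v x → queries (cell q v) x ℕ.≤ 1) (claim : Q × Vec Bool a → ℚ) where

  -- At most `2 ^ (f + 1)` level tests with at most `6 * 2 ^ (3 f + 4)` repetitions each must be
  -- outweighed. Two halvings per batch give `½^ (4 f + 10)`, which leaves a false alarm rate of
  -- `6 * ½^ 5`; this fixes the summand 5.
  b batches precision : ℕ
  b         = 2 ℕ.* f
  batches   = 2 ℕ.* f ℕ.+ 5
  precision = 2 ℕ.+ ⌈log₂ batches ⌉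

  -- An honest block fails all batches with probability at most
  -- ½^ (batches * precision), one erring by 2θ with probability at least ½,
  -- as 4 * batches ≤ 2 ^ precision.
  levelTest : Sampler b → ℚ → ℕ → Test n Q
  levelTest S θ s = anyOf s (atRandom a (allOf batches (meanTest S θ cell cell-cost claim)))

  -- Errors below ½^ (3 f + 3), half of the average error to be detected, may
  -- be ignored.  Expected number of hits: 3 at least, over all levels.
  fullTest : Test n Q
  fullTest = levelTest (identitySampler b) (½^ (3 ℕ.* f ℕ.+ 4)) (6 ℕ.* 2 ℕ.^ (2 ℕ.* f ℕ.+ 3))

  -- The width makes the variance exactly `½^ precision * θ²` at the threshold `θ = ½^ (suc i)` of
  -- its level. Hashed positions may repeat, so the sample may outgrow the block, as it does at
  -- `i = f`.
  sampler : ℕ → Sampler b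
  sampler i = hashSampler b (precision ℕ.+ (suc i ℕ.+ suc i))

  -- Half of this number has to cover `scale` times the height `½^ i + ½^ i` of the corresponding
  -- layer, which asks for `6 * 2 ^ (3 f + 4 - i)`.
  repetitions : ℕ → ℕ
  repetitions i = 6 ℕ.* (2 ℕ.^ (2 ℕ.* f ℕ.+ 4) ℕ.* 2 ℕ.^ (f ℕ.∸ i))

  levels : ℕ → Test n Q
  levels zero    = fullTest
  levels (suc i) = either (levelTest (sampler i) (½^ (suc i)) (repetitions i)) (levels i)

  4*batches≤2^precision : 4 ℕ.* batches ℕ.≤ 2 ℕ.^ precision
  4*batches≤2^precision = ℕ.≤-trans (ℕ.*-monoʳ-≤ 4 (n≤2^⌈log₂n⌉ batches)) (ℕ.≤-reflexive (ℕ.*-assoc 2 2 (2 ℕ.^ ⌈log₂ batches ⌉)))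

  4*batches*½^precision≤1 : fromℕ 4 * fromℕ batches * ½^ precision ≤ 1ℚ
  4*batches*½^precision≤1 = begin
    fromℕ 4 * fromℕ batches * ½^ precision       ≡⟨ cong (_* ½^ precision) (fromℕ-* 4 batches) ⟨
    fromℕ (4 ℕ.* batches) * ½^ precision         ≤⟨ *-monoʳ (0≤½^ precision) (fromℕ-mono 4*batches≤2^precision) ⟩
    fromℕ (2 ℕ.^ precision) * ½^ precision       ≡⟨ 2^*½^ precision ⟩
    1ℚ                                           ∎
    where open ℚ.≤-Reasoning

  var-sampler : ∀ i → Sampler.var (sampler i) ≤ ½^ precision * (½^ (suc i) * ½^ (suc i))
  var-sampler i = ℚ.≤-reflexive (trans (½^-+ precision (suc i ℕ.+ suc i)) (cong (½^ precision *_) (½^-+ (suc i) (suc i))))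

  var-full : ∀ {θ} → 0ℚ ≤ ½^ precision * (θ * θ)
  var-full {θ} = 0≤* (0≤½^ precision) (0≤p² θ)

  module _ (q : Q) (x : Vec Bool n) where

    mean : Vec Bool a → ℚ
    mean β = E (bits b) λ γ → ⟦ run (cell (q , β) γ) x ⟧

    deviationAt : Vec Bool a → ℚ
    deviationAt β = ∣ claim (q , β) - mean β ∣

    module _ (honest : ∀ β → claim (q , β) ≡ mean β) where

      falseAlarm : ℚ
      falseAlarm = fromℕ (6 ℕ.* 2 ℕ.^ (3 ℕ.* f ℕ.+ 4)) * ½^ (4 ℕ.* f ℕ.+ 10)

      levelTest-honest : ∀ S {θ s} → 0ℚ < θ → Sampler.var S ≤ ½^ precision * (θ * θ) →
                         s ℕ.≤ 6 ℕ.* 2 ℕ.^ (3 ℕ.* f ℕ.+ 4) → rate (levelTest S θ s) q x ≤ falseAlarm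
      levelTest-honest S {θ} {s} 0<θ var≤ s≤ = begin
        rate (levelTest S θ s) q x                            ≤⟨ rate-anyOf s T q x ⟩
        fromℕ s * rate T q x                                  ≤⟨ *-mono (0≤fromℕ s) (0≤½^ (4 ℕ.* f ℕ.+ 10)) (fromℕ-mono s≤)
                                                                   (E-≤ (bits a) λ β → ℚ.≤-trans
                                                                     (rate-allOf-≤ batches precision M (q , β) x (meanTest-honest S θ cell cell-cost claim (q , β) x 0<θ var≤ (honest β)))
                                                                     (½^-antimono enough)) ⟩
        falseAlarm                                            ∎
        where
        open ℚ.≤-Reasoning
        M = meanTest S θ cell cell-cost claim
        T = atRandom a (allOf batches M)
        -- Each batch contributes at least the two halvings in the constant summand of `precision`.
        enough : 4 ℕ.* f ℕ.+ 10 ℕ.≤ batches ℕ.* precision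
        enough = ℕ.≤-trans (ℕ.≤-reflexive (ℕ-solve 1 (λ f → ℕ-con 4 ⊗ₛ f ⊕ₛ ℕ-con 10 ≔ (ℕ-con 2 ⊗ₛ f ⊕ₛ ℕ-con 5) ⊗ₛ ℕ-con 2) refl f))
                           (ℕ.*-monoʳ-≤ batches (ℕ.m≤m+n 2 ⌈log₂ batches ⌉))

      levels-honest : ∀ j → rate (levels j) q x ≤ fromℕ (suc j) * falseAlarm
      levels-honest zero    = ℚ.≤-trans
        (levelTest-honest (identitySampler b) (½^-pos (3 ℕ.* f ℕ.+ 4)) (var-full {½^ (3 ℕ.* f ℕ.+ 4)})
          (ℕ.*-monoʳ-≤ 6 (ℕ.^-monoʳ-≤ 2 (ℕ.+-mono-≤ (ℕ.*-monoˡ-≤ f (ℕ.n≤1+n 2)) (ℕ.n≤1+n 3)))))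
        (ℚ.≤-reflexive (sym (ℚ.*-identityˡ falseAlarm)))
      levels-honest (suc i) = begin
        rate (levels (suc i)) q x                                    ≤⟨ rate-either (levelTest (sampler i) (½^ (suc i)) (repetitions i)) (levels i) q x ⟩
        rate (levelTest (sampler i) (½^ (suc i)) (repetitions i)) q x + rate (levels i) q x
                                                                     ≤⟨ ℚ.+-mono-≤ (levelTest-honest (sampler i) (½^-pos (suc i)) (var-sampler i) few) (levels-honest i) ⟩
        falseAlarm + fromℕ (suc i) * falseAlarm                      ≡⟨ solve 2 (λ c n → c :+ n :* c := (con 1ℚ :+ n) :* c) refl falseAlarm (fromℕ (suc i)) ⟩
        (1ℚ + fromℕ (suc i)) * falseAlarm                            ≡⟨ cong (_* falseAlarm) (fromℕ-+ 1 (suc i)) ⟨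
        fromℕ (suc (suc i)) * falseAlarm                             ∎
        where
        open ℚ.≤-Reasoning
        few : repetitions i ℕ.≤ 6 ℕ.* 2 ℕ.^ (3 ℕ.* f ℕ.+ 4)
        few = ℕ.*-monoʳ-≤ 6 (ℕ.≤-trans (ℕ.*-monoʳ-≤ (2 ℕ.^ (2 ℕ.* f ℕ.+ 4)) (ℕ.^-monoʳ-≤ 2 (ℕ.m∸n≤m f i)))
          (ℕ.≤-reflexive (trans (sym (ℕ.^-distribˡ-+-* 2 (2 ℕ.* f ℕ.+ 4) f))
            (cong (2 ℕ.^_) (ℕ-solve 1 (λ f → (ℕ-con 2 ⊗ₛ f ⊕ₛ ℕ-con 4) ⊕ₛ f ≔ ℕ-con 3 ⊗ₛ f ⊕ₛ ℕ-con 4) refl f)))))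

      levels-complete : rate (levels (suc f)) q x ≤ ℤ.+ 1 / 4
      levels-complete = begin
        rate (levels (suc f)) q x                                    ≤⟨ levels-honest (suc f) ⟩
        fromℕ (2 ℕ.+ f) * (fromℕ (6 ℕ.* 2 ℕ.^ e) * ½^ (4 ℕ.* f ℕ.+ 10))
          ≤⟨ *-monoʳ (0≤* (0≤fromℕ (6 ℕ.* 2 ℕ.^ e)) (0≤½^ (4 ℕ.* f ℕ.+ 10))) (fromℕ-mono (2+f≤2^ f)) ⟩
        fromℕ (2 ℕ.^ suc f) * (fromℕ (6 ℕ.* 2 ℕ.^ e) * ½^ (4 ℕ.* f ℕ.+ 10))
          ≡⟨ cong₂ (λ p h → fromℕ (2 ℕ.^ suc f) * (p * h)) (fromℕ-* 6 (2 ℕ.^ e))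
               (trans (cong ½^_ (ℕ-solve 1 (λ f → ℕ-con 4 ⊗ₛ f ⊕ₛ ℕ-con 10 ≔ ℕ-con 5 ⊕ₛ ((ℕ-con 1 ⊕ₛ f) ⊕ₛ (ℕ-con 3 ⊗ₛ f ⊕ₛ ℕ-con 4))) refl f))
                 (trans (½^-+ 5 (suc f ℕ.+ e)) (cong (½^ 5 *_) (½^-+ (suc f) e)))) ⟩
        fromℕ (2 ℕ.^ suc f) * ((fromℕ 6 * fromℕ (2 ℕ.^ e)) * (½^ 5 * (½^ (suc f) * ½^ e)))
          ≡⟨ solve 6 (λ p s q c g h → p :* ((s :* q) :* (c :* (g :* h))) := (s :* c) :* ((p :* g) :* (q :* h))) refl
               (fromℕ (2 ℕ.^ suc f)) (fromℕ 6) (fromℕ (2 ℕ.^ e)) (½^ 5) (½^ (suc f)) (½^ e) ⟩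
        (fromℕ 6 * ½^ 5) * ((fromℕ (2 ℕ.^ suc f) * ½^ (suc f)) * (fromℕ (2 ℕ.^ e) * ½^ e))
          ≡⟨ cong₂ (λ p q → (fromℕ 6 * ½^ 5) * (p * q)) (2^*½^ (suc f)) (2^*½^ e) ⟩
        -- The bound is 3/16, leaving 1/16 to spare.
        (fromℕ 6 * ½^ 5) * (1ℚ * 1ℚ)                                 ≤⟨ ≤-via (ℤ.+ 1 / 16) (ℚ.nonNegative⁻¹ (ℤ.+ 1 / 16)) refl ⟩
        ℤ.+ 1 / 4                                                    ∎
        where
        open ℚ.≤-Reasoning
        e : ℕ
        e = 3 ℕ.* f ℕ.+ 4
        2+f≤2^ : ∀ f → 2 ℕ.+ f ℕ.≤ 2 ℕ.^ suc f
        2+f≤2^ zero    = ℕ.≤-refl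
        2+f≤2^ (suc f) = ℕ.≤-trans (ℕ.s≤s (2+f≤2^ f)) (ℕ.+-mono-≤ (ℕ.>-nonZero⁻¹ (2 ℕ.^ suc f) {{ℕ.m^n≢0 2 (suc f)}}) (ℕ.m≤m+n (2 ℕ.^ suc f) 0))

    far : ℚ → ℚ
    far θ = E (bits a) λ β → ⟦ does (θ ≤? deviationAt β) ⟧

    levelTest-rate : ∀ S {θ} → 0ℚ < θ → Sampler.var S ≤ ½^ precision * (θ * θ) →
                     ½ * far (θ + θ) ≤ rate (atRandom a (allOf batches (meanTest S θ cell cell-cost claim))) q x
    levelTest-rate S {θ} 0<θ var≤ = ℚ.≤-trans (ℚ.≤-reflexive (sym (E-* (bits a) ½ _)))
      (E-mono (bits a) λ β → pointwise β (θ + θ ≤? deviationAt β))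
      where
      M = meanTest S θ cell cell-cost claim
      pointwise : ∀ β (d : Dec (θ + θ ≤ deviationAt β)) → ½ * ⟦ does d ⟧ ≤ rate (allOf batches M) (q , β) x
      pointwise β (no _)     = 0≤rate (allOf batches M) (q , β) x
      pointwise β (yes 2θ≤D) = ℚ.≤-trans
        -- The batches miss with total probability at most `batches * ½^ precision ≤ 1/4`, so
        -- detection succeeds with probability 3/4; one half of it is claimed.
        (≤-via ((ℤ.+ 1 / 4) * (1ℚ - fromℕ 4 * fromℕ batches * ½^ precision) + (ℤ.+ 1 / 4))
          (0≤+ (0≤* (ℚ.nonNegative⁻¹ (ℤ.+ 1 / 4)) (0≤-diff 4*batches*½^precision≤1)) (ℚ.nonNegative⁻¹ (ℤ.+ 1 / 4)))
          (solve 2 (λ u e → con 1ℚ :- u :* e := con (½ * 1ℚ) :+ (con (ℤ.+ 1 / 4) :* (con 1ℚ :- (con (fromℕ 4) :* u) :* e) :+ con (ℤ.+ 1 / 4))) refl (fromℕ batches) (½^ precision)))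
        (rate-allOf-≥ batches M (q , β) x (0≤½^ precision) (meanTest-caught S θ cell cell-cost claim (q , β) x {ε = ½^ precision} 0<θ var≤ 2θ≤D))

    -- A step function whose average over blocks involves only the fractions of blocks beyond fixed
    -- thresholds, which are what random probing can hit. One step of height `½^ f` serves all
    -- errors from `½^ (3 f + 3)` to `½^ f`: a block is then read entirely, at a cost that does not
    -- depend on its error.
    layers : ℕ → ℚ → ℚ
    layers zero    d = ½^ f * ⟦ does (½^ (3 ℕ.* f ℕ.+ 3) ≤? d) ⟧
    layers (suc i) d = (½^ i + ½^ i) * ⟦ does (½^ i ≤? d) ⟧ + layers i d

    ½^-double : ∀ i → ½^ (suc i) + ½^ (suc i) ≡ ½^ i
    ½^-double i = solve 1 (λ h → con ½ :* h :+ con ½ :* h := h) refl (½^ i)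

    0≤layers : ∀ i d → 0ℚ ≤ layers i d
    0≤layers zero    d = 0≤* (0≤½^ f) (0≤⟦⟧ (does (½^ (3 ℕ.* f ℕ.+ 3) ≤? d)))
    0≤layers (suc i) d = 0≤+ (0≤* (0≤+ (0≤½^ i) (0≤½^ i)) (0≤⟦⟧ (does (½^ i ≤? d)))) (0≤layers i d)

    -- Descent through the dyadic scales: as long as `d` is not covered, it is at most twice the
    -- current scale `½^ i`; if it also reaches that scale, the step of height `½^ i + ½^ i` covers
    -- it. The bound 2 on `d` starts the descent at scale 1.
    layers-or-small : ∀ i {d} → d ≤ fromℕ 2 → d ≤ layers i d ⊎ d ≤ ½^ i + ½^ i
    layers-or-small zero    d≤2 = inj₂ d≤2
    layers-or-small (suc i) {d} d≤2 with layers-or-small i d≤2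
    ... | inj₁ d≤ = inj₁ (ℚ.≤-trans d≤ (≤-via ((½^ i + ½^ i) * ⟦ does (½^ i ≤? d) ⟧)
                      (0≤* (0≤+ (0≤½^ i) (0≤½^ i)) (0≤⟦⟧ (does (½^ i ≤? d)))) (ℚ.+-comm _ (layers i d))))
    ... | inj₂ d≤ = top (½^ i ≤? d)
      where
      top : ∀ (D : Dec (½^ i ≤ d)) → d ≤ (½^ i + ½^ i) * ⟦ does D ⟧ + layers i d ⊎ d ≤ ½^ (suc i) + ½^ (suc i)
      top (no ≰d) = inj₂ (ℚ.≤-trans (ℚ.<⇒≤ (ℚ.≰⇒> ≰d)) (ℚ.≤-reflexive (sym (½^-double i))))
      top (yes _) = inj₁ (ℚ.≤-trans d≤ (≤-via (layers i d) (0≤layers i d) (cong (_+ layers i d) (ℚ.*-identityʳ (½^ i + ½^ i)))))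

    layers-bottom : ∀ j {d} (D : Dec (½^ (3 ℕ.* f ℕ.+ 3) ≤ d)) → ½^ f * ⟦ does D ⟧ ≤ layers j d → d ≤ ½^ f → d ≤ ½^ (3 ℕ.* f ℕ.+ 3) + layers j d
    layers-bottom j {d} (yes _) low d≤ = ℚ.≤-trans d≤ (ℚ.≤-trans (ℚ.≤-reflexive (sym (ℚ.*-identityʳ (½^ f)))) (ℚ.≤-trans low
      (≤-via (½^ (3 ℕ.* f ℕ.+ 3)) (0≤½^ (3 ℕ.* f ℕ.+ 3)) (ℚ.+-comm _ (layers j d)))))
    layers-bottom j {d} (no ≰d) low d≤ = ℚ.≤-trans (ℚ.<⇒≤ (ℚ.≰⇒> ≰d)) (≤-via (layers j d) (0≤layers j d) refl)

    layers-mono : ∀ j d → layers 0 d ≤ layers j d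
    layers-mono zero    d = ℚ.≤-refl
    layers-mono (suc i) d = ℚ.≤-trans (layers-mono i d) (≤-via ((½^ i + ½^ i) * ⟦ does (½^ i ≤? d) ⟧)
      (0≤* (0≤+ (0≤½^ i) (0≤½^ i)) (0≤⟦⟧ (does (½^ i ≤? d)))) (ℚ.+-comm _ (layers i d)))

    layer-cake : ∀ {d} → d ≤ fromℕ 2 → d ≤ ½^ (3 ℕ.* f ℕ.+ 3) + layers (suc f) d
    layer-cake {d} d≤2 with layers-or-small (suc f) d≤2
    ... | inj₁ d≤ = ℚ.≤-trans d≤ (≤-via (½^ (3 ℕ.* f ℕ.+ 3)) (0≤½^ (3 ℕ.* f ℕ.+ 3)) (ℚ.+-comm _ (layers (suc f) d)))
    ... | inj₂ d≤ = layers-bottom (suc f) (½^ (3 ℕ.* f ℕ.+ 3) ≤? d) (layers-mono (suc f) d) (ℚ.≤-trans d≤ (ℚ.≤-reflexive (½^-double f)))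

    -- Three over `½^ (3 f + 3)`, the part of the average error that is left to the layers.
    scale : ℚ
    scale = fromℕ 3 * fromℕ (2 ℕ.^ (3 ℕ.* f ℕ.+ 3))

    fullRound : Test n Q
    fullRound = atRandom a (allOf batches (meanTest (identitySampler b) (½^ (3 ℕ.* f ℕ.+ 4)) cell cell-cost claim))

    round : ℕ → Test n Q
    round i = atRandom a (allOf batches (meanTest (sampler i) (½^ (suc i)) cell cell-cost claim))

    weight : ℕ → ℚ
    weight zero    = fromℕ (6 ℕ.* 2 ℕ.^ (2 ℕ.* f ℕ.+ 3)) * rate fullRound q x
    weight (suc i) = fromℕ (repetitions i) * rate (round i) q x + weight i

    levels-caught : ∀ j → Caught (levels j) q x (weight j)
    levels-caught zero    = caught-anyOf (6 ℕ.* 2 ℕ.^ (2 ℕ.* f ℕ.+ 3)) fullRound q x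
    levels-caught (suc i) = caught-either (anyOf (repetitions i) (round i)) (levels i) q x
                              (caught-anyOf (repetitions i) (round i) q x) (levels-caught i)

    -- Level by level: `scale` times the height of a layer is at most half the number of
    -- repetitions, and half the fraction of blocks beyond its threshold is at most the rate of one
    -- repetition.
    scale*layers≤weight : ∀ j → scale * E (bits a) (λ β → layers j (deviationAt β)) ≤ weight j
    scale*layers≤weight zero = begin
      scale * E (bits a) (λ β → layers 0 (deviationAt β))
        ≡⟨ cong (scale *_) (E-* (bits a) (½^ f) _) ⟩
      (fromℕ 3 * fromℕ (2 ℕ.^ (3 ℕ.* f ℕ.+ 3))) * (½^ f * far (½^ e))
        ≡⟨ cong (λ p → (fromℕ 3 * p) * (½^ f * far (½^ e))) split ⟩
      (fromℕ 3 * (fromℕ (2 ℕ.^ (2 ℕ.* f ℕ.+ 3)) * fromℕ (2 ℕ.^ f))) * (½^ f * far (½^ e))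
        ≡⟨ solve 4 (λ p g h t → (con (fromℕ 3) :* (p :* g)) :* (h :* t) := (con (fromℕ 6) :* p) :* ((g :* h) :* (con ½ :* t))) refl
             (fromℕ (2 ℕ.^ (2 ℕ.* f ℕ.+ 3))) (fromℕ (2 ℕ.^ f)) (½^ f) (far (½^ e)) ⟩
      (fromℕ 6 * fromℕ (2 ℕ.^ (2 ℕ.* f ℕ.+ 3))) * ((fromℕ (2 ℕ.^ f) * ½^ f) * (½ * far (½^ e)))
        ≡⟨ cong₂ _*_ (sym (fromℕ-* 6 (2 ℕ.^ (2 ℕ.* f ℕ.+ 3)))) (trans (cong (_* (½ * far (½^ e))) (2^*½^ f)) (ℚ.*-identityˡ (½ * far (½^ e)))) ⟩
      fromℕ s * (½ * far (½^ e))
        ≡⟨ cong (λ t → fromℕ s * (½ * far t)) (trans (sym (½^-double e)) (cong (λ k → ½^ k + ½^ k) (sym (ℕ.+-suc (3 ℕ.* f) 3)))) ⟩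
      fromℕ s * (½ * far (½^ (3 ℕ.* f ℕ.+ 4) + ½^ (3 ℕ.* f ℕ.+ 4)))
        ≤⟨ *-monoˡ (0≤fromℕ s) (levelTest-rate (identitySampler b) (½^-pos (3 ℕ.* f ℕ.+ 4)) (var-full {½^ (3 ℕ.* f ℕ.+ 4)})) ⟩
      fromℕ s * rate fullRound q x ∎
      where
      open ℚ.≤-Reasoning
      e s : ℕ
      e = 3 ℕ.* f ℕ.+ 3
      s = 6 ℕ.* 2 ℕ.^ (2 ℕ.* f ℕ.+ 3)
      split : fromℕ (2 ℕ.^ (3 ℕ.* f ℕ.+ 3)) ≡ fromℕ (2 ℕ.^ (2 ℕ.* f ℕ.+ 3)) * fromℕ (2 ℕ.^ f)
      split = trans (cong fromℕ (trans (cong (2 ℕ.^_) (ℕ-solve 1 (λ f → ℕ-con 3 ⊗ₛ f ⊕ₛ ℕ-con 3 ≔ (ℕ-con 2 ⊗ₛ f ⊕ₛ ℕ-con 3) ⊕ₛ f) refl f)) (ℕ.^-distribˡ-+-* 2 (2 ℕ.* f ℕ.+ 3) f)))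
                    (fromℕ-* (2 ℕ.^ (2 ℕ.* f ℕ.+ 3)) (2 ℕ.^ f))
    scale*layers≤weight (suc i) = begin
      scale * E (bits a) (λ β → layers (suc i) (deviationAt β))
        ≡⟨ cong (scale *_) (trans (E-+ (bits a) _ (λ β → layers i (deviationAt β))) (cong (_+ rest) (E-* (bits a) (½^ i + ½^ i) _))) ⟩
      scale * ((½^ i + ½^ i) * far (½^ i) + rest)
        ≡⟨ solve 4 (λ k g t r → (con (fromℕ 3) :* k) :* ((g :+ g) :* t :+ r) := (con (fromℕ 6) :* (k :* g)) :* t :+ (con (fromℕ 3) :* k) :* r) refl (fromℕ (2 ℕ.^ (3 ℕ.* f ℕ.+ 3))) (½^ i) (far (½^ i)) rest ⟩
      (fromℕ 6 * (fromℕ (2 ℕ.^ (3 ℕ.* f ℕ.+ 3)) * ½^ i)) * far (½^ i) + scale * rest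
        ≤⟨ ℚ.+-mono-≤ (*-monoʳ (E-≥0 (bits a) λ β → 0≤⟦⟧ (does (½^ i ≤? deviationAt β))) enough) (scale*layers≤weight i) ⟩
      (fromℕ s * ½) * far (½^ i) + w
        ≡⟨ cong (_+ w) (trans (ℚ.*-assoc (fromℕ s) ½ (far (½^ i))) (cong (λ t → fromℕ s * (½ * far t)) (sym (½^-double i)))) ⟩
      fromℕ s * (½ * far (½^ (suc i) + ½^ (suc i))) + w
        ≤⟨ ℚ.+-monoˡ-≤ w (*-monoˡ (0≤fromℕ s) (levelTest-rate (sampler i) (½^-pos (suc i)) (var-sampler i))) ⟩
      fromℕ s * rate (round i) q x + w ∎
      where
      open ℚ.≤-Reasoning
      s e : ℕ
      s = repetitions i
      e = 2 ℕ.^ (2 ℕ.* f ℕ.+ 4) ℕ.* 2 ℕ.^ (f ℕ.∸ i)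
      rest w : ℚ
      w = weight i
      rest = E (bits a) (λ β → layers i (deviationAt β))
      -- Truncated subtraction is harmless, as `f ≤ i + (f ∸ i)` holds for every `i`.
      powers : 2 ℕ.* 2 ℕ.^ (3 ℕ.* f ℕ.+ 3) ℕ.≤ e ℕ.* 2 ℕ.^ i
      powers = ℕ.≤-trans (ℕ.^-monoʳ-≤ 2 {suc (3 ℕ.* f ℕ.+ 3)} {((2 ℕ.* f ℕ.+ 4) ℕ.+ (f ℕ.∸ i)) ℕ.+ i}
          (ℕ.≤-trans (ℕ.≤-reflexive (ℕ-solve 1 (λ f → ℕ-con 1 ⊕ₛ (ℕ-con 3 ⊗ₛ f ⊕ₛ ℕ-con 3) ≔ (ℕ-con 2 ⊗ₛ f ⊕ₛ ℕ-con 4) ⊕ₛ f) refl f))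
            (ℕ.≤-trans (ℕ.+-monoʳ-≤ (2 ℕ.* f ℕ.+ 4) (ℕ.≤-trans (ℕ.m≤n+m∸n f i) (ℕ.≤-reflexive (ℕ.+-comm i (f ℕ.∸ i))))) (ℕ.≤-reflexive (sym (ℕ.+-assoc (2 ℕ.* f ℕ.+ 4) (f ℕ.∸ i) i))))))
        (ℕ.≤-reflexive (trans (ℕ.^-distribˡ-+-* 2 ((2 ℕ.* f ℕ.+ 4) ℕ.+ (f ℕ.∸ i)) i) (cong (ℕ._* 2 ℕ.^ i) (ℕ.^-distribˡ-+-* 2 (2 ℕ.* f ℕ.+ 4) (f ℕ.∸ i)))))
      enough : fromℕ 6 * (fromℕ (2 ℕ.^ (3 ℕ.* f ℕ.+ 3)) * ½^ i) ≤ fromℕ s * ½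
      enough = begin
        fromℕ 6 * (fromℕ (2 ℕ.^ (3 ℕ.* f ℕ.+ 3)) * ½^ i)                ≡⟨ solve 2 (λ p h → con (fromℕ 6) :* (p :* h) := (con (fromℕ 3) :* (con (fromℕ 2) :* p)) :* h) refl (fromℕ (2 ℕ.^ (3 ℕ.* f ℕ.+ 3))) (½^ i) ⟩
        (fromℕ 3 * (fromℕ 2 * fromℕ (2 ℕ.^ (3 ℕ.* f ℕ.+ 3)))) * ½^ i    ≡⟨ cong (λ p → (fromℕ 3 * p) * ½^ i) (fromℕ-* 2 (2 ℕ.^ (3 ℕ.* f ℕ.+ 3))) ⟨
        (fromℕ 3 * fromℕ (2 ℕ.* 2 ℕ.^ (3 ℕ.* f ℕ.+ 3))) * ½^ i          ≤⟨ *-monoʳ (0≤½^ i) (*-monoˡ (0≤fromℕ 3) (fromℕ-mono powers)) ⟩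
        (fromℕ 3 * fromℕ (e ℕ.* 2 ℕ.^ i)) * ½^ i                        ≡⟨ cong (λ p → (fromℕ 3 * p) * ½^ i) (fromℕ-* e (2 ℕ.^ i)) ⟩
        (fromℕ 3 * (fromℕ e * fromℕ (2 ℕ.^ i))) * ½^ i                  ≡⟨ solve 3 (λ p g h → (con (fromℕ 3) :* (p :* g)) :* h := ((con (fromℕ 6) :* p) :* con ½) :* (g :* h)) refl (fromℕ e) (fromℕ (2 ℕ.^ i)) (½^ i) ⟩
        ((fromℕ 6 * fromℕ e) * ½) * (fromℕ (2 ℕ.^ i) * ½^ i)            ≡⟨ cong₂ (λ p g → (p * ½) * g) (sym (fromℕ-* 6 e)) (2^*½^ i) ⟩
        (fromℕ s * ½) * 1ℚ                                              ≡⟨ ℚ.*-identityʳ (fromℕ s * ½) ⟩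
        fromℕ s * ½                                                     ∎

    -- The cut-off `½^ (3 f + 3)` of the layer cake absorbs at most half of the average error. The
    -- other half gives the tests weight at least 3, and `Caught` turns this into `1 / (1 + 3)`.
    levels-sound : (∀ β → deviationAt β ≤ fromℕ 2) → ½^ (3 ℕ.* f ℕ.+ 2) ≤ E (bits a) deviationAt → quiet (levels (suc f)) q x ≤ ℤ.+ 1 / 4
    levels-sound D≤2 ED = ℚ.*-cancelʳ-≤-pos (fromℕ 4) (begin
      quiet T q x * fromℕ 4           ≤⟨ *-monoˡ (0≤quiet T q x) (ℚ.+-monoʳ-≤ 1ℚ 3≤w) ⟩
      quiet T q x * (1ℚ + w)          ≤⟨ proj₂ (levels-caught (suc f)) ⟩
      1ℚ                              ∎)
      where
      open ℚ.≤-Reasoning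
      T = levels (suc f)
      e : ℕ
      e = 3 ℕ.* f ℕ.+ 3
      w L : ℚ
      w = weight (suc f)
      L = E (bits a) (λ β → layers (suc f) (deviationAt β))
      ½^e≤L : ½^ e ≤ L
      ½^e≤L = ≤-via (½^ e + L - (½^ e + ½^ e)) (0≤-diff (begin
          ½^ e + ½^ e                                                       ≡⟨ trans (cong (λ k → ½^ k + ½^ k) (ℕ.+-suc (3 ℕ.* f) 2)) (½^-double (3 ℕ.* f ℕ.+ 2)) ⟩
          ½^ (3 ℕ.* f ℕ.+ 2)                                                ≤⟨ ED ⟩
          E (bits a) deviationAt                                            ≤⟨ E-mono (bits a) (λ β → layer-cake (D≤2 β)) ⟩
          E (bits a) (λ β → ½^ e + layers (suc f) (deviationAt β))          ≡⟨ trans (E-+ (bits a) (λ _ → ½^ e) _) (cong (_+ L) (E-const (bits a) (½^ e))) ⟩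
          ½^ e + L                                                          ∎))
        (solve 2 (λ h l → l := h :+ (h :+ l :- (h :+ h))) refl (½^ e) L)
      3≤w : fromℕ 3 ≤ w
      3≤w = begin
        fromℕ 3                                     ≡⟨ cong (fromℕ 3 *_) (2^*½^ e) ⟨
        fromℕ 3 * (fromℕ (2 ℕ.^ e) * ½^ e)          ≡⟨ ℚ.*-assoc (fromℕ 3) (fromℕ (2 ℕ.^ e)) (½^ e) ⟨
        scale * ½^ e                                ≤⟨ *-monoˡ (0≤* (0≤fromℕ 3) (0≤fromℕ (2 ℕ.^ e))) ½^e≤L ⟩
        scale * L                                   ≤⟨ scale*layers≤weight (suc f) ⟩
        w                                           ∎

-- Query cost of the levels

2^4f : ∀ f → 2 ℕ.^ (4 ℕ.* f) ≡ (2 ℕ.^ f ℕ.* 2 ℕ.^ f) ℕ.* (2 ℕ.^ f ℕ.* 2 ℕ.^ f)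
2^4f f = trans (cong (2 ℕ.^_) (ℕ-solve 1 (λ f → ℕ-con 4 ⊗ₛ f ≔ (f ⊕ₛ f) ⊕ₛ (f ⊕ₛ f)) refl f))
  (trans (ℕ.^-distribˡ-+-* 2 (f ℕ.+ f) (f ℕ.+ f)) (cong (λ p → p ℕ.* p) (ℕ.^-distribˡ-+-* 2 f f)))

2^[2f+c] : ∀ f c → 2 ℕ.^ (2 ℕ.* f ℕ.+ c) ≡ (2 ℕ.^ f ℕ.* 2 ℕ.^ f) ℕ.* 2 ℕ.^ c
2^[2f+c] f c = trans (ℕ.^-distribˡ-+-* 2 (2 ℕ.* f) c) (cong (ℕ._* 2 ℕ.^ c)
  (trans (cong (2 ℕ.^_) (cong (f ℕ.+_) (ℕ.+-identityʳ f))) (ℕ.^-distribˡ-+-* 2 f f)))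

module _ {n : ℕ} {Q : Set} (f a : ℕ) (cell : Q × Vec Bool a → Vec Bool (2 ℕ.* f) → Algorithm n Bool)
         (cell-cost : ∀ q v x → queries (cell q v) x ℕ.≤ 1) (claim : Q × Vec Bool a → ℚ) where
  private
    open module Lv = Levels f a cell cell-cost claim using (b; batches; precision; levelTest; levels; sampler; repetitions)

    -- 3072 = 6 · 16 · 4 · 8: the constants 6 and 16 of `repetitions`, the 4 in
    -- `2 ^ (suc i + suc i) = 4 * 4 ^ i`, and the 8 in `2 ^ precision ≤ 8 * batches`, which also
    -- accounts for the second factor `batches`.
    G perLevel : ℕ
    G        = 2 ℕ.^ f
    perLevel = 3072 ℕ.* ((batches ℕ.* batches) ℕ.* 2 ℕ.^ (4 ℕ.* f))

    cost-levelTest : ∀ S θ s → cost (levelTest S θ s) ≡ s ℕ.* (batches ℕ.* 2 ℕ.^ Sampler.width S)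
    cost-levelTest S θ s = trans (cost-anyOf s (atRandom a (allOf batches M)))
      (cong (s ℕ.*_) (trans (cost-allOf batches M) (cong (batches ℕ.*_) (ℕ.+-identityʳ (2 ℕ.^ Sampler.width S)))))
      where M = meanTest S θ cell cell-cost claim

    2^precision≤ : 2 ℕ.^ precision ℕ.≤ 8 ℕ.* batches
    2^precision≤ = begin
      2 ℕ.* (2 ℕ.* 2 ℕ.^ ⌈log₂ batches ⌉)    ≤⟨ ℕ.*-monoʳ-≤ 2 (ℕ.*-monoʳ-≤ 2 (2^⌈log₂n⌉≤2n batches {{ℕ.>-nonZero (ℕ.≤-trans (ℕ.s≤s ℕ.z≤n) (ℕ.m≤n+m 5 (2 ℕ.* f)))}})) ⟩
      2 ℕ.* (2 ℕ.* (2 ℕ.* batches))          ≡⟨ ℕ-solve 1 (λ u → ℕ-con 2 ⊗ₛ (ℕ-con 2 ⊗ₛ (ℕ-con 2 ⊗ₛ u)) ≔ ℕ-con 8 ⊗ₛ u) refl batches ⟩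
      8 ℕ.* batches                          ∎
      where open ℕ.≤-Reasoning

    full≤ : (6 ℕ.* 2 ℕ.^ (2 ℕ.* f ℕ.+ 3)) ℕ.* (batches ℕ.* 2 ℕ.^ b) ℕ.≤ perLevel
    full≤ = begin
      (6 ℕ.* 2 ℕ.^ (2 ℕ.* f ℕ.+ 3)) ℕ.* (batches ℕ.* 2 ℕ.^ b)
        ≡⟨ cong₂ (λ p q → (6 ℕ.* p) ℕ.* (batches ℕ.* q)) (2^[2f+c] f 3) (trans (cong (2 ℕ.^_) (sym (ℕ.+-identityʳ b))) (2^[2f+c] f 0)) ⟩
      (6 ℕ.* ((G ℕ.* G) ℕ.* 8)) ℕ.* (batches ℕ.* ((G ℕ.* G) ℕ.* 1))
        ≡⟨ ℕ-solve 2 (λ u g → (ℕ-con 6 ⊗ₛ ((g ⊗ₛ g) ⊗ₛ ℕ-con 8)) ⊗ₛ (u ⊗ₛ ((g ⊗ₛ g) ⊗ₛ ℕ-con 1)) ≔ ℕ-con 48 ⊗ₛ (u ⊗ₛ ((g ⊗ₛ g) ⊗ₛ (g ⊗ₛ g)))) refl batches G ⟩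
      48 ℕ.* (batches ℕ.* ((G ℕ.* G) ℕ.* (G ℕ.* G)))
        ≤⟨ ℕ.*-mono-≤ (ℕ.m≤m+n 48 3024) (ℕ.*-monoˡ-≤ ((G ℕ.* G) ℕ.* (G ℕ.* G)) (ℕ.m≤m*n batches batches {{ℕ.>-nonZero (ℕ.≤-trans (ℕ.s≤s ℕ.z≤n) (ℕ.m≤n+m 5 (2 ℕ.* f)))}})) ⟩
      3072 ℕ.* ((batches ℕ.* batches) ℕ.* ((G ℕ.* G) ℕ.* (G ℕ.* G)))
        ≡⟨ cong (λ p → 3072 ℕ.* ((batches ℕ.* batches) ℕ.* p)) (2^4f f) ⟨
      perLevel ∎
      where open ℕ.≤-Reasoning

    level≤ : ∀ i → i ℕ.≤ f → repetitions i ℕ.* (batches ℕ.* 2 ℕ.^ (precision ℕ.+ (suc i ℕ.+ suc i))) ℕ.≤ perLevel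
    level≤ i i≤f = begin
      (6 ℕ.* (2 ℕ.^ (2 ℕ.* f ℕ.+ 4) ℕ.* H)) ℕ.* (batches ℕ.* 2 ℕ.^ (precision ℕ.+ (suc i ℕ.+ suc i)))
        ≡⟨ cong₂ (λ p q → (6 ℕ.* (p ℕ.* H)) ℕ.* (batches ℕ.* q)) (2^[2f+c] f 4)
             (trans (ℕ.^-distribˡ-+-* 2 precision (suc i ℕ.+ suc i)) (cong (P ℕ.*_) (ℕ.^-distribˡ-+-* 2 (suc i) (suc i)))) ⟩
      (6 ℕ.* (((G ℕ.* G) ℕ.* 16) ℕ.* H)) ℕ.* (batches ℕ.* (P ℕ.* ((2 ℕ.* I) ℕ.* (2 ℕ.* I))))
        ≡⟨ ℕ-solve 5 (λ u g h p i → (ℕ-con 6 ⊗ₛ (((g ⊗ₛ g) ⊗ₛ ℕ-con 16) ⊗ₛ h)) ⊗ₛ (u ⊗ₛ (p ⊗ₛ ((ℕ-con 2 ⊗ₛ i) ⊗ₛ (ℕ-con 2 ⊗ₛ i))))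
                              ≔ ℕ-con 384 ⊗ₛ ((u ⊗ₛ p) ⊗ₛ ((g ⊗ₛ g) ⊗ₛ ((h ⊗ₛ i) ⊗ₛ i)))) refl batches G H P I ⟩
      384 ℕ.* ((batches ℕ.* P) ℕ.* ((G ℕ.* G) ℕ.* ((H ℕ.* I) ℕ.* I)))
        -- Fewer repetitions but larger samples as `i` grows: their product is
        -- `2 ^ (f - i) * 4 ^ i = 2 ^ f * 2 ^ i`, largest at the last level `i = f`.
        ≤⟨ ℕ.*-monoʳ-≤ 384 (ℕ.*-mono-≤ (ℕ.*-monoʳ-≤ batches 2^precision≤) (ℕ.*-monoʳ-≤ (G ℕ.* G) (ℕ.*-mono-≤ (ℕ.≤-reflexive HI≡G) (ℕ.^-monoʳ-≤ 2 i≤f)))) ⟩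
      384 ℕ.* ((batches ℕ.* (8 ℕ.* batches)) ℕ.* ((G ℕ.* G) ℕ.* (G ℕ.* G)))
        ≡⟨ ℕ-solve 2 (λ u g → ℕ-con 384 ⊗ₛ ((u ⊗ₛ (ℕ-con 8 ⊗ₛ u)) ⊗ₛ g) ≔ ℕ-con 3072 ⊗ₛ ((u ⊗ₛ u) ⊗ₛ g)) refl batches ((G ℕ.* G) ℕ.* (G ℕ.* G)) ⟩
      3072 ℕ.* ((batches ℕ.* batches) ℕ.* ((G ℕ.* G) ℕ.* (G ℕ.* G)))
        ≡⟨ cong (λ p → 3072 ℕ.* ((batches ℕ.* batches) ℕ.* p)) (2^4f f) ⟨
      perLevel ∎
      where
      open ℕ.≤-Reasoning
      H P I : ℕ
      H = 2 ℕ.^ (f ℕ.∸ i)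
      P = 2 ℕ.^ precision
      I = 2 ℕ.^ i
      HI≡G : H ℕ.* I ≡ G
      HI≡G = trans (sym (ℕ.^-distribˡ-+-* 2 (f ℕ.∸ i) i)) (cong (2 ℕ.^_) (ℕ.m∸n+n≡m i≤f))

    cost-levels-perLevel : ∀ j → j ℕ.≤ suc f → cost (levels j) ℕ.≤ suc j ℕ.* perLevel
    cost-levels-perLevel zero    _  = ℕ.≤-trans (ℕ.≤-reflexive (cost-levelTest (identitySampler b) (½^ (3 ℕ.* f ℕ.+ 4)) (6 ℕ.* 2 ℕ.^ (2 ℕ.* f ℕ.+ 3))))
                                        (ℕ.≤-trans full≤ (ℕ.m≤m+n perLevel 0))
    cost-levels-perLevel (suc i) h = ℕ.+-mono-≤
      (ℕ.≤-trans (ℕ.≤-reflexive (cost-levelTest (sampler i) (½^ (suc i)) (repetitions i))) (level≤ i (ℕ.s≤s⁻¹ h)))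
      (ℕ.≤-trans (ℕ.≤-reflexive (ℕ.+-identityʳ (cost (levels i)))) (cost-levels-perLevel i (ℕ.<⇒≤ h)))

  cost-levels : cost (levels (suc f)) ℕ.≤ (50 ℕ.* 3072) ℕ.* (2 ℕ.^ (4 ℕ.* f) ℕ.* suc f ℕ.^ 3)
  cost-levels = begin
    cost (levels (suc f))
      ≤⟨ cost-levels-perLevel (suc f) ℕ.≤-refl ⟩
    (2 ℕ.+ f) ℕ.* (3072 ℕ.* ((batches ℕ.* batches) ℕ.* T))
      ≤⟨ ℕ.*-mono-≤ 2+f≤ (ℕ.*-monoʳ-≤ 3072 (ℕ.*-monoˡ-≤ T (ℕ.*-mono-≤ batches≤ batches≤))) ⟩
    (2 ℕ.* suc f) ℕ.* (3072 ℕ.* (((5 ℕ.* suc f) ℕ.* (5 ℕ.* suc f)) ℕ.* T))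
      ≡⟨ collect 3072 (suc f) T ⟩
    (50 ℕ.* 3072) ℕ.* (T ℕ.* suc f ℕ.^ 3) ∎
    where
    open ℕ.≤-Reasoning
    T : ℕ
    T = 2 ℕ.^ (4 ℕ.* f)
    2+f≤ : 2 ℕ.+ f ℕ.≤ 2 ℕ.* suc f
    2+f≤ = ℕ.≤-trans (ℕ.m≤m+n (2 ℕ.+ f) f) (ℕ.≤-reflexive (ℕ-solve 1 (λ f → (ℕ-con 2 ⊕ₛ f) ⊕ₛ f ≔ ℕ-con 2 ⊗ₛ (ℕ-con 1 ⊕ₛ f)) refl f))
    batches≤ : batches ℕ.≤ 5 ℕ.* suc f
    batches≤ = ℕ.≤-trans (ℕ.m≤m+n batches (3 ℕ.* f)) (ℕ.≤-reflexive (ℕ-solve 1 (λ f → (ℕ-con 2 ⊗ₛ f ⊕ₛ ℕ-con 5) ⊕ₛ ℕ-con 3 ⊗ₛ f ≔ ℕ-con 5 ⊗ₛ (ℕ-con 1 ⊕ₛ f)) refl f))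
    collect : ∀ c s t → (2 ℕ.* s) ℕ.* (c ℕ.* (((5 ℕ.* s) ℕ.* (5 ℕ.* s)) ℕ.* t)) ≡ (50 ℕ.* c) ℕ.* (t ℕ.* s ℕ.^ 3)
    collect = ℕ-solve 3 (λ c s t → (ℕ-con 2 ⊗ₛ s) ⊗ₛ (c ⊗ₛ (((ℕ-con 5 ⊗ₛ s) ⊗ₛ (ℕ-con 5 ⊗ₛ s)) ⊗ₛ t)) ≔ (ℕ-con 50 ⊗ₛ c) ⊗ₛ (t ⊗ₛ (s ⊗ₛ (s ⊗ₛ (s ⊗ₛ ℕ-con 1))))) refl

-- The protocol

/-as-*1/ : ∀ m n .{{_ : NonZero n}} → ℤ.+ m / n ≡ fromℕ m * (ℤ.+ 1 / n)
/-as-*1/ m n = begin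
  ℤ.+ m / n                                   ≡⟨ ℚ.*-identityʳ (ℤ.+ m / n) ⟨
  (ℤ.+ m / n) * 1ℚ                            ≡⟨ cong ((ℤ.+ m / n) *_) (/-as-* 1 n) ⟨
  (ℤ.+ m / n) * ((ℤ.+ 1 / n) * fromℕ n)       ≡⟨ solve 3 (λ p i n → p :* (i :* n) := (p :* n) :* i) refl (ℤ.+ m / n) (ℤ.+ 1 / n) (fromℕ n) ⟩
  ((ℤ.+ m / n) * fromℕ n) * (ℤ.+ 1 / n)       ≡⟨ cong (_* (ℤ.+ 1 / n)) (/-as-* m n) ⟩
  fromℕ m * (ℤ.+ 1 / n)                       ∎
  where open ≡-Reasoning

0≤/ : ∀ m n .{{_ : NonZero n}} → 0ℚ ≤ ℤ.+ m / n
0≤/ m n = ℚ.nonNegative⁻¹ (ℤ.+ m / n) {{ℚ.normalize-nonNeg m n}}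

-- The entries of a Toeplitz matrix with `⌈log₂ n ⌉` rows and `6 f + 8` columns, followed by the
-- offset.
seedBits : ℕ → ℕ → ℕ
seedBits n f = (⌈log₂ n ⌉ ℕ.+ ((4 ℕ.* f ℕ.+ 8) ℕ.+ 2 ℕ.* f)) ℕ.+ ⌈log₂ n ⌉

replyBits : ℕ → ℕ
replyBits f = tableSize (4 ℕ.* f ℕ.+ 8) (suc (2 ℕ.* f))

-- The tolerances enter only through a rational threshold `τ` with a margin `½^ (3 f)` on either
-- side, so the analysis of the protocol is free of real numbers.
record Guarantee (n : ℕ) .{{_ : NonZero n}} (f : ℕ) (weight : Fin (suc n)) (τ : ℚ) : Set where
  field
    verifier         : Verifier n (seedBits n f) (replyBits f)
    prover           : Prover n (seedBits n f) (replyBits f)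
    complete         : ∀ x → deviation x weight + ½^ (3 ℕ.* f) ≤ τ → ℤ.+ 2 / 3 ≤ Pr[accept] verifier prover x
    sound            : ∀ x → τ + ½^ (3 ℕ.* f) ≤ deviation x weight → ∀ P* → Pr[accept] verifier P* x ≤ ℤ.+ 1 / 3
    verifier-queries : ∀ x r reply → queries (Verifier.strategy verifier r) x ℕ.+ queries (Verifier.decision verifier r x reply) x
                                     ℕ.≤ (50 ℕ.* 3072) ℕ.* (2 ℕ.^ (4 ℕ.* f) ℕ.* suc f ℕ.^ 3)
    prover-queries   : ∀ x r s → queries (Prover.strategy prover s (Verifier.message verifier r x)) x ℕ.≤ 2 ℕ.^ (6 ℕ.* f ℕ.+ 8)

module Protocol (n : ℕ) .{{_ : NonZero n}} (f : ℕ) (weight : Fin (suc n)) (τ : ℚ) where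

  σ : ℚ
  σ = ℤ.+ toℕ weight / n

  -- `k = 4 + 2 (3 f + 2)` makes a sample mean err by `½^ (3 f + 2)` with probability at most
  -- `½^ 4`. The extra bit in `w` is needed because a block consisting of ones has count `2 ^ b`.
  m a b k w : ℕ
  m = ⌈log₂ n ⌉
  a = 4 ℕ.* f ℕ.+ 8
  b = 2 ℕ.* f
  k = a ℕ.+ b
  w = suc b

  SeedSpace : Space
  SeedSpace = bits (m ℕ.+ k) ⊗ bits m

  Seed Reply : Set
  Seed  = Point SeedSpace
  Reply = Vec Bool (tableSize a w)

  read : Vec Bool m → Algorithm n Bool
  read v = fetch (layout m (List.tabulate λ i → i) v)

  cell : (Seed × Reply) × Vec Bool a → Vec Bool b → Algorithm n Bool
  cell ((seed , _) , β) γ = read (hash m seed (β ++ γ))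

  claimed : Reply → Vec Bool a → ℚ
  claimed reply β = fromℕ (value (entry a reply β)) * ½^ b

  cell-cost : ∀ q γ x → queries (cell q γ) x ℕ.≤ 1
  cell-cost ((seed , _) , β) γ = queries-fetch (layout m (List.tabulate λ i → i) (hash m seed (β ++ γ)))

  claim : (Seed × Reply) × Vec Bool a → ℚ
  claim ((_ , reply) , β) = claimed reply β

  module L = Levels f a cell cell-cost claim

  tests : Test n (Seed × Reply)
  tests = L.levels (suc f)

  -- Padding with zeros to length `2 ^ m` shrinks the mean, and `κ` undoes this. Errors of the mean
  -- are thereby amplified, but at most twice.
  κ : ℚ
  κ = ℤ.+ (2 ℕ.^ m) / n

  consistent : ∀ reply → Dec (∣ κ * E (bits a) (claimed reply) - σ ∣ ≤ τ)
  consistent reply = ∣ κ * E (bits a) (claimed reply) - σ ∣ ≤? τ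

  verdict : Seed → Reply → Point (Ω tests) → Algorithm n Bool
  verdict seed reply ω = if does (consistent reply) then bind (alarm tests (seed , reply) ω) (output ∘ not) else output false

  queries-verdict : ∀ seed reply ω x → queries (verdict seed reply ω) x ℕ.≤ cost tests
  queries-verdict seed reply ω x = go (does (consistent reply))
    where
    go : ∀ c → queries (if c then bind (alarm tests (seed , reply) ω) (output ∘ not) else output false) x ℕ.≤ cost tests
    go false = ℕ.z≤n
    go true  = ℕ.≤-trans (queries-bind-≤ (alarm tests (seed , reply) ω) (output ∘ not) x (cost-bound tests (seed , reply) ω x) λ _ → ℕ.z≤n)
                         (ℕ.≤-reflexive (ℕ.+-identityʳ (cost tests)))

  theVerifier : Verifier n (seedBits n f) (replyBits f)
  theVerifier = record
    { coins    = size (SeedSpace ⊗ Ω tests)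
    ; coins≢0  = size≢0 (SeedSpace ⊗ Ω tests)
    ; strategy = λ r → let ((t , c) , ω) = decode (SeedSpace ⊗ Ω tests) r in
                       output (t ++ c , λ reply → verdict (t , c) reply ω)
    }

  seedOf : Vec Bool ((m ℕ.+ k) ℕ.+ m) → Seed
  seedOf message = Vec.take (m ℕ.+ k) message , Vec.drop (m ℕ.+ k) message

  honestReply : (Vec Bool k → Bool) → Reply
  honestReply ys = write a λ β → encode w (count b λ γ → ys (β ++ γ))

  theProver : Prover n (seedBits n f) (replyBits f)
  theProver = record
    { coins    = 1
    ; strategy = λ _ message → bind (readAll k λ i → read (hash m (seedOf message) i)) (output ∘ honestReply)
    }

  queries-theProver : ∀ s message x → queries (Prover.strategy theProver s message) x ℕ.≤ 2 ℕ.^ k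
  queries-theProver s message x = ℕ.≤-trans
    (queries-bind-≤ (readAll k λ i → read (hash m (seedOf message) i)) (output ∘ honestReply) x
      (queries-readAll k (λ i → read (hash m (seedOf message) i)) x λ i → queries-fetch (layout m (List.tabulate λ i → i) (hash m (seedOf message) i)) x) λ _ → ℕ.z≤n)
    (ℕ.≤-reflexive (ℕ.+-identityʳ (2 ℕ.^ k)))

  0≤κ : 0ℚ ≤ κ
  0≤κ = 0≤/ (2 ℕ.^ m) n

  κ≤2 : κ ≤ fromℕ 2
  κ≤2 = begin
    κ                                  ≡⟨ /-as-*1/ (2 ℕ.^ m) n ⟩
    fromℕ (2 ℕ.^ m) * (ℤ.+ 1 / n)      ≤⟨ *-monoʳ (0≤/ 1 n) (fromℕ-mono (2^⌈log₂n⌉≤2n n)) ⟩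
    fromℕ (2 ℕ.* n) * (ℤ.+ 1 / n)      ≡⟨ cong (_* (ℤ.+ 1 / n)) (fromℕ-* 2 n) ⟩
    fromℕ 2 * fromℕ n * (ℤ.+ 1 / n)    ≡⟨ trans (ℚ.*-assoc (fromℕ 2) (fromℕ n) (ℤ.+ 1 / n)) (cong (fromℕ 2 *_) (trans (ℚ.*-comm (fromℕ n) (ℤ.+ 1 / n)) (/-as-* 1 n))) ⟩
    fromℕ 2 * 1ℚ                       ≡⟨ ℚ.*-identityʳ (fromℕ 2) ⟩
    fromℕ 2                            ∎
    where open ℚ.≤-Reasoning

  module _ (x : Vec Bool n) where

    X : Vec Bool m → Bool
    X v = run (read v) x

    μ : ℚ
    μ = E (bits m) (⟦_⟧ ∘ X)

    κμ≡wt : κ * μ ≡ wt x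
    κμ≡wt = begin
      κ * μ
        ≡⟨ cong₂ _*_ (/-as-*1/ (2 ℕ.^ m) n) (trans (E-layout x m (List.tabulate λ i → i) fits) (cong (λ s → fromℕ s * ½^ m) (ones-allFin x))) ⟩
      (fromℕ (2 ℕ.^ m) * (ℤ.+ 1 / n)) * (fromℕ S * ½^ m)
        ≡⟨ solve 4 (λ p i s h → (p :* i) :* (s :* h) := (p :* h) :* (s :* i)) refl (fromℕ (2 ℕ.^ m)) (ℤ.+ 1 / n) (fromℕ S) (½^ m) ⟩
      (fromℕ (2 ℕ.^ m) * ½^ m) * (fromℕ S * (ℤ.+ 1 / n))
        ≡⟨ cong₂ _*_ (2^*½^ m) (sym (/-as-*1/ S n)) ⟩
      1ℚ * wt x
        ≡⟨ ℚ.*-identityˡ (wt x) ⟩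
      wt x ∎
      where
      open ≡-Reasoning
      S : ℕ
      S = Vec.sum (Vec.map bit x)
      fits : List.length (List.tabulate {n = n} λ i → i) ℕ.≤ 2 ℕ.^ m
      fits = ℕ.≤-trans (ℕ.≤-reflexive (List.length-tabulate {n = n} λ i → i)) (n≤2^⌈log₂n⌉ n)

    sampled : Seed → Vec Bool a → ℚ
    sampled seed β = E (bits b) λ γ → ⟦ X (hash m seed (β ++ γ)) ⟧

    sampleError : Seed → ℚ
    sampleError seed = E (bits a) (sampled seed) - μ

    -- Refers to the seed and `x` but to no reply, so its probability is the same against every
    -- prover.
    bad : ∀ seed → Dec (½^ (3 ℕ.* f ℕ.+ 2) ≤ ∣ sampleError seed ∣)
    bad seed = ½^ (3 ℕ.* f ℕ.+ 2) ≤? ∣ sampleError seed ∣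

    bad-rare : E SeedSpace (λ seed → ⟦ does (bad seed) ⟧) ≤ ½^ 4
    bad-rare = chebyshev SeedSpace sampleError {ε = ½^ 4} (½^-pos (3 ℕ.* f ℕ.+ 2)) (begin
      E SeedSpace (λ seed → sampleError seed * sampleError seed)
        ≡⟨ E-cong SeedSpace (λ seed → cong (λ e → (e - μ) * (e - μ)) (sym (E-++ a b λ i → ⟦ X (hash m seed i) ⟧))) ⟩
      E SeedSpace (λ seed → Sampler.error (hashSampler m k) X seed * Sampler.error (hashSampler m k) X seed)
        ≤⟨ Sampler.variance (hashSampler m k) X ⟩
      ½^ k
        ≡⟨ trans (cong ½^_ (ℕ-solve 1 (λ f → (ℕ-con 4 ⊗ₛ f ⊕ₛ ℕ-con 8) ⊕ₛ ℕ-con 2 ⊗ₛ f ≔ ℕ-con 4 ⊕ₛ ((ℕ-con 3 ⊗ₛ f ⊕ₛ ℕ-con 2) ⊕ₛ (ℕ-con 3 ⊗ₛ f ⊕ₛ ℕ-con 2))) refl f))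
             (trans (½^-+ 4 ((3 ℕ.* f ℕ.+ 2) ℕ.+ (3 ℕ.* f ℕ.+ 2))) (cong (½^ 4 *_) (½^-+ (3 ℕ.* f ℕ.+ 2) (3 ℕ.* f ℕ.+ 2)))) ⟩
      ½^ 4 * (½^ (3 ℕ.* f ℕ.+ 2) * ½^ (3 ℕ.* f ℕ.+ 2)) ∎)
      where open ℚ.≤-Reasoning

    acceptance : Seed → Reply → ℚ
    acceptance seed reply = E (Ω tests) λ ω → ⟦ run (verdict seed reply ω) x ⟧

    accepting : ∀ c seed reply → E (Ω tests) (λ ω → ⟦ run (if c then bind (alarm tests (seed , reply) ω) (output ∘ not) else output false) x ⟧)
                                 ≡ ⟦ c ⟧ * quiet tests (seed , reply) x
    accepting false seed reply = trans (E-const (Ω tests) 0ℚ) (sym (ℚ.*-zeroˡ (quiet tests (seed , reply) x)))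
    accepting true  seed reply = trans (E-cong (Ω tests) λ ω → cong ⟦_⟧ (run-bind (alarm tests (seed , reply) ω) (output ∘ not) x))
                                       (sym (ℚ.*-identityˡ (quiet tests (seed , reply) x)))

    acceptance≡ : ∀ seed reply → acceptance seed reply ≡ ⟦ does (consistent reply) ⟧ * quiet tests (seed , reply) x
    acceptance≡ seed reply = accepting (does (consistent reply)) seed reply

    quiet≤1 : ∀ q → quiet tests q x ≤ 1ℚ
    quiet≤1 q = E-≤ (Ω tests) λ ω → ⟦⟧≤1 (not (run (alarm tests q ω) x))

    half : ½^ (3 ℕ.* f ℕ.+ 2) ≡ ½ * (½ * ½^ (3 ℕ.* f))
    half = cong ½^_ (ℕ.+-comm (3 ℕ.* f) 2)

    κ*≤ : ∀ {e} → κ * ∣ e ∣ ≤ fromℕ 2 * ∣ e ∣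
    κ*≤ {e} = *-monoʳ (ℚ.0≤∣p∣ e) κ≤2

    κ∣-∣ : ∀ p q → ∣ κ * p - κ * q ∣ ≤ fromℕ 2 * ∣ p - q ∣
    κ∣-∣ p q = ℚ.≤-trans (ℚ.≤-reflexive (trans (cong ∣_∣ (solve 3 (λ κ p q → κ :* p :- κ :* q := κ :* (p :- q)) refl κ p q))
      (trans (ℚ.∣p*q∣≡∣p∣*∣q∣ κ (p - q)) (cong (_* ∣ p - q ∣) (ℚ.0≤p⇒∣p∣≡p 0≤κ))))) (κ*≤ {p - q})

    0≤claimed : ∀ reply β → 0ℚ ≤ claimed reply β
    0≤claimed reply β = 0≤* (0≤fromℕ (value (entry a reply β))) (0≤½^ b)

    -- A cheating prover may use all `b + 1` bits of an entry, and the verifier does not compare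
    -- entries with `2 ^ b`; hence 2 rather than 1.
    claimed≤2 : ∀ reply β → claimed reply β ≤ fromℕ 2
    claimed≤2 reply β = begin
      fromℕ (value (entry a reply β)) * ½^ b      ≤⟨ *-monoʳ (0≤½^ b) (fromℕ-mono (ℕ.<⇒≤ (value<2^ (entry a reply β)))) ⟩
      fromℕ (2 ℕ.* 2 ℕ.^ b) * ½^ b                ≡⟨ cong (_* ½^ b) (fromℕ-* 2 (2 ℕ.^ b)) ⟩
      fromℕ 2 * fromℕ (2 ℕ.^ b) * ½^ b            ≡⟨ trans (ℚ.*-assoc (fromℕ 2) (fromℕ (2 ℕ.^ b)) (½^ b)) (cong (fromℕ 2 *_) (2^*½^ b)) ⟩
      fromℕ 2 * 1ℚ                                ≡⟨ ℚ.*-identityʳ (fromℕ 2) ⟩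
      fromℕ 2                                     ∎
      where open ℚ.≤-Reasoning

    discrepancy≤2 : ∀ seed reply β → ∣ claimed reply β - sampled seed β ∣ ≤ fromℕ 2
    discrepancy≤2 seed reply β = ∣p∣≤
      (≤-via ((fromℕ 2 - c) + s) (0≤+ (0≤-diff (claimed≤2 reply β)) 0≤s)
        (solve 2 (λ c s → con (fromℕ 2) := (c :- s) :+ ((con (fromℕ 2) :- c) :+ s)) refl c s))
      (≤-via ((1ℚ - s) + (1ℚ + c)) (0≤+ (0≤-diff s≤1) (0≤+ 0≤1 (0≤claimed reply β)))
        (solve 2 (λ c s → con (fromℕ 2) := (:- (c :- s)) :+ ((con 1ℚ :- s) :+ (con 1ℚ :+ c))) refl c s))
      where
      c s : ℚ
      c = claimed reply β
      s = sampled seed β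
      0≤s : 0ℚ ≤ s
      0≤s = E-≥0 (bits b) λ γ → 0≤⟦⟧ (X (hash m seed (β ++ γ)))
      s≤1 : s ≤ 1ℚ
      s≤1 = E-≤ (bits b) λ γ → ⟦⟧≤1 (X (hash m seed (β ++ γ)))

    module _ (far : τ + ½^ (3 ℕ.* f) ≤ ∣ wt x - σ ∣) where

      -- With `ρ = ½^ (3 f)`, the claimed total is off by at least `ρ` after scaling by `κ ≤ 2`, so
      -- the claimed mean is off by `ρ / 2`. The sample accounts for less than `ρ / 4`; the blocks
      -- must account for the remaining `ρ / 4 = ½^ (3 f + 2)`.
      discrepant : ∀ seed reply → ∣ sampleError seed ∣ < ½^ (3 ℕ.* f ℕ.+ 2) → ∣ κ * E (bits a) (claimed reply) - σ ∣ ≤ τ →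
                   ½^ (3 ℕ.* f ℕ.+ 2) ≤ E (bits a) (λ β → ∣ claimed reply β - sampled seed β ∣)
      discrepant seed reply good close = ℚ.≤-trans (≤-via s 0≤s eq) (ℚ.≤-trans (ℚ.≤-reflexive (cong ∣_∣ (sym (E-- (bits a) (claimed reply) (sampled seed)))))
                                                     (E-∣∣ (bits a) λ β → claimed reply β - sampled seed β))
        where
        open ℚ.≤-Reasoning
        C Y ρ : ℚ
        C = E (bits a) (claimed reply)
        Y = E (bits a) (sampled seed)
        ρ = ½^ (3 ℕ.* f)
        near : τ + ρ ≤ fromℕ 2 * (∣ C - Y ∣ + ∣ Y - μ ∣) + τ
        near = begin
          τ + ρ                                            ≤⟨ far ⟩
          ∣ wt x - σ ∣                                     ≡⟨ cong (λ z → ∣ z - σ ∣) κμ≡wt ⟨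
          ∣ κ * μ - σ ∣                                    ≤⟨ ∣∣-sub (κ * μ) (κ * C) σ ⟩
          ∣ κ * μ - κ * C ∣ + ∣ κ * C - σ ∣                ≤⟨ ℚ.+-mono-≤ (κ∣-∣ μ C) close ⟩
          fromℕ 2 * ∣ μ - C ∣ + τ                          ≤⟨ ℚ.+-monoˡ-≤ τ (*-monoˡ (0≤fromℕ 2) (ℚ.≤-trans (ℚ.≤-reflexive (∣∣-comm μ C)) (∣∣-sub C Y μ))) ⟩
          fromℕ 2 * (∣ C - Y ∣ + ∣ Y - μ ∣) + τ            ∎
        s : ℚ
        s = ½ * (fromℕ 2 * (∣ C - Y ∣ + ∣ Y - μ ∣) + τ - (τ + ρ)) + (½^ (3 ℕ.* f ℕ.+ 2) - ∣ Y - μ ∣)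
        0≤s : 0ℚ ≤ s
        0≤s = 0≤+ (0≤* 0≤½ (0≤-diff near)) (0≤-diff (ℚ.<⇒≤ good))
        eq : ∣ C - Y ∣ ≡ ½^ (3 ℕ.* f ℕ.+ 2) + s
        eq = trans (solve 4 (λ c y t r → c := (con ½ :* (con ½ :* r)) :+ (con ½ :* (con (fromℕ 2) :* (c :+ y) :+ t :- (t :+ r)) :+ ((con ½ :* (con ½ :* r)) :- y))) refl ∣ C - Y ∣ ∣ Y - μ ∣ τ ρ)
                   (cong (λ h → h + (½ * (fromℕ 2 * (∣ C - Y ∣ + ∣ Y - μ ∣) + τ - (τ + ρ)) + (h - ∣ Y - μ ∣))) (sym half))

      acceptance-sound : ∀ seed reply → acceptance seed reply ≤ ⟦ does (bad seed) ⟧ + ℤ.+ 1 / 4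
      acceptance-sound seed reply = ℚ.≤-trans (ℚ.≤-reflexive (acceptance≡ seed reply)) (cases (consistent reply) (bad seed))
        where
        Qt = quiet tests (seed , reply) x
        cases : (c : Dec (∣ κ * E (bits a) (claimed reply) - σ ∣ ≤ τ)) (d : Dec (½^ (3 ℕ.* f ℕ.+ 2) ≤ ∣ sampleError seed ∣)) →
                ⟦ does c ⟧ * Qt ≤ ⟦ does d ⟧ + ℤ.+ 1 / 4
        cases (no _)      d       = ℚ.≤-trans (ℚ.≤-reflexive (ℚ.*-zeroˡ Qt)) (0≤+ (0≤⟦⟧ (does d)) (0≤/ 1 4))
        cases (yes _)     (yes _) = ℚ.≤-trans (ℚ.≤-reflexive (ℚ.*-identityˡ Qt)) (ℚ.≤-trans (quiet≤1 (seed , reply)) (≤-via (ℤ.+ 1 / 4) (0≤/ 1 4) refl))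
        cases (yes close) (no ok) = ℚ.≤-trans (ℚ.≤-reflexive (ℚ.*-identityˡ Qt)) (ℚ.≤-trans
          (L.levels-sound (seed , reply) x (discrepancy≤2 seed reply) (discrepant seed reply (ℚ.≰⇒> ok) close)) (ℚ.≤-reflexive (sym (ℚ.+-identityˡ (ℤ.+ 1 / 4)))))

      theVerifier-sound : ∀ P* → Pr[accept] theVerifier P* x ≤ ℤ.+ 1 / 3
      theVerifier-sound P* = probability-≤ (SeedSpace ⊗ Ω tests) P*.coins
        (λ { ((t , c) , ω) s → run (verdict (t , c) (run (P*.strategy s (t ++ c)) x) ω) x }) λ s → begin
          E SeedSpace (λ { (t , c) → acceptance (t , c) (run (P*.strategy s (t ++ c)) x) })
            ≤⟨ E-mono SeedSpace (λ { (t , c) → acceptance-sound (t , c) (run (P*.strategy s (t ++ c)) x) }) ⟩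
          E SeedSpace (λ seed → ⟦ does (bad seed) ⟧ + ℤ.+ 1 / 4)
            ≡⟨ trans (E-+ SeedSpace (λ seed → ⟦ does (bad seed) ⟧) (λ _ → ℤ.+ 1 / 4)) (cong (λ e → E SeedSpace (λ seed → ⟦ does (bad seed) ⟧) + e) (E-const SeedSpace (ℤ.+ 1 / 4))) ⟩
          E SeedSpace (λ seed → ⟦ does (bad seed) ⟧) + ℤ.+ 1 / 4
            ≤⟨ ℚ.+-monoˡ-≤ (ℤ.+ 1 / 4) bad-rare ⟩
          ½^ 4 + ℤ.+ 1 / 4
            -- Bad seeds contribute 1/16 and undetected discrepancies 1/4, which is 5/16 in total.
            ≤⟨ ≤-via (ℤ.+ 1 / 48) (0≤/ 1 48) refl ⟩
          ℤ.+ 1 / 3 ∎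
        where
        open ℚ.≤-Reasoning
        module P* = Prover P*

    honest : Seed → Reply
    honest (t , c) = run (Prover.strategy theProver Fin.zero (t ++ c)) x

    claimed-honest : ∀ seed β → claimed (honest seed) β ≡ sampled seed β
    claimed-honest (t , c) β = begin
      fromℕ (value (entry a (honest (t , c)) β)) * ½^ b
        ≡⟨ cong (λ r → fromℕ (value (entry a r β)) * ½^ b) (run-bind (readAll k λ i → read (hash m (seedOf (t ++ c)) i)) (output ∘ honestReply) x) ⟩
      fromℕ (value (entry a (honestReply ys) β)) * ½^ b
        ≡⟨ cong (λ r → fromℕ (value r) * ½^ b) (entry-write a _ β) ⟩
      fromℕ (value (encode w (count b λ γ → ys (β ++ γ)))) * ½^ b
        ≡⟨ cong (λ j → fromℕ j * ½^ b) (value-encode w (count b λ γ → ys (β ++ γ)) small) ⟩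
      fromℕ (count b λ γ → ys (β ++ γ)) * ½^ b
        ≡⟨ cong (λ j → fromℕ j * ½^ b) (count-cong b λ γ → trans (run-readAll k (λ i → read (hash m (seedOf (t ++ c)) i)) x (β ++ γ))
             (cong (λ s → X (hash m s (β ++ γ))) (cong₂ _,_ (take-++ t c) (drop-++ t c)))) ⟩
      fromℕ (count b λ γ → X (hash m (t , c) (β ++ γ))) * ½^ b
        ≡⟨ E-count b (λ γ → X (hash m (t , c) (β ++ γ))) ⟨
      sampled (t , c) β ∎
      where
      open ≡-Reasoning
      ys : Vec Bool k → Bool
      ys = run (readAll k λ i → read (hash m (seedOf (t ++ c)) i)) x
      small : count b (λ γ → ys (β ++ γ)) ℕ.< 2 ℕ.^ w
      small = ℕ.≤-<-trans (count≤2^ b λ γ → ys (β ++ γ)) (ℕ.^-monoʳ-< 2 (ℕ.s≤s (ℕ.s≤s ℕ.z≤n)) {b} {w} ℕ.≤-refl)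

    module _ (close : ∣ wt x - σ ∣ + ½^ (3 ℕ.* f) ≤ τ) where

      honest-consistent : ∀ seed → ∣ sampleError seed ∣ < ½^ (3 ℕ.* f ℕ.+ 2) → ∣ κ * E (bits a) (claimed (honest seed)) - σ ∣ ≤ τ
      honest-consistent seed good = begin
        ∣ κ * E (bits a) (claimed (honest seed)) - σ ∣   ≡⟨ cong (λ c → ∣ κ * c - σ ∣) (E-cong (bits a) (claimed-honest seed)) ⟩
        ∣ κ * Y - σ ∣                                    ≤⟨ ∣∣-sub (κ * Y) (κ * μ) σ ⟩
        ∣ κ * Y - κ * μ ∣ + ∣ κ * μ - σ ∣                ≤⟨ ℚ.+-mono-≤ (κ∣-∣ Y μ) (ℚ.≤-reflexive (cong (λ z → ∣ z - σ ∣) κμ≡wt)) ⟩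
        fromℕ 2 * ∣ Y - μ ∣ + ∣ wt x - σ ∣               ≤⟨ ℚ.+-monoˡ-≤ ∣ wt x - σ ∣ (*-monoˡ (0≤fromℕ 2) (ℚ.≤-trans (ℚ.<⇒≤ good) (ℚ.≤-reflexive half))) ⟩
        fromℕ 2 * (½ * (½ * ρ)) + ∣ wt x - σ ∣           ≤⟨ ≤-via (½ * ρ) (0≤* 0≤½ (0≤½^ (3 ℕ.* f)))
                                                              (solve 2 (λ d r → d :+ r := (con (fromℕ 2) :* (con ½ :* (con ½ :* r)) :+ d) :+ con ½ :* r) refl ∣ wt x - σ ∣ ρ) ⟩
        ∣ wt x - σ ∣ + ρ                                 ≤⟨ close ⟩
        τ                                                ∎
        where
        open ℚ.≤-Reasoning
        Y ρ : ℚ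
        Y = E (bits a) (sampled seed)
        ρ = ½^ (3 ℕ.* f)

      acceptance-complete : ∀ seed → (1ℚ - ℤ.+ 1 / 4) - ⟦ does (bad seed) ⟧ ≤ acceptance seed (honest seed)
      acceptance-complete seed = ℚ.≤-trans (cases (consistent (honest seed)) (bad seed)) (ℚ.≤-reflexive (sym (acceptance≡ seed (honest seed))))
        where
        Qt = quiet tests (seed , honest seed) x
        cases : (c : Dec (∣ κ * E (bits a) (claimed (honest seed)) - σ ∣ ≤ τ)) (d : Dec (½^ (3 ℕ.* f ℕ.+ 2) ≤ ∣ sampleError seed ∣)) →
                (1ℚ - ℤ.+ 1 / 4) - ⟦ does d ⟧ ≤ ⟦ does c ⟧ * Qt
        -- On a bad seed the left side is `3/4 - 1`, which is negative.
        cases c       (yes _)  = ℚ.≤-trans (≤-via (ℤ.+ 1 / 4) (0≤/ 1 4) refl) (0≤* (0≤⟦⟧ (does c)) (0≤quiet tests (seed , honest seed) x))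
        cases (no ≰τ) (no ok)  = ⊥-elim (≰τ (honest-consistent seed (ℚ.≰⇒> ok)))
        cases (yes _) (no _)   = ℚ.≤-trans
          (ℚ.+-monoʳ-≤ 1ℚ (ℚ.neg-antimono-≤ (L.levels-complete (seed , honest seed) x (claimed-honest seed))))
          (ℚ.≤-reflexive (sym (trans (ℚ.*-identityˡ Qt) (quiet≡1-rate tests (seed , honest seed) x))))

      theVerifier-complete : ℤ.+ 2 / 3 ≤ Pr[accept] theVerifier theProver x
      theVerifier-complete = probability-≥ (SeedSpace ⊗ Ω tests) 1
        (λ { ((t , c) , ω) s → run (verdict (t , c) (run (Prover.strategy theProver s (t ++ c)) x) ω) x }) λ { Fin.zero → begin
          ℤ.+ 2 / 3
            ≤⟨ ≤-via (ℤ.+ 1 / 48) (0≤/ 1 48) refl ⟩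
          (1ℚ - ℤ.+ 1 / 4) - ½^ 4
            ≤⟨ ℚ.+-monoʳ-≤ (1ℚ - ℤ.+ 1 / 4) (ℚ.neg-antimono-≤ bad-rare) ⟩
          (1ℚ - ℤ.+ 1 / 4) - E SeedSpace (λ seed → ⟦ does (bad seed) ⟧)
            ≡⟨ trans (E-- SeedSpace (λ _ → 1ℚ - ℤ.+ 1 / 4) (λ seed → ⟦ does (bad seed) ⟧))
                     (cong (λ e → e - E SeedSpace (λ seed → ⟦ does (bad seed) ⟧)) (E-const SeedSpace (1ℚ - ℤ.+ 1 / 4))) ⟨
          E SeedSpace (λ seed → (1ℚ - ℤ.+ 1 / 4) - ⟦ does (bad seed) ⟧)
            ≤⟨ E-mono SeedSpace acceptance-complete ⟩
          E SeedSpace (λ seed → acceptance seed (honest seed)) ∎ }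
        where open ℚ.≤-Reasoning

  abstract
    guarantee : Guarantee n f weight τ
    guarantee = record
      { verifier         = theVerifier
      ; prover           = theProver
      ; complete         = theVerifier-complete
      ; sound            = theVerifier-sound
      ; verifier-queries = λ x r reply → let seed , ω = decode (SeedSpace ⊗ Ω tests) r in
                             ℕ.≤-trans (queries-verdict seed reply ω x) (cost-levels f a cell cell-cost claim)
      ; prover-queries   = λ x r s → ℕ.≤-trans (queries-theProver s (Verifier.message theVerifier r x) x) (ℕ.≤-reflexive (cong (2 ℕ.^_) (sizes f)))
      }
      where
      sizes : ∀ f → (4 ℕ.* f ℕ.+ 8) ℕ.+ 2 ℕ.* f ≡ 6 ℕ.* f ℕ.+ 8
      sizes = ℕ-solve 1 (λ f → (ℕ-con 4 ⊗ₛ f ⊕ₛ ℕ-con 8) ⊕ₛ ℕ-con 2 ⊗ₛ f ≔ ℕ-con 6 ⊗ₛ f ⊕ₛ ℕ-con 8) refl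

-- Parameters of given tolerances

radius≤½^ : ∀ e N → 2 ℕ.^ e ℕ.≤ suc N → radius N ≤ ½^ e
radius≤½^ e N h = begin
  radius N                                   ≡⟨ trans (sym (ℚ.*-identityʳ (radius N))) (cong (radius N *_) (sym (2^*½^ e))) ⟩
  radius N * (fromℕ (2 ℕ.^ e) * ½^ e)        ≡⟨ ℚ.*-assoc (radius N) (fromℕ (2 ℕ.^ e)) (½^ e) ⟨
  radius N * fromℕ (2 ℕ.^ e) * ½^ e          ≤⟨ *-monoʳ (0≤½^ e) (*-monoˡ (radius≥0 N) (fromℕ-mono h)) ⟩
  radius N * fromℕ (suc N) * ½^ e            ≡⟨ cong (_* ½^ e) (/-as-* 1 (suc N)) ⟩
  1ℚ * ½^ e                                  ≡⟨ ℚ.*-identityˡ (½^ e) ⟩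
  ½^ e                                       ∎
  where open ℚ.≤-Reasoning

-- The denominator of `δ` serves as the exponent: a positive rational is at least one over its
-- denominator `e`, and `e < 2 ^ e`.
archimedean : ∀ δ → 0ℚ < δ → ∃[ e ] ½^ e ≤ δ
archimedean δ 0<δ = e , (begin
  ½^ e                                ≡⟨ ℚ.*-identityˡ (½^ e) ⟨
  1ℚ * ½^ e                           ≤⟨ *-monoʳ (0≤½^ e) 1≤δd ⟩
  δ * fromℕ e * ½^ e                  ≤⟨ *-monoʳ (0≤½^ e) (*-monoˡ (ℚ.<⇒≤ 0<δ) (fromℕ-mono (ℕ.<⇒≤ (n<2^n e)))) ⟩
  δ * fromℕ (2 ℕ.^ e) * ½^ e          ≡⟨ trans (ℚ.*-assoc δ (fromℕ (2 ℕ.^ e)) (½^ e)) (cong (δ *_) (2^*½^ e)) ⟩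
  δ * 1ℚ                              ≡⟨ ℚ.*-identityʳ δ ⟩
  δ                                   ∎)
  where
  open ℚ.≤-Reasoning
  e : ℕ
  e = ℚ.↧ₙ δ
  n<2^n : ∀ n → n ℕ.< 2 ℕ.^ n
  n<2^n zero    = ℕ.≤-refl
  n<2^n (suc n) = ℕ.≤-trans (ℕ.s≤s (n<2^n n)) (ℕ.+-mono-≤ (ℕ.>-nonZero⁻¹ (2 ℕ.^ n) {{ℕ.m^n≢0 2 n}}) (ℕ.m≤m+n (2 ℕ.^ n) 0))
  times-denominator : ∀ p .{{_ : Positive p}} → 1ℚ ≤ p * fromℕ (ℚ.↧ₙ p)
  times-denominator p@(ℚ.mkℚ (ℤ.+[1+ q ]) d _) = ℚ.≤-trans (fromℕ-mono {1} {suc q} (ℕ.s≤s ℕ.z≤n))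
    (ℚ.≤-reflexive (trans (sym (/-as-* (suc q) (suc d))) (cong (_* fromℕ (suc d)) (ℚ.↥p/↧p≡p p))))
  1≤δd : 1ℚ ≤ δ * fromℕ e
  1≤δd = times-denominator δ {{positive 0<δ}}

-- Walks down from a known solution and stops before the first failure. Failure at the predecessor
-- alone is what bounds the gap from above, so `P` may be non-monotone.
descend : ∀ {P : ℕ → Set} → (∀ n → Dec (P n)) → ∀ n → P n → ∃[ k ] P k × (∀ j → k ≡ suc j → ¬ P j)
descend P? zero    p = zero , p , λ _ ()
descend P? (suc n) p with P? n
... | yes p′ = descend P? n p′
... | no ¬p  = suc n , p , λ { _ refl → ¬p }

approx-close : ∀ (c : ℝ) m n → approx c m ≤ approx c n + (radius m + radius n)
approx-close c m n = ≤-via s (0≤-diff (ℚ.≤-trans (p≤∣p∣ (approx c m - approx c n)) (regular c m n)))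
  (solve 3 (λ a b r → b :+ r := a :+ (r :- (a :- b))) refl (approx c m) (approx c n) (radius m + radius n))
  where
  s : ℚ
  s = (radius m + radius n) - (approx c m - approx c n)

<ʳ-trans : ∀ {r s} (c : ℝ) → fromℚ r <ʳ c → c <ʳ fromℚ s → r ≤ s
<ʳ-trans {r} {s} c (m , r<c) (n , c<s) = ≤-via t
    (0≤+ (0≤+ (0≤-diff (ℚ.<⇒≤ r<c)) (0≤-diff (ℚ.<⇒≤ c<s))) (0≤+ (0≤-diff (approx-close c m n)) (0≤+ (radius≥0 m) (radius≥0 n))))
    (solve 6 (λ r s a b u v → s := r :+ (((a :- (r :+ (u :+ u))) :+ (s :- (b :+ (v :+ v)))) :+ ((b :+ (u :+ v) :- a) :+ (u :+ v)))) refl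
      r s (approx c m) (approx c n) (radius m) (radius n))
  where
  t : ℚ
  t = ((approx c m - (r + (radius m + radius m))) + (s - (approx c n + (radius n + radius n))))
    + ((approx c n + (radius m + radius n) - approx c m) + (radius m + radius n))


-- Here `l` and `h` approximate the tolerances with radius `r ≤ p / 8`, and `p` is `8⁻ᶠ`. The
-- midpoint is at least `l + 2 p`, whereas `d + p` is at most `l + p / 4 + p`. The lemmas that
-- follow are budgets of the same kind.
inner-margin : ∀ {l h r p d} → r ≤ ½^ 3 * p → fromℕ 4 * p ≤ h - l → 0ℚ ≤ p → d ≤ l + (r + r) → d + p ≤ ½ * (l + h)
inner-margin {l} {h} {r} {p} {d} r≤ sep 0≤p d≤ = ≤-via ((l + (r + r) - d) + (fromℕ 2 * (½^ 3 * p - r) + (½ * (h - l - fromℕ 4 * p) + (ℤ.+ 3 / 4) * p)))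
  (0≤+ (0≤-diff d≤) (0≤+ (0≤* (0≤fromℕ 2) (0≤-diff r≤)) (0≤+ (0≤* 0≤½ (0≤-diff sep)) (0≤* (0≤/ 3 4) 0≤p))))
  (solve 5 (λ l h r p d → con ½ :* (l :+ h) := (d :+ p) :+ ((l :+ (r :+ r) :- d) :+ (con (fromℕ 2) :* (con (½^ 3) :* p :- r) :+ (con ½ :* (h :- l :- con (fromℕ 4) :* p) :+ con (ℤ.+ 3 / 4) :* p)))) refl l h r p d)

outer-margin : ∀ {l h r p d a v} → r ≤ ½^ 3 * p → fromℕ 4 * p ≤ h - l → 0ℚ ≤ p → 0ℚ ≤ v → h ≤ a + (r + v) → a + (v + v) ≤ d → ½ * (l + h) + p ≤ d
outer-margin {l} {h} {r} {p} {d} {a} {v} r≤ sep 0≤p 0≤v h≤ ≤d = ≤-via ((d - (a + (v + v))) + ((a + (r + v) - h) + (v + ((½^ 3 * p - r) + (½ * (h - l - fromℕ 4 * p) + (ℤ.+ 7 / 8) * p)))))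
  (0≤+ (0≤-diff ≤d) (0≤+ (0≤-diff h≤) (0≤+ 0≤v (0≤+ (0≤-diff r≤) (0≤+ (0≤* 0≤½ (0≤-diff sep)) (0≤* (0≤/ 7 8) 0≤p))))))
  (solve 7 (λ l h r p d a v → d := (con ½ :* (l :+ h) :+ p) :+ ((d :- (a :+ (v :+ v))) :+ ((a :+ (r :+ v) :- h) :+ (v :+ ((con (½^ 3) :* p :- r) :+ (con ½ :* (h :- l :- con (fromℕ 4) :* p) :+ con (ℤ.+ 7 / 8) :* p)))))) refl
    l h r p d a v)

separation : ∀ {l h r p a c v e} → r ≤ ½^ 3 * p → 0ℚ ≤ p → p ≤ ½^ 3 * e → e ≤ a - (c + (v + v)) → a ≤ h + (v + r) → l ≤ c + (r + v) → fromℕ 4 * p ≤ h - l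
separation {l} {h} {r} {p} {a} {c} {v} {e} r≤ 0≤p p≤ e≤ a≤ l≤ =
  ≤-via ((a - (c + (v + v)) - e) + (fromℕ 8 * (½^ 3 * e - p) + ((h + (v + r) - a) + ((c + (r + v) - l) + (fromℕ 2 * (½^ 3 * p - r) + (ℤ.+ 15 / 4) * p)))))
  (0≤+ (0≤-diff e≤) (0≤+ (0≤* (0≤fromℕ 8) (0≤-diff p≤)) (0≤+ (0≤-diff a≤) (0≤+ (0≤-diff l≤) (0≤+ (0≤* (0≤fromℕ 2) (0≤-diff r≤)) (0≤* (0≤/ 15 4) 0≤p))))))
  (solve 8 (λ h l p r a c v e → h :- l := con (fromℕ 4) :* p :+ (((a :- (c :+ (v :+ v))) :- e) :+ (con (fromℕ 8) :* (con (½^ 3) :* e :- p) :+ ((h :+ (v :+ r) :- a) :+ ((c :+ (r :+ v) :- l) :+ (con (fromℕ 2) :* (con (½^ 3) :* p :- r) :+ con (ℤ.+ 15 / 4) :* p)))))) refl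
    h l p r a c v e)

gap-margin : ∀ {l h p a c v} → v + v ≤ ½^ 3 * p → 0ℚ ≤ p → h - l ≤ fromℕ 4 * p → a ≤ h + (v + (v + v)) → l ≤ c + ((v + v) + v) → (a - c) + ((v + v) + (v + v)) ≤ fromℕ 5 * p
gap-margin {l} {h} {p} {a} {c} {v} r≤ 0≤p close a≤ l≤ =
  ≤-via ((fromℕ 4 * p - (h - l)) + ((h + (v + (v + v)) - a) + ((c + ((v + v) + v) - l) + (fromℕ 5 * (½^ 3 * p - (v + v)) + (ℤ.+ 3 / 8) * p))))
  (0≤+ (0≤-diff close) (0≤+ (0≤-diff a≤) (0≤+ (0≤-diff l≤) (0≤+ (0≤* (0≤fromℕ 5) (0≤-diff r≤)) (0≤* (0≤/ 3 8) 0≤p)))))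
  (solve 6 (λ h l p a c v → con (fromℕ 5) :* p := ((a :- c) :+ ((v :+ v) :+ (v :+ v))) :+ ((con (fromℕ 4) :* p :- (h :- l)) :+ ((h :+ (v :+ (v :+ v)) :- a) :+ ((c :+ ((v :+ v) :+ v) :- l) :+ (con (fromℕ 5) :* (con (½^ 3) :* p :- (v :+ v)) :+ con (ℤ.+ 3 / 8) :* p))))) refl
    h l p a c v)

gap-trivial : ∀ {a c} → 0ℚ ≤ c + (½ + ½) → a ≤ 1ℚ + (½ + ½) → (a - c) + (1ℚ + 1ℚ) ≤ fromℕ 5
gap-trivial {a} {c} 0≤c a≤1 = ≤-via ((c + (½ + ½) - 0ℚ) + (1ℚ + (½ + ½) - a)) (0≤+ (0≤-diff 0≤c) (0≤-diff a≤1))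
  (solve 2 (λ c a → con (fromℕ 5) := ((a :- c) :+ (con 1ℚ :+ con 1ℚ)) :+ ((c :+ (con ½ :+ con ½) :- con 0ℚ) :+ (con 1ℚ :+ (con ½ :+ con ½) :- a))) refl c a)


record Parameters (t : Tolerances) : Set where
  field
    level     : ℕ
    threshold : ℚ
    inner     : ∀ d → fromℚ d ≤ʳ εc t → d + ½^ (3 ℕ.* level) ≤ threshold
    outer     : ∀ d → εf t <ʳ fromℚ d → threshold + ½^ (3 ℕ.* level) ≤ d
    gap<      : gap t <ʳ fromℚ (fromℕ 64 * ½^ (3 ℕ.* level))

-- The level is an f at which approximations of radius 8⁻ᶠ / 8 separate the
-- tolerances by 4 · 8⁻ᶠ although those for f - 1 do not.
module _ (t : Tolerances) where
  private
    N : ℕ → ℕ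
    N f = 2 ℕ.^ (3 ℕ.* f ℕ.+ 3)

    ρ lo hi : ℕ → ℚ
    ρ f  = ½^ (3 ℕ.* f)
    lo f = approx (εc t) (N f)
    hi f = approx (εf t) (N f)

    0≤ρ : ∀ f → 0ℚ ≤ ρ f
    0≤ρ f = 0≤½^ (3 ℕ.* f)

    radius-N : ∀ f → radius (N f) ≤ ½^ 3 * ρ f
    radius-N f = ℚ.≤-trans (radius≤½^ (3 ℕ.* f ℕ.+ 3) (N f) (ℕ.n≤1+n (N f)))
                           (ℚ.≤-reflexive (trans (½^-+ (3 ℕ.* f) 3) (ℚ.*-comm (ρ f) (½^ 3))))

    Separated : ℕ → Set
    Separated f = fromℕ 4 * ρ f ≤ hi f - lo f

    positive-diff : ∀ {p q} → p < q → 0ℚ < q - p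
    positive-diff {p} {q} p<q = ℚ.≤-<-trans (ℚ.≤-reflexive (sym (ℚ.+-inverseʳ p))) (ℚ.+-monoˡ-< (- p) p<q)

    separated-at : ∀ M e → ½^ e ≤ approx (εf t) M - (approx (εc t) M + (radius M + radius M)) → Separated (3 ℕ.+ e)
    separated-at M e ½^e≤ = separation {l = lo F} {h = hi F} {r = radius (N F)} {p = ρ F} {a = approx (εf t) M} {c = approx (εc t) M} {v = radius M} {e = ½^ e} (radius-N F) (0≤ρ F) small ½^e≤ (approx-close (εf t) M (N F)) (approx-close (εc t) (N F) M)
      where
      F : ℕ
      -- The summand 3 gives `8⁻ᶠ ≤ ½^ e / 8`, which leaves room for four such units and the
      -- approximation errors inside a certified gap `½^ e`.
      F = 3 ℕ.+ e
      small : ρ F ≤ ½^ 3 * ½^ e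
      small = ℚ.≤-trans (½^-antimono {3 ℕ.+ e} {3 ℕ.* F} (ℕ.m≤n*m F 3)) (ℚ.≤-reflexive (½^-+ 3 e))

    eventually : ∃[ f ] Separated f
    eventually = let M , lo<hi = εc<εf t
                     e , ½^e≤  = archimedean (approx (εf t) M - (approx (εc t) M + (radius M + radius M))) (positive-diff lo<hi)
                 in 3 ℕ.+ e , separated-at M e ½^e≤

    gap<-minimal : ∀ f → (∀ j → f ≡ suc j → ¬ Separated j) → gap t <ʳ fromℚ (fromℕ 64 * ρ f)
    -- Level 0 has no failed predecessor; there `0 ≤ εc` and `εf ≤ 1`, at the coarsest precision,
    -- bound the gap.
    gap<-minimal zero    _       = 0 , ℚ.≤-<-trans (gap-trivial {approx (εf t) 1} {approx (εc t) 1} (0≤εc t 1) (εf≤1 t 1)) (from-yes (fromℕ 5 ℚ.<? fromℕ 64 * 1ℚ))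
    gap<-minimal (suc j) minimal = N j , ℚ.≤-<-trans
      (subst (λ r → (A - B) + (r + r) ≤ fromℕ 5 * ρ j) (radius-double (N j))
        (gap-margin {l = lo j} {h = hi j} {p = ρ j} {a = A} {c = B} {v = v} (subst (_≤ ½^ 3 * ρ j) (sym (radius-double (N j))) (radius-N j)) (0≤ρ j) (ℚ.<⇒≤ (ℚ.≰⇒> (minimal j refl)))
          (subst (λ r → A ≤ hi j + (v + r)) (sym (radius-double (N j))) (approx-close (εf t) (double (N j)) (N j)))
          (subst (λ r → lo j ≤ B + (r + v)) (sym (radius-double (N j))) (approx-close (εc t) (N j) (double (N j))))))
      -- The constant 64 is 8 · 8: the failure at `j` bounds the gap by `5 * ρ j`, rounded up to
      -- `8 * ρ j`, and `ρ j` is 8 times the value at `suc j`.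
      (ℚ.<-≤-trans (ℚ.*-monoˡ-<-pos (ρ j) {{positive (½^-pos (3 ℕ.* j))}} (from-yes (fromℕ 5 ℚ.<? fromℕ 8)))
        (ℚ.≤-reflexive (trans (solve 1 (λ p → con (fromℕ 8) :* p := con (fromℕ 64) :* (con (½^ 3) :* p)) refl (ρ j))
          (cong (fromℕ 64 *_) (trans (sym (½^-+ 3 (3 ℕ.* j))) (cong ½^_ (sym (ℕ.*-suc 3 j))))))))
      where
      A B v : ℚ
      A = approx (εf t) (double (N j))
      B = approx (εc t) (double (N j))
      v = radius (double (N j))

    found : ∃[ f ] Separated f × (∀ j → f ≡ suc j → ¬ Separated j)
    found = descend (λ f → fromℕ 4 * ρ f ≤? hi f - lo f) (proj₁ eventually) (proj₂ eventually)

  abstract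
    parameters : Parameters t
    parameters = record
      { level     = f
      ; threshold = ½ * (lo f + hi f)
      ; inner     = λ d d≤εc → inner-margin {l = lo f} {h = hi f} {r = radius (N f)} {p = ρ f} {d = d} (radius-N f) separated (0≤ρ f) (d≤εc (N f))
      ; outer     = λ { d (n , εf<d) → outer-margin {l = lo f} {h = hi f} {r = radius (N f)} {p = ρ f} {d = d} {a = approx (εf t) n} {v = radius n} (radius-N f) separated (0≤ρ f) (radius≥0 n) (approx-close (εf t) (N f) n) (ℚ.<⇒≤ εf<d) }
      ; gap<      = gap<-minimal f (proj₂ (proj₂ found))
      }
      where
      f : ℕ
      f = proj₁ found
      separated : Separated f
      separated = proj₁ (proj₂ found)

-- Complexity bounds

fromℕ-cancel-≤ : ∀ {m n} → fromℕ m ≤ fromℕ n → m ℕ.≤ n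
fromℕ-cancel-≤ {m} {n} h = ℤ.drop‿+≤+ (subst₂ ℤ._≤_ (ℤ.*-identityʳ (ℤ.+ m)) (ℤ.*-identityʳ (ℤ.+ n))
  (ℚᵘ.drop-*≤* (ℚᵘ.≤-respˡ-≃ (fromℕ≃ m) (ℚᵘ.≤-respʳ-≃ (fromℕ≃ n) (ℚ.toℚᵘ-mono-≤ h)))))

1≤⌈1/r⌉*r : ∀ r .{{_ : Positive r}} → 1ℚ ≤ fromℕ ℤ.∣ ceiling ((1/ r) {{ℚ.pos⇒nonZero r}}) ∣ * r
1≤⌈1/r⌉*r r@(ℚ.mkℚ (ℤ.+[1+ p ]) d _) = ℚ.*-cancelʳ-≤-pos (fromℕ (suc d)) {{fromℕ-pos (suc d)}} (begin
  1ℚ * fromℕ (suc d)                ≡⟨ ℚ.*-identityˡ (fromℕ (suc d)) ⟩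
  fromℕ (suc d)                     ≤⟨ fromℕ-mono (ℤ.drop‿+≤+ (ℤ.≤-trans exceeds (ℤ.≤-trans (ℤ.*-monoʳ-≤-nonNeg (ℤ.+[1+ p ]) (i≤∣i∣ c)) (ℤ.≤-reflexive (sym (ℤ.pos-* ℤ.∣ c ∣ (suc p))))))) ⟩
  fromℕ (ℤ.∣ c ∣ ℕ.* suc p)         ≡⟨ fromℕ-* ℤ.∣ c ∣ (suc p) ⟩
  fromℕ ℤ.∣ c ∣ * fromℕ (suc p)     ≡⟨ cong (fromℕ ℤ.∣ c ∣ *_) (trans (sym (/-as-* (suc p) (suc d))) (cong (_* fromℕ (suc d)) (ℚ.↥p/↧p≡p r))) ⟩
  fromℕ ℤ.∣ c ∣ * (r * fromℕ (suc d)) ≡⟨ ℚ.*-assoc (fromℕ ℤ.∣ c ∣) r (fromℕ (suc d)) ⟨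
  fromℕ ℤ.∣ c ∣ * r * fromℕ (suc d) ∎)
  where
  open ℚ.≤-Reasoning
  floor c : ℤ.ℤ
  -- The ceiling of `1/ r` is by definition the negated floor of `- (1/ r)`, and this quotient is
  -- that floor.
  floor = ℤ.-[1+ d ] ℤ./ ℤ.+[1+ p ]
  c     = ℤ.- floor
  i≤∣i∣ : ∀ i → i ℤ.≤ ℤ.+ ℤ.∣ i ∣
  i≤∣i∣ (ℤ.+ _)      = ℤ.≤-refl
  i≤∣i∣ ℤ.-[1+ _ ]   = ℤ.-≤+
  exceeds : ℤ.+[1+ d ] ℤ.≤ c ℤ.* ℤ.+[1+ p ]
  exceeds = ℤ.≤-trans (ℤ.neg-mono-≤ (ℤ.[n/d]*d≤n ℤ.-[1+ d ] ℤ.+[1+ p ])) (ℤ.≤-reflexive (ℤ.neg-distribˡ-* floor ℤ.+[1+ p ]))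

-- From `8 ^ f ≤ 64 / r ≤ 2 ^ (6 + l)` with `l = ⌈log₂ ⌈1/r⌉ ⌉` follows `3 f ≤ 6 + l`.
level≤log⁺1/ : ∀ f r .{{_ : Positive r}} → r ≤ fromℕ 64 * ½^ (3 ℕ.* f) → suc f ℕ.≤ 7 ℕ.* log⁺1/ r
level≤log⁺1/ f r r≤ = begin
  suc f                             ≤⟨ ℕ.s≤s (ℕ.≤-trans (ℕ.m≤n*m f 3) 3f≤) ⟩
  7 ℕ.+ l                           ≤⟨ ℕ.+-monoʳ-≤ 7 (ℕ.m≤n*m l 7) ⟩
  7 ℕ.+ 7 ℕ.* l                     ≡⟨ ℕ.*-suc 7 l ⟨
  7 ℕ.* suc l                       ∎
  where
  open ℕ.≤-Reasoning
  c l : ℕ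
  c = ℤ.∣ ceiling ((1/ r) {{ℚ.pos⇒nonZero r}}) ∣
  l = ⌈log₂ c ⌉
  2^3f≤ : fromℕ (2 ℕ.^ (3 ℕ.* f)) ≤ fromℕ (2 ℕ.^ (6 ℕ.+ l))
  2^3f≤ = ℚ.≤-trans (≤-via (P * (fromℕ c * (fromℕ 64 * h - r)) + P * (fromℕ c * r - 1ℚ))
      (0≤+ (0≤* (0≤fromℕ (2 ℕ.^ (3 ℕ.* f))) (0≤* (0≤fromℕ c) (0≤-diff r≤))) (0≤* (0≤fromℕ (2 ℕ.^ (3 ℕ.* f))) (0≤-diff (1≤⌈1/r⌉*r r))))
      (solve 4 (λ p h c r → (con (fromℕ 64) :* c) :* (p :* h) := p :+ (p :* (c :* (con (fromℕ 64) :* h :- r)) :+ p :* (c :* r :- con 1ℚ))) refl P h (fromℕ c) r))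
    (ℚ.≤-trans (ℚ.≤-reflexive (trans (cong ((fromℕ 64 * fromℕ c) *_) (2^*½^ (3 ℕ.* f))) (trans (ℚ.*-identityʳ (fromℕ 64 * fromℕ c)) (sym (fromℕ-* 64 c)))))
      (fromℕ-mono (ℕ.≤-trans (ℕ.*-monoʳ-≤ 64 (n≤2^⌈log₂n⌉ c)) (ℕ.≤-reflexive (sym (ℕ.^-distribˡ-+-* 2 6 l))))))
    where
    P h : ℚ
    P = fromℕ (2 ℕ.^ (3 ℕ.* f))
    h = ½^ (3 ℕ.* f)
  3f≤ : 3 ℕ.* f ℕ.≤ 6 ℕ.+ l
  3f≤ = ℕ.≤-trans (ℕ.≤-reflexive (sym (ℕ.⌈log₂2^n⌉≡n (3 ℕ.* f))))
    (ℕ.≤-trans (ℕ.⌈log₂⌉-mono-≤ {2 ℕ.^ (3 ℕ.* f)} {2 ℕ.^ (6 ℕ.+ l)} (fromℕ-cancel-≤ 2^3f≤)) (ℕ.≤-reflexive (ℕ.⌈log₂2^n⌉≡n (6 ℕ.+ l))))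

½^3f : ∀ f → ½^ (3 ℕ.* f) ≡ ½^ f * (½^ f * ½^ f)
½^3f f = trans (cong (λ k → ½^ (f ℕ.+ (f ℕ.+ k))) (ℕ.+-identityʳ f)) (trans (½^-+ f (f ℕ.+ f)) (cong (½^ f *_) (½^-+ f f)))

*-^ : ∀ k m n → (m ℕ.* n) ℕ.^ k ≡ m ℕ.^ k ℕ.* n ℕ.^ k
*-^ zero    m n = refl
*-^ (suc k) m n = trans (cong (m ℕ.* n ℕ.*_) (*-^ k m n))
  (ℕ-solve 4 (λ m n p q → (m ⊗ₛ n) ⊗ₛ (p ⊗ₛ q) ≔ (m ⊗ₛ p) ⊗ₛ (n ⊗ₛ q)) refl m n (m ℕ.^ k) (n ℕ.^ k))

cube-mono : ∀ {p q} → 0ℚ ≤ p → p ≤ q → p * (p * (p * 1ℚ)) ≤ q * (q * (q * 1ℚ))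
cube-mono 0≤p p≤q = *-mono 0≤p (0≤* 0≤q (0≤* 0≤q 0≤1)) p≤q (*-mono 0≤p (0≤* 0≤q 0≤1) p≤q (*-monoʳ 0≤1 p≤q))
  where 0≤q = ℚ.≤-trans 0≤p p≤q

-- A rational `r < g` is at most `64 * 8⁻ᶠ`, whose fourth power is the cube of `256 * 2 ^ (-4 f)`,
-- as 64^(4/3) = 256. Hence the cubed bound follows from `m * 256 * 2 ^ (-4 f) ≤ 256 * C * suc f ^
-- k`, and powers of `suc f` become powers of the logarithm, each at the price of a factor 7.
power≤Õ : ∀ g C k f m → g <ʳ fromℚ (fromℕ 64 * ½^ (3 ℕ.* f)) → m ℕ.≤ C ℕ.* (2 ℕ.^ (4 ℕ.* f) ℕ.* suc f ℕ.^ k) →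
          Õ[1/ g ^4/3] (C ℕ.* (256 ℕ.* 7 ℕ.^ k)) k m
power≤Õ g C k f m g< m≤ r r<g = begin
  M * (M * (M * 1ℚ)) * (r * (r * (r * (r * 1ℚ))))
    ≤⟨ *-monoˡ (0≤* 0≤M (0≤* 0≤M (0≤* 0≤M 0≤1))) (fourth-mono r≤) ⟩
  M * (M * (M * 1ℚ)) * (s * (s * (s * (s * 1ℚ))))
    ≡⟨ cong (λ h → M * (M * (M * 1ℚ)) * ((fromℕ 64 * h) * ((fromℕ 64 * h) * ((fromℕ 64 * h) * ((fromℕ 64 * h) * 1ℚ))))) (½^3f f) ⟩
  _ ≡⟨ regroup M u ⟩
  A * (A * (A * 1ℚ))
    ≤⟨ cube-mono (0≤* 0≤M (0≤* (0≤fromℕ 256) 0≤u⁴)) A≤ ⟩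
  B * (B * (B * 1ℚ)) ∎
  where
  open ℚ.≤-Reasoning
  L : ℕ
  L = log⁺1/ r
  M u s A B : ℚ
  M = fromℕ m
  u = ½^ f
  s = fromℕ 64 * ½^ (3 ℕ.* f)
  A = M * (fromℕ 256 * ((u * u) * (u * u)))
  B = fromℕ (C ℕ.* (256 ℕ.* 7 ℕ.^ k) ℕ.* L ℕ.^ k)
  0≤M : 0ℚ ≤ M
  0≤M = 0≤fromℕ m
  0≤u⁴ : 0ℚ ≤ (u * u) * (u * u)
  0≤u⁴ = 0≤p² (u * u)
  r≤ : r ≤ s
  r≤ = <ʳ-trans g r<g g<
  fourth-mono : r ≤ s → r * (r * (r * (r * 1ℚ))) ≤ s * (s * (s * (s * 1ℚ)))
  fourth-mono r≤s = *-mono 0≤r (0≤* 0≤s (0≤* 0≤s (0≤* 0≤s 0≤1))) r≤s (cube-mono 0≤r r≤s)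
    where
    0≤r = ℚ.<⇒≤ (ℚ.positive⁻¹ r)
    0≤s = ℚ.≤-trans 0≤r r≤s
  regroup : ∀ M u → let s = fromℕ 64 * (u * (u * u)) ; A = M * (fromℕ 256 * ((u * u) * (u * u))) in
            M * (M * (M * 1ℚ)) * (s * (s * (s * (s * 1ℚ)))) ≡ A * (A * (A * 1ℚ))
  regroup = solve 2 (λ M u → let s = con (fromℕ 64) :* (u :* (u :* u)) ; A = M :* (con (fromℕ 256) :* ((u :* u) :* (u :* u))) in
    M :* (M :* (M :* con 1ℚ)) :* (s :* (s :* (s :* (s :* con 1ℚ)))) := A :* (A :* (A :* con 1ℚ))) refl
  reassociate : ∀ c d s l → c ℕ.* (d ℕ.* (s ℕ.* l)) ≡ (c ℕ.* (d ℕ.* s)) ℕ.* l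
  reassociate = ℕ-solve 4 (λ c d s l → c ⊗ₛ (d ⊗ₛ (s ⊗ₛ l)) ≔ (c ⊗ₛ (d ⊗ₛ s)) ⊗ₛ l) refl
  ½^4f : ½^ (4 ℕ.* f) ≡ (u * u) * (u * u)
  ½^4f = trans (cong ½^_ (ℕ-solve 1 (λ f → ℕ-con 4 ⊗ₛ f ≔ (f ⊕ₛ f) ⊕ₛ (f ⊕ₛ f)) refl f)) (trans (½^-+ (f ℕ.+ f) (f ℕ.+ f)) (cong (λ p → p * p) (½^-+ f f)))
  A≤ : A ≤ B
  A≤ = begin
    M * (fromℕ 256 * ((u * u) * (u * u)))
      ≤⟨ *-monoʳ (0≤* (0≤fromℕ 256) 0≤u⁴) (fromℕ-mono m≤) ⟩
    fromℕ (C ℕ.* (2 ℕ.^ (4 ℕ.* f) ℕ.* suc f ℕ.^ k)) * (fromℕ 256 * ((u * u) * (u * u)))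
      ≡⟨ cong₂ (λ a b → a * (fromℕ 256 * b)) (trans (fromℕ-* C (2 ℕ.^ (4 ℕ.* f) ℕ.* suc f ℕ.^ k)) (cong (fromℕ C *_) (fromℕ-* (2 ℕ.^ (4 ℕ.* f)) (suc f ℕ.^ k)))) (sym ½^4f) ⟩
    (fromℕ C * (fromℕ (2 ℕ.^ (4 ℕ.* f)) * fromℕ (suc f ℕ.^ k))) * (fromℕ 256 * ½^ (4 ℕ.* f))
      ≡⟨ solve 5 (λ c p q d h → (c :* (p :* q)) :* (d :* h) := (c :* (d :* q)) :* (p :* h)) refl (fromℕ C) (fromℕ (2 ℕ.^ (4 ℕ.* f))) (fromℕ (suc f ℕ.^ k)) (fromℕ 256) (½^ (4 ℕ.* f)) ⟩
    (fromℕ C * (fromℕ 256 * fromℕ (suc f ℕ.^ k))) * (fromℕ (2 ℕ.^ (4 ℕ.* f)) * ½^ (4 ℕ.* f))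
      ≡⟨ trans (cong ((fromℕ C * (fromℕ 256 * fromℕ (suc f ℕ.^ k))) *_) (2^*½^ (4 ℕ.* f))) (ℚ.*-identityʳ _) ⟩
    fromℕ C * (fromℕ 256 * fromℕ (suc f ℕ.^ k))
      ≡⟨ trans (fromℕ-* C (256 ℕ.* suc f ℕ.^ k)) (cong (fromℕ C *_) (fromℕ-* 256 (suc f ℕ.^ k))) ⟨
    fromℕ (C ℕ.* (256 ℕ.* suc f ℕ.^ k))
      ≤⟨ fromℕ-mono (ℕ.≤-trans (ℕ.*-monoʳ-≤ C (ℕ.*-monoʳ-≤ 256 (ℕ.≤-trans (ℕ.^-monoˡ-≤ k (level≤log⁺1/ f r r≤)) (ℕ.≤-reflexive (*-^ k 7 L)))))
                        (ℕ.≤-reflexive (reassociate C 256 (7 ℕ.^ k) (L ℕ.^ k)))) ⟩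
    B ∎

2^[6f+8] : ∀ f → 2 ℕ.^ (6 ℕ.* f ℕ.+ 8) ≡ (2 ℕ.^ (3 ℕ.* f) ℕ.* 2 ℕ.^ (3 ℕ.* f)) ℕ.* 256
2^[6f+8] f = trans (cong (2 ℕ.^_) (ℕ-solve 1 (λ f → ℕ-con 6 ⊗ₛ f ⊕ₛ ℕ-con 8 ≔ (ℕ-con 3 ⊗ₛ f ⊕ₛ ℕ-con 3 ⊗ₛ f) ⊕ₛ ℕ-con 8) refl f))
  (trans (ℕ.^-distribˡ-+-* 2 (3 ℕ.* f ℕ.+ 3 ℕ.* f) 8) (cong (ℕ._* 256) (ℕ.^-distribˡ-+-* 2 (3 ℕ.* f) (3 ℕ.* f))))

power≤/g² : ∀ g f → g <ʳ fromℚ (fromℕ 64 * ½^ (3 ℕ.* f)) → ∀ {m} → m ℕ.≤ 2 ℕ.^ (6 ℕ.* f ℕ.+ 8) → m ≤ (64 ℕ.* 64 ℕ.* 256) /g²[ g ]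
power≤/g² g f g< {m} m≤ r r<g = begin
  fromℕ m * (r * (r * 1ℚ))
    ≤⟨ *-mono (0≤fromℕ m) (0≤* 0≤s (0≤* 0≤s 0≤1)) (fromℕ-mono m≤) (*-mono 0≤r (0≤* 0≤s 0≤1) r≤ (*-monoʳ 0≤1 r≤)) ⟩
  fromℕ (2 ℕ.^ (6 ℕ.* f ℕ.+ 8)) * ((fromℕ 64 * h) * ((fromℕ 64 * h) * 1ℚ))
    ≡⟨ cong (_* ((fromℕ 64 * h) * ((fromℕ 64 * h) * 1ℚ))) (trans (cong fromℕ (2^[6f+8] f)) (trans (fromℕ-* (P ℕ.* P) 256) (cong (_* fromℕ 256) (fromℕ-* P P)))) ⟩
  ((fromℕ P * fromℕ P) * fromℕ 256) * ((fromℕ 64 * h) * ((fromℕ 64 * h) * 1ℚ))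
    ≡⟨ solve 2 (λ p h → ((p :* p) :* con (fromℕ 256)) :* ((con (fromℕ 64) :* h) :* ((con (fromℕ 64) :* h) :* con 1ℚ)) := con (fromℕ 64 * fromℕ 64 * fromℕ 256) :* ((p :* h) :* (p :* h))) refl (fromℕ P) h ⟩
  (fromℕ 64 * fromℕ 64 * fromℕ 256) * ((fromℕ P * h) * (fromℕ P * h))
    ≡⟨ cong (λ e → (fromℕ 64 * fromℕ 64 * fromℕ 256) * (e * e)) (2^*½^ (3 ℕ.* f)) ⟩
  (fromℕ 64 * fromℕ 64 * fromℕ 256) * (1ℚ * 1ℚ)
    ≡⟨⟩
  fromℕ (64 ℕ.* 64 ℕ.* 256) ∎
  where
  open ℚ.≤-Reasoning
  P : ℕ
  P = 2 ℕ.^ (3 ℕ.* f)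
  h : ℚ
  h = ½^ (3 ℕ.* f)
  r≤ : r ≤ fromℕ 64 * h
  r≤ = <ʳ-trans g r<g g<
  0≤r : 0ℚ ≤ r
  0≤r = ℚ.<⇒≤ (ℚ.positive⁻¹ r)
  0≤s : 0ℚ ≤ fromℕ 64 * h
  0≤s = ℚ.≤-trans 0≤r r≤

-- The family of protocols and its complexity

levelOf : Tolerances → ℕ
levelOf t = Parameters.level (parameters t)

gap<levelOf : ∀ t → gap t <ʳ fromℚ (fromℕ 64 * ½^ (3 ℕ.* levelOf t))
gap<levelOf t = Parameters.gap< (parameters t)

guaranteed : ∀ t n .{{_ : NonZero n}} σ → Guarantee n (levelOf t) σ (Parameters.threshold (parameters t))
guaranteed t n σ = Protocol.guarantee n (levelOf t) σ (Parameters.threshold (parameters t))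

protocol : (t : Tolerances) → OneRoundIPP t
protocol t = record
  { verifierBits = λ n σ → seedBits n (levelOf t)
  ; proverBits   = λ n σ → replyBits (levelOf t)
  ; verifier     = λ n σ → Guarantee.verifier (guaranteed t n σ)
  ; honestProver = λ n σ → Guarantee.prover (guaranteed t n σ)
  ; completeness = λ n σ x close → Guarantee.complete (guaranteed t n σ) x (Parameters.inner (parameters t) (deviation x σ) close)
  ; soundness    = λ n σ x far → Guarantee.sound (guaranteed t n σ) x (Parameters.outer (parameters t) (deviation x σ) far)
  }

protocol-verifier : ∀ t n .{{_ : NonZero n}} → VerifierQueries (protocol t) n
                    (ℕ._≤ (50 ℕ.* 3072) ℕ.* (2 ℕ.^ (4 ℕ.* levelOf t) ℕ.* suc (levelOf t) ℕ.^ 3))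
protocol-verifier t n σ = Guarantee.verifier-queries (guaranteed t n σ)

protocol-prover : ∀ t n .{{_ : NonZero n}} → HonestProverQueries (protocol t) n (ℕ._≤ 2 ℕ.^ (6 ℕ.* levelOf t ℕ.+ 8))
protocol-prover t n σ x _ = Guarantee.prover-queries (guaranteed t n σ) x

-- The `6 f + 8` seed bits that depend on the gap need not be O(log n), so they are charged together
-- with the reply.
reply≤ : ∀ f → ((4 ℕ.* f ℕ.+ 8) ℕ.+ 2 ℕ.* f) ℕ.+ replyBits f ℕ.≤ 520 ℕ.* (2 ℕ.^ (4 ℕ.* f) ℕ.* suc f ℕ.^ 1)
reply≤ f = begin
  ((4 ℕ.* f ℕ.+ 8) ℕ.+ 2 ℕ.* f) ℕ.+ replyBits f
    ≤⟨ ℕ.+-mono-≤ index≤ (ℕ.≤-reflexive (trans (tableSize≡ (4 ℕ.* f ℕ.+ 8) (suc (2 ℕ.* f))) (cong (ℕ._* suc (2 ℕ.* f)) (ℕ.^-distribˡ-+-* 2 (4 ℕ.* f) 8)))) ⟩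
  8 ℕ.* (T ℕ.* suc f) ℕ.+ (T ℕ.* 256) ℕ.* suc (2 ℕ.* f)
    ≤⟨ ℕ.+-monoʳ-≤ (8 ℕ.* (T ℕ.* suc f)) (ℕ.*-monoʳ-≤ (T ℕ.* 256) (ℕ.≤-trans (ℕ.n≤1+n (suc (2 ℕ.* f))) (ℕ.≤-reflexive (sym (ℕ.*-suc 2 f))))) ⟩
  8 ℕ.* (T ℕ.* suc f) ℕ.+ (T ℕ.* 256) ℕ.* (2 ℕ.* suc f)
    ≡⟨ collect T (suc f) ⟩
  520 ℕ.* (T ℕ.* suc f ℕ.^ 1) ∎
  where
  open ℕ.≤-Reasoning
  T : ℕ
  T = 2 ℕ.^ (4 ℕ.* f)
  index≤ : (4 ℕ.* f ℕ.+ 8) ℕ.+ 2 ℕ.* f ℕ.≤ 8 ℕ.* (T ℕ.* suc f)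
  index≤ = ℕ.≤-trans (ℕ.m≤m+n _ (2 ℕ.* f)) (ℕ.≤-trans (ℕ.≤-reflexive (eight f)) (ℕ.*-monoʳ-≤ 8 (ℕ.m≤n*m (suc f) T {{ℕ.m^n≢0 2 (4 ℕ.* f)}})))
    where
    eight : ∀ f → ((4 ℕ.* f ℕ.+ 8) ℕ.+ 2 ℕ.* f) ℕ.+ 2 ℕ.* f ≡ 8 ℕ.* suc f
    eight = ℕ-solve 1 (λ f → ((ℕ-con 4 ⊗ₛ f ⊕ₛ ℕ-con 8) ⊕ₛ ℕ-con 2 ⊗ₛ f) ⊕ₛ ℕ-con 2 ⊗ₛ f ≔ ℕ-con 8 ⊗ₛ (ℕ-con 1 ⊕ₛ f)) refl
  collect : ∀ t s → 8 ℕ.* (t ℕ.* s) ℕ.+ (t ℕ.* 256) ℕ.* (2 ℕ.* s) ≡ 520 ℕ.* (t ℕ.* s ℕ.^ 1)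
  collect = ℕ-solve 2 (λ t s → ℕ-con 8 ⊗ₛ (t ⊗ₛ s) ⊕ₛ (t ⊗ₛ ℕ-con 256) ⊗ₛ (ℕ-con 2 ⊗ₛ s) ≔ ℕ-con 520 ⊗ₛ (t ⊗ₛ (s ⊗ₛ ℕ-con 1))) refl

protocol-communication : ∀ t n .{{_ : NonZero n}} → Communication (protocol t) n λ c →
  ∃[ a ] ∃[ b ] c ℕ.≤ a ℕ.+ b × a ℕ.≤ (520 ℕ.* (256 ℕ.* 7 ℕ.^ 1)) ℕ.* ⌈log₂ n ⌉ × Õ[1/ gap t ^4/3] (520 ℕ.* (256 ℕ.* 7 ℕ.^ 1)) 1 b
-- The logarithmic term consists of the `2 ⌈log₂ n ⌉` seed bits that depend on `n`. Its factor 2 is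
-- enlarged to the constant of the other term, since the statement has one constant for both.
protocol-communication t n σ = m ℕ.+ m , k ℕ.+ p , ℕ.≤-reflexive (regroup m k p) , twice {520 ℕ.* (256 ℕ.* 7 ℕ.^ 1)} (from-yes (2 ℕ.≤? 520 ℕ.* (256 ℕ.* 7 ℕ.^ 1))) , power≤Õ (gap t) 520 1 (levelOf t) (k ℕ.+ p) (gap<levelOf t) (reply≤ (levelOf t))
  where
  m k p : ℕ
  m = ⌈log₂ n ⌉
  k = (4 ℕ.* levelOf t ℕ.+ 8) ℕ.+ 2 ℕ.* levelOf t
  p = replyBits (levelOf t)
  regroup : ∀ m k p → ((m ℕ.+ k) ℕ.+ m) ℕ.+ p ≡ (m ℕ.+ m) ℕ.+ (k ℕ.+ p)
  regroup = ℕ-solve 3 (λ m k p → ((m ⊕ₛ k) ⊕ₛ m) ⊕ₛ p ≔ (m ⊕ₛ m) ⊕ₛ (k ⊕ₛ p)) refl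
  twice : ∀ {c} → 2 ℕ.≤ c → m ℕ.+ m ℕ.≤ c ℕ.* m
  twice 2≤c = ℕ.≤-trans (ℕ.≤-reflexive (cong (m ℕ.+_) (sym (ℕ.+-identityʳ m)))) (ℕ.*-monoˡ-≤ m 2≤c)

-- Lets the polylogarithmic factor be absorbed when `2 ^ (4 f)` is raised to `2 ^ (6 f)`, so that
-- the verifier is covered by the regime `1/g² = o(n)`. The inductive step multiplies by 4, which
-- beats the growth of the cube only from 2 on; hence the two base cases.
cube≤2*4^ : ∀ f → suc f ℕ.^ 3 ℕ.≤ 2 ℕ.* (2 ℕ.^ f ℕ.* 2 ℕ.^ f)
cube≤2*4^ zero          = ℕ.s≤s ℕ.z≤n
cube≤2*4^ (suc zero)    = ℕ.≤-refl
cube≤2*4^ (suc (suc f)) = begin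
  (3 ℕ.+ f) ℕ.^ 3                                          ≤⟨ ℕ.m≤m+n _ _ ⟩
  (3 ℕ.+ f) ℕ.^ 3 ℕ.+ (5 ℕ.+ f ℕ.* (21 ℕ.+ f ℕ.* (15 ℕ.+ 3 ℕ.* f)))   ≡⟨ expand f ⟩
  4 ℕ.* (2 ℕ.+ f) ℕ.^ 3                                    ≤⟨ ℕ.*-monoʳ-≤ 4 (cube≤2*4^ (suc f)) ⟩
  4 ℕ.* (2 ℕ.* (2 ℕ.^ suc f ℕ.* 2 ℕ.^ suc f))              ≡⟨ regroup (2 ℕ.^ suc f) ⟩
  2 ℕ.* (2 ℕ.^ suc (suc f) ℕ.* 2 ℕ.^ suc (suc f))          ∎
  where
  open ℕ.≤-Reasoning
  expand : ∀ f → (3 ℕ.+ f) ℕ.^ 3 ℕ.+ (5 ℕ.+ f ℕ.* (21 ℕ.+ f ℕ.* (15 ℕ.+ 3 ℕ.* f))) ≡ 4 ℕ.* (2 ℕ.+ f) ℕ.^ 3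
  expand = ℕ-solve 1 (λ f → (ℕ-con 3 ⊕ₛ f) ⊗ₛ ((ℕ-con 3 ⊕ₛ f) ⊗ₛ ((ℕ-con 3 ⊕ₛ f) ⊗ₛ ℕ-con 1)) ⊕ₛ (ℕ-con 5 ⊕ₛ f ⊗ₛ (ℕ-con 21 ⊕ₛ f ⊗ₛ (ℕ-con 15 ⊕ₛ ℕ-con 3 ⊗ₛ f)))
    ≔ ℕ-con 4 ⊗ₛ ((ℕ-con 2 ⊕ₛ f) ⊗ₛ ((ℕ-con 2 ⊕ₛ f) ⊗ₛ ((ℕ-con 2 ⊕ₛ f) ⊗ₛ ℕ-con 1)))) refl
  regroup : ∀ p → 4 ℕ.* (2 ℕ.* (p ℕ.* p)) ≡ 2 ℕ.* ((2 ℕ.* p) ℕ.* (2 ℕ.* p))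
  regroup = ℕ-solve 1 (λ p → ℕ-con 4 ⊗ₛ (ℕ-con 2 ⊗ₛ (p ⊗ₛ p)) ≔ ℕ-con 2 ⊗ₛ ((ℕ-con 2 ⊗ₛ p) ⊗ₛ (ℕ-con 2 ⊗ₛ p))) refl

module _ (B : ℕ) .{{_ : NonZero B}} (δ : ℚ) .{{_ : Positive δ}} where
  private
    D : ℕ
    D = B ℕ.* (64 ℕ.* 64)
    instance
      D≢0 : NonZero D
      D≢0 = ℕ.m*n≢0 B (64 ℕ.* 64)

  -- The regime is evaluated at `64 * ½^ (3 f)`, a rational above the gap, and yields the square of
  -- 64; the divisor cancels this and the constant `B` of the query bound.
  share : ℚ
  share = δ * (ℤ.+ 1 / D)

  share-positive : Positive share
  share-positive = ℚ.pos*pos⇒pos δ (ℤ.+ 1 / D) {{ℚ.normalize-pos 1 D}}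

  power-sublinear : ∀ g f n → g <ʳ fromℚ (fromℕ 64 * ½^ (3 ℕ.* f)) → 1/g²[ g ]≤ (share * fromℕ n) →
                    ∀ {m} → m ℕ.≤ B ℕ.* (2 ℕ.^ (3 ℕ.* f) ℕ.* 2 ℕ.^ (3 ℕ.* f)) → fromℕ m ≤ δ * fromℕ n
  power-sublinear g f n g< 1/g²≤ {m} m≤ = begin
    fromℕ m
      ≤⟨ fromℕ-mono m≤ ⟩
    fromℕ (B ℕ.* (P ℕ.* P))
      ≡⟨ trans (fromℕ-* B (P ℕ.* P)) (trans (cong (fromℕ B *_) (fromℕ-* P P)) (sym (ℚ.*-identityʳ _))) ⟩
    (fromℕ B * (fromℕ P * fromℕ P)) * 1ℚ
      ≤⟨ *-monoˡ (0≤* (0≤fromℕ B) (0≤p² (fromℕ P))) (1/g²≤ (fromℕ 64 * h) g<) ⟩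
    (fromℕ B * (fromℕ P * fromℕ P)) * (share * fromℕ n * ((fromℕ 64 * h) * ((fromℕ 64 * h) * 1ℚ)))
      ≡⟨ regroup (fromℕ B) (fromℕ P) δ (ℤ.+ 1 / D) (fromℕ n) h (fromℕ 64) ⟩
    (δ * fromℕ n) * (((ℤ.+ 1 / D) * (fromℕ B * (fromℕ 64 * fromℕ 64))) * ((fromℕ P * h) * (fromℕ P * h)))
      ≡⟨ cong₂ (λ c e → (δ * fromℕ n) * (((ℤ.+ 1 / D) * c) * (e * e))) (trans (cong (fromℕ B *_) (sym (fromℕ-* 64 64))) (sym (fromℕ-* B (64 ℕ.* 64)))) (2^*½^ (3 ℕ.* f)) ⟩
    (δ * fromℕ n) * (((ℤ.+ 1 / D) * fromℕ D) * (1ℚ * 1ℚ))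
      ≡⟨ cong (λ c → (δ * fromℕ n) * (c * (1ℚ * 1ℚ))) (/-as-* 1 D) ⟩
    (δ * fromℕ n) * (1ℚ * (1ℚ * 1ℚ))
      ≡⟨ ℚ.*-identityʳ (δ * fromℕ n) ⟩
    δ * fromℕ n ∎
    where
    open ℚ.≤-Reasoning
    P : ℕ
    P = 2 ℕ.^ (3 ℕ.* f)
    h : ℚ
    h = ½^ (3 ℕ.* f)
    regroup : ∀ b p d i n h s → (b * (p * p)) * (d * i * n * ((s * h) * ((s * h) * 1ℚ))) ≡ (d * n) * ((i * (b * (s * s))) * ((p * h) * (p * h)))
    regroup = solve 7 (λ b p d i n h s → (b :* (p :* p)) :* (d :* i :* n :* ((s :* h) :* ((s :* h) :* con 1ℚ))) := (d :* n) :* ((i :* (b :* (s :* s))) :* ((p :* h) :* (p :* h)))) refl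

2^4f*4^f : ∀ f → 2 ℕ.^ (4 ℕ.* f) ℕ.* (2 ℕ.^ f ℕ.* 2 ℕ.^ f) ≡ 2 ℕ.^ (3 ℕ.* f) ℕ.* 2 ℕ.^ (3 ℕ.* f)
2^4f*4^f f = begin
  2 ℕ.^ (4 ℕ.* f) ℕ.* (2 ℕ.^ f ℕ.* 2 ℕ.^ f)     ≡⟨ cong (2 ℕ.^ (4 ℕ.* f) ℕ.*_) (ℕ.^-distribˡ-+-* 2 f f) ⟨
  2 ℕ.^ (4 ℕ.* f) ℕ.* 2 ℕ.^ (f ℕ.+ f)           ≡⟨ ℕ.^-distribˡ-+-* 2 (4 ℕ.* f) (f ℕ.+ f) ⟨
  2 ℕ.^ (4 ℕ.* f ℕ.+ (f ℕ.+ f))                 ≡⟨ cong (2 ℕ.^_) (ℕ-solve 1 (λ f → ℕ-con 4 ⊗ₛ f ⊕ₛ (f ⊕ₛ f) ≔ ℕ-con 3 ⊗ₛ f ⊕ₛ ℕ-con 3 ⊗ₛ f) refl f) ⟩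
  2 ℕ.^ (3 ℕ.* f ℕ.+ 3 ℕ.* f)                   ≡⟨ ℕ.^-distribˡ-+-* 2 (3 ℕ.* f) (3 ℕ.* f) ⟩
  2 ℕ.^ (3 ℕ.* f) ℕ.* 2 ℕ.^ (3 ℕ.* f)           ∎
  where open ≡-Reasoning

verifier≤power : ∀ c f → c ℕ.* (2 ℕ.^ (4 ℕ.* f) ℕ.* suc f ℕ.^ 3) ℕ.≤ (c ℕ.* 2) ℕ.* (2 ℕ.^ (3 ℕ.* f) ℕ.* 2 ℕ.^ (3 ℕ.* f))
verifier≤power c f = begin
  c ℕ.* (T ℕ.* suc f ℕ.^ 3)                                     ≤⟨ ℕ.*-monoʳ-≤ c (ℕ.*-monoʳ-≤ T (cube≤2*4^ f)) ⟩
  c ℕ.* (T ℕ.* (2 ℕ.* (2 ℕ.^ f ℕ.* 2 ℕ.^ f)))                   ≡⟨ regroup c T (2 ℕ.^ f ℕ.* 2 ℕ.^ f) ⟩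
  (c ℕ.* 2) ℕ.* (T ℕ.* (2 ℕ.^ f ℕ.* 2 ℕ.^ f))                   ≡⟨ cong ((c ℕ.* 2) ℕ.*_) (2^4f*4^f f) ⟩
  (c ℕ.* 2) ℕ.* (2 ℕ.^ (3 ℕ.* f) ℕ.* 2 ℕ.^ (3 ℕ.* f))           ∎
  where
  open ℕ.≤-Reasoning
  T : ℕ
  T = 2 ℕ.^ (4 ℕ.* f)
  regroup : ∀ c t p → c ℕ.* (t ℕ.* (2 ℕ.* p)) ≡ (c ℕ.* 2) ℕ.* (t ℕ.* p)
  regroup = ℕ-solve 3 (λ c t p → c ⊗ₛ (t ⊗ₛ (ℕ-con 2 ⊗ₛ p)) ≔ (c ⊗ₛ ℕ-con 2) ⊗ₛ (t ⊗ₛ p)) refl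

prover≤power : ∀ f c → 256 ℕ.≤ c → 2 ℕ.^ (6 ℕ.* f ℕ.+ 8) ℕ.≤ c ℕ.* (2 ℕ.^ (3 ℕ.* f) ℕ.* 2 ℕ.^ (3 ℕ.* f))
prover≤power f c 256≤c = ℕ.≤-trans
  (ℕ.≤-reflexive (trans (2^[6f+8] f) (ℕ.*-comm (2 ℕ.^ (3 ℕ.* f) ℕ.* 2 ℕ.^ (3 ℕ.* f)) 256)))
  (ℕ.*-monoˡ-≤ (2 ℕ.^ (3 ℕ.* f) ℕ.* 2 ℕ.^ (3 ℕ.* f)) 256≤c)

module _ (c : ℕ) .{{_ : NonZero c}} (256≤ : 256 ℕ.≤ c ℕ.* 2)
         (verifier : ∀ t n .{{_ : NonZero n}} → VerifierQueries (protocol t) n (ℕ._≤ c ℕ.* (2 ℕ.^ (4 ℕ.* levelOf t) ℕ.* suc (levelOf t) ℕ.^ 3)))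
         (R : Regime) where
  open Regime R using (tolerances; size≢0) renaming (size to length)
  private
    instance
      2c≢0 : NonZero (c ℕ.* 2)
      2c≢0 = ℕ.m*n≢0 c 2

    level : ℕ → ℕ
    level j = levelOf (tolerances j)

  protocol-sublinear : 1/g²=o[n] R → DoublySublinear R protocol
  protocol-sublinear 1/g²=o δ = J , λ j J≤j →
      (λ σ x r reply → small j J≤j (ℕ.≤-trans (verifier (tolerances j) (length j) σ x r reply) (verifier≤power c (level j))))
    , (λ σ x close r s → small j J≤j (ℕ.≤-trans (protocol-prover (tolerances j) (length j) σ x close r s) (prover≤power (level j) (c ℕ.* 2) 256≤)))
    where
    eventually : Eventually λ j → 1/g²[ gap (tolerances j) ]≤ (share (c ℕ.* 2) δ * fromℕ (length j))
    eventually = 1/g²=o (share (c ℕ.* 2) δ) {{share-positive (c ℕ.* 2) δ}}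
    J : ℕ
    J = proj₁ eventually
    small : ∀ j → J ℕ.≤ j → ∀ {m} → m ℕ.≤ (c ℕ.* 2) ℕ.* (2 ℕ.^ (3 ℕ.* level j) ℕ.* 2 ℕ.^ (3 ℕ.* level j)) → fromℕ m ≤ δ * fromℕ (length j)
    small j J≤j = power-sublinear (c ℕ.* 2) δ (gap (tolerances j)) (level j) (length j) (gap<levelOf (tolerances j)) (proj₂ eventually j J≤j)

theorem3p4 : Σ[ Π ∈ ((t : Tolerances) → OneRoundIPP t) ]
    (∃[ C ] ∃[ k ] ∀ (t : Tolerances) (n : ℕ) .{{_ : NonZero n}} →
    VerifierQueries (Π t) n (Õ[1/ gap t ^4/3] C k)) ×
    (∃[ C ] ∀ (t : Tolerances) (n : ℕ) .{{_ : NonZero n}} →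
    HonestProverQueries (Π t) n (_≤ C /g²[ gap t ])) ×
    (∃[ C ] ∃[ k ] ∀ (t : Tolerances) (n : ℕ) .{{_ : NonZero n}} →
    Communication (Π t) n λ c →
    ∃[ a ] ∃[ b ] c ℕ.≤ a ℕ.+ b × a ℕ.≤ C ℕ.* ⌈log₂ n ⌉ × Õ[1/ gap t ^4/3] C k b) ×
    (∀ (R : Regime) → 1/g²=o[n] R → DoublySublinear R Π)
theorem3p4 =
    protocol
  , ((50 ℕ.* 3072) ℕ.* (256 ℕ.* 7 ℕ.^ 3) , 3 , λ t n σ x r reply →
      power≤Õ (gap t) (50 ℕ.* 3072) 3 (levelOf t) _ (gap<levelOf t) (protocol-verifier t n σ x r reply))
  , (64 ℕ.* 64 ℕ.* 256 , λ t n σ x close r s →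
      power≤/g² (gap t) (levelOf t) (gap<levelOf t) (protocol-prover t n σ x close r s))
  , (520 ℕ.* (256 ℕ.* 7 ℕ.^ 1) , 1 , λ t n → protocol-communication t n)
  , protocol-sublinear (50 ℕ.* 3072) (from-yes (256 ℕ.≤? 50 ℕ.* 3072 ℕ.* 2)) protocol-verifier
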